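{- Let $p \geq 1$ and $q \geq 3$ be integers with $q$ even. If $H$ is a graph that is $L$-cospectral with the jellyfish graph $JFG(p,q)$, then $H$ is DLS; that is, every graph $L$-cospectral with $H$ is isomorphic to $H$.
   Context: All graphs are finite and simple. For a graph $G$ with adjacency matrix $A(G)$ and diagonal degree matrix $D(G)$, the Laplacian matrix is $L(G)=D(G)-A(G)$ (its spectrum is the Laplacian spectrum). Two graphs are $L$-cospectral if their Laplacian matrices have the same spectrum; a graph is DLS if every graph $L$-cospectral with it is isomorphic to it. The jellyfish graph $JFG(p,q)$ is obtained from a cycle $C_q$ and $q$ copies of the star $K_{1,p}$ by identifying each vertex of $C_q$ with the center (vertex of maximum degree) of its own copy of $K_{1,p}$; it has $q(p+1)$ vertices and $q(p+1)$ edges. -}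

module Defs where

open import Data.Bool using (Bool; true; false; _∧_; _∨_; not; if_then_else_)
open import Data.Nat as ℕ using (ℕ; zero; suc; _≡ᵇ_)
open import Data.Fin as Fin using (Fin; zero; suc; toℕ; punchIn; remQuot)
open import Data.Integer as ℤ using (ℤ; +_; -_; _-_)
open import Data.Product using (Σ; _×_; _,_; proj₁; proj₂)
open import Relation.Nullary using (does; yes; no)
open import Data.Empty using (⊥-elim)
import Data.Bool.Properties
open import Data.Bool.Properties using (∨-comm)
open import Relation.Binary.PropositionalEquality using (_≡_; refl; cong; cong₂) renaming (sym to ≡-sym)
open import Function.Bundles using (_↔_; Inverse)

_==_ : ∀ {n} → Fin n → Fin n → Bool
i == j = does (i Fin.≟ j)

record Graph (n : ℕ) : Set where
  field
    adj    : Fin n → Fin n → Bool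
    sym    : ∀ i j → adj i j ≡ adj j i
    irrefl : ∀ i → adj i i ≡ false
open Graph public

∑ : ∀ {n} → (Fin n → ℤ) → ℤ
∑ {zero}  f = + 0
∑ {suc n} f = f zero ℤ.+ ∑ (λ i → f (suc i))

count : ∀ {n} → (Fin n → Bool) → ℕ
count {zero}  f = 0
count {suc n} f = (if f zero then 1 else 0) ℕ.+ count (λ i → f (suc i))

degree : ∀ {n} → Graph n → Fin n → ℕ
degree G i = count (adj G i)

laplacian : ∀ {n} → Graph n → Fin n → Fin n → ℤ
laplacian G i j =
  (if i == j then + degree G i else + 0) - (if adj G i j then + 1 else + 0)

sign : ℕ → ℤ
sign zero = + 1
sign (suc k) = - sign k

det : ∀ {n} → (Fin n → Fin n → ℤ) → ℤ
det {zero}  M = + 1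
det {suc n} M =
  ∑ (λ j → sign (toℕ j) ℤ.* (M zero j ℤ.* det (λ r c → M (suc r) (punchIn j c))))

lapCharPoly : ∀ {n} → Graph n → ℤ → ℤ
lapCharPoly G t =
  det (λ i j → (if i == j then t else + 0) - laplacian G i j)

-- L-cospectral: same Laplacian characteristic polynomial
-- (equality as polynomial functions on ℤ, equivalently as polynomials)
LCospectral : ∀ {n m} → Graph n → Graph m → Set
LCospectral G H = ∀ (t : ℤ) → lapCharPoly G t ≡ lapCharPoly H t

Iso : ∀ {n m} → Graph n → Graph m → Set
Iso {n} {m} G H =
  Σ (Fin n ↔ Fin m) λ σ →
    ∀ i j → adj G i j ≡ adj H (Inverse.to σ i) (Inverse.to σ j)

DLS : ∀ {n} → Graph n → Set
DLS {n} G = ∀ (m : ℕ) (K : Graph m) → LCospectral K G → Iso K G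

-- Jellyfish graph JFG(p,q).
-- Vertex (i , a) with i : Fin q (cycle position), a : Fin (suc p);
-- a = 0 is the cycle vertex / star centre, a = 1..p are the pendant leaves.

cycAdj : (q : ℕ) → ℕ → ℕ → Bool
cycAdj q i i' = (suc i ≡ᵇ i') ∨ ((suc i ≡ᵇ q) ∧ (i' ≡ᵇ 0))

isZero : ∀ {k} → Fin k → Bool
isZero zero    = true
isZero (suc _) = false

jfBase : (p q : ℕ) → Fin q × Fin (suc p) → Fin q × Fin (suc p) → Bool
jfBase p q (i , a) (i' , b) =
     (isZero a ∧ isZero b ∧ cycAdj q (toℕ i) (toℕ i'))
  ∨ ((i == i') ∧ isZero a ∧ not (isZero b))

==-refl : ∀ {n} (i : Fin n) → (i == i) ≡ true
==-refl i with i Fin.≟ i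
... | yes _ = refl
... | no ¬p = ⊥-elim (¬p refl)

==-sym : ∀ {n} (i j : Fin n) → (i == j) ≡ (j == i)
==-sym i j with i Fin.≟ j | j Fin.≟ i
... | yes _ | yes _ = refl
... | no _  | no _  = refl
... | yes p | no ¬q = ⊥-elim (¬q (≡-sym p))
... | no ¬p | yes q = ⊥-elim (¬p (≡-sym q))

same : ∀ {q p} → Fin q × Fin (suc p) → Fin q × Fin (suc p) → Bool
same (i , a) (i' , b) = (i == i') ∧ (a == b)

same-sym : ∀ {q p} (x y : Fin q × Fin (suc p)) → same x y ≡ same y x
same-sym (i , a) (i' , b) = cong₂ _∧_ (==-sym i i') (==-sym a b)

same-refl : ∀ {q p} (x : Fin q × Fin (suc p)) → same x x ≡ true
same-refl (i , a) rewrite ==-refl i | ==-refl a = refl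

jfAdjPair : (p q : ℕ) → Fin q × Fin (suc p) → Fin q × Fin (suc p) → Bool
jfAdjPair p q x y =
  (jfBase p q x y ∨ jfBase p q y x) ∧ not (same x y)

jfAdj : (p q : ℕ) → Fin (q ℕ.* suc p) → Fin (q ℕ.* suc p) → Bool
jfAdj p q u v = jfAdjPair p q (remQuot (suc p) u) (remQuot (suc p) v)

jfAdj-sym : ∀ p q u v → jfAdj p q u v ≡ jfAdj p q v u
jfAdj-sym p q u v =
  cong₂ _∧_ (∨-comm (jfBase p q x y) (jfBase p q y x)) (cong not (same-sym x y))
  where
  x = remQuot (suc p) u
  y = remQuot (suc p) v

jfAdj-irrefl : ∀ p q u → jfAdj p q u u ≡ false
jfAdj-irrefl p q u
  rewrite same-refl (remQuot {q} (suc p) u) = Data.Bool.Properties.∧-zeroʳ _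

JFG : (p q : ℕ) → Graph (q ℕ.* suc p)
JFG p q = record
  { adj    = jfAdj p q
  ; sym    = jfAdj-sym p q
  ; irrefl = jfAdj-irrefl p q
  }

{-# OPTIONS --safe #-}

-- A graph H that is L-cospectral with JFG(p,q) is isomorphic to it, so any two such graphs are isomorphic.
-- From χ(t) = det(tI - L) one gets det(I - sL) for all integers s; since f(s) = det(I - sM) satisfies
-- f'(s) = - tr(adj(I - sM) M) and adj(I - sM) = f(s)(I + sM + s²M² + ...), reducing modulo powers of s
-- recovers tr M, tr M² and tr M³.  Hence the sums of d, d² and d³ - 6 t agree, d ranging over the degrees
-- and t being the number of triangles.  Replacing a column of -L by ones gives a determinant D with
-- χ(t) = t (D + O(t)).  It vanishes for disconnected graphs, so H is connected with as many edges as
-- vertices, that is, unicyclic; for such graphs |D| = n g with g the girth, so H has girth q.  As q is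
-- even, neither graph has a triangle, and then Σ (d - 1)(d - p - 2)² is determined by the spectrum.  Its
-- terms are nonnegative and it is zero for JFG(p,q), so all degrees of H are 1 or p + 2, and the q cycle
-- vertices with p leaves each exhaust H.

module Submission where

open import Defs
open import Data.Bool using (Bool; true; false; if_then_else_; _∧_; _∨_; not)
import Data.Bool.Properties as Bool
open import Data.Nat as ℕ using (ℕ; zero; suc; _≤_)
import Data.Nat.Properties as ℕ
import Data.Nat.Divisibility as ℕ
open import Data.Fin as Fin using (Fin; zero; suc; toℕ; fromℕ; inject₁; punchIn; punchOut; combine; remQuot; _↑ˡ_; _↑ʳ_)
import Data.Fin.Properties as Fin
open import Data.Integer as ℤ using (ℤ; +_; -_; _+_; _*_; _-_; ∣_∣)
import Data.Integer.Properties as ℤ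
open import Data.Integer.Divisibility.Signed
open import Data.Integer.Tactic.RingSolver using (solve-∀)
open import Data.Product using (Σ; ∃₂; _×_; _,_; proj₁; proj₂)
open import Data.Sum using (_⊎_; inj₁; inj₂)
open import Data.Vec using (Vec; []; _∷_; zipWith)
open import Data.Empty using (⊥; ⊥-elim)
open import Relation.Nullary using (Dec; yes; no; does; ¬_)
open import Relation.Nullary.Decidable using (dec-true; dec-false; _×-dec_; ¬?)
open import Relation.Binary.PropositionalEquality hiding ([_]) renaming (sym to ≡-sym)
open import Function using (_∘_)
open import Function.Bundles using (Inverse; mk↔ₛ′)
open import Function.Properties.Inverse using (↔-sym; ↔-trans)
open import Relation.Binary.Definitions using (tri<; tri≈; tri>)
open ≡-Reasoning

-- No eigenvalues or rational numbers occur: every identity is between integers, and an integer is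
-- shown to be zero by showing that every positive integer divides it. Congruences modulo `t` for
-- all `t` thus take the place of comparing coefficients and of differentiating. Cospectrality
-- speaks of det(tI - L), the traces need det(I - sL); viewing det(aI - bL) as a binary form joins
-- the two and also recovers the order of the graph. Since `det` expands along the first row,
-- multilinearity and alternation are natural for columns, and all later matrix arguments are column
-- operations. The value n g is obtained from lattices: integer matrices whose columns span the same
-- lattice have determinants dividing each other. A unicyclic graph is handled through a function
-- `f` with edges {v, f v}; girth, absence of triangles and isomorphisms are all read off `f`. In
-- the cubic, the simple root 1 is harmless because every degree is at least 1, and the double root
-- p + 2 keeps the sign.

private
  variable
    n m : ℕ

-- Finite sums and indicators

==-≡ : {i j : Fin n} → i ≡ j → (i == j) ≡ true
==-≡ {i = i} {j} = dec-true (i Fin.≟ j)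

==-≢ : {i j : Fin n} → i ≢ j → (i == j) ≡ false
==-≢ {i = i} {j} = dec-false (i Fin.≟ j)

∑-cong : {f g : Fin n → ℤ} → (∀ i → f i ≡ g i) → ∑ f ≡ ∑ g
∑-cong {zero}  eq = refl
∑-cong {suc n} eq = cong₂ _+_ (eq zero) (∑-cong (eq ∘ suc))

∑-zero : {f : Fin n → ℤ} → (∀ i → f i ≡ + 0) → ∑ f ≡ + 0
∑-zero {zero}  eq = refl
∑-zero {suc n} eq = cong₂ _+_ (eq zero) (∑-zero (eq ∘ suc))

∑-linear : ∀ a b (f g : Fin n → ℤ) → ∑ (λ i → a * f i + b * g i) ≡ a * ∑ f + b * ∑ g
∑-linear {zero} a b f g = ring a b
  where
  ring : ∀ a b → + 0 ≡ a * + 0 + b * + 0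
  ring = solve-∀
∑-linear {suc n} a b f g =
  trans (cong (ℤ._+_ (a * f zero + b * g zero)) (∑-linear a b (f ∘ suc) (g ∘ suc)))
        (ring a b (f zero) (g zero) (∑ (f ∘ suc)) (∑ (g ∘ suc)))
  where
  ring : ∀ a b x y u v → a * x + b * y + (a * u + b * v) ≡ a * (x + u) + b * (y + v)
  ring = solve-∀

∑-+ : (f g : Fin n → ℤ) → ∑ (λ i → f i + g i) ≡ ∑ f + ∑ g
∑-+ {zero} f g = refl
∑-+ {suc n} f g =
  trans (cong (ℤ._+_ (f zero + g zero)) (∑-+ (f ∘ suc) (g ∘ suc))) (ring (f zero) (g zero) _ _)
  where
  ring : ∀ x y u v → x + y + (u + v) ≡ x + u + (y + v)
  ring = solve-∀

∑-- : (f g : Fin n → ℤ) → ∑ (λ i → f i - g i) ≡ ∑ f - ∑ g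
∑-- {zero} f g = refl
∑-- {suc n} f g =
  trans (cong (ℤ._+_ (f zero - g zero)) (∑-- (f ∘ suc) (g ∘ suc))) (ring (f zero) (g zero) _ _)
  where
  ring : ∀ x y u v → x - y + (u - v) ≡ x + u - (y + v)
  ring = solve-∀

∑-*ˡ : ∀ c (f : Fin n → ℤ) → ∑ (λ i → c * f i) ≡ c * ∑ f
∑-*ˡ {zero} c f = ≡-sym (ℤ.*-zeroʳ c)
∑-*ˡ {suc n} c f = trans (cong (ℤ._+_ (c * f zero)) (∑-*ˡ c (f ∘ suc))) (≡-sym (ℤ.*-distribˡ-+ c _ _))

∑-*ʳ : ∀ c (f : Fin n → ℤ) → ∑ (λ i → f i * c) ≡ ∑ f * c
∑-*ʳ c f = trans (∑-cong (λ i → ℤ.*-comm (f i) c)) (trans (∑-*ˡ c f) (ℤ.*-comm c _))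

∑-swap : (f : Fin n → Fin m → ℤ) → ∑ (λ i → ∑ (f i)) ≡ ∑ (λ j → ∑ (λ i → f i j))
∑-swap {zero} {m} f = ≡-sym (∑-zero {m} (λ _ → refl))
∑-swap {suc n} f =
  trans (cong (ℤ._+_ (∑ (f zero))) (∑-swap (f ∘ suc))) (≡-sym (∑-+ (f zero) _))

∑-single : {f : Fin n → ℤ} (j : Fin n) → (∀ i → i ≢ j → f i ≡ + 0) → ∑ f ≡ f j
∑-single {f = f} zero eq =
  trans (cong (ℤ._+_ (f zero)) (∑-zero (λ i → eq (suc i) λ ()))) (ℤ.+-identityʳ _)
∑-single {f = f} (suc j) eq =
  trans (cong₂ _+_ (eq zero λ ()) (∑-single j (λ i i≢j → eq (suc i) (i≢j ∘ Fin.suc-injective))))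
        (ℤ.+-identityˡ _)

∑-mod : ∀ {t} (f g : Fin n → ℤ) → (∀ i → t ∣ (f i - g i)) → t ∣ (∑ f - ∑ g)
∑-mod {zero} f g eq = divides (+ 0) refl
∑-mod {suc n} {t} f g eq =
  subst (t ∣_) (ring (f zero) (g zero) _ _) (∣m∣n⇒∣m+n (eq zero) (∑-mod (f ∘ suc) (g ∘ suc) (eq ∘ suc)))
  where
  ring : ∀ x y u v → x - y + (u - v) ≡ x + u - (y + v)
  ring = solve-∀

∑-nonneg : {f : Fin n → ℤ} → (∀ i → + 0 ℤ.≤ f i) → + 0 ℤ.≤ ∑ f
∑-nonneg {zero}  p = ℤ.≤-refl
∑-nonneg {suc n} p = ℤ.+-mono-≤ (p zero) (∑-nonneg (p ∘ suc))

+-≡0 : ∀ {x y} → + 0 ℤ.≤ x → + 0 ℤ.≤ y → x + y ≡ + 0 → x ≡ + 0 × y ≡ + 0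
+-≡0 {+ zero} {+ zero} _ _ _ = refl , refl
+-≡0 {+ zero} {+ suc y} _ _ ()
+-≡0 {+ suc x} {+ y} _ _ ()

∑-nonneg-≡0 : {f : Fin n → ℤ} → (∀ i → + 0 ℤ.≤ f i) → ∑ f ≡ + 0 → ∀ i → f i ≡ + 0
∑-nonneg-≡0 p eq zero = proj₁ (+-≡0 (p zero) (∑-nonneg (p ∘ suc)) eq)
∑-nonneg-≡0 p eq (suc i) =
  ∑-nonneg-≡0 (p ∘ suc) (proj₂ (+-≡0 (p zero) (∑-nonneg (p ∘ suc)) eq)) i

⟦_⟧ : Bool → ℤ
⟦ b ⟧ = if b then + 1 else + 0

⟦⟧-nonneg : ∀ b → + 0 ℤ.≤ ⟦ b ⟧
⟦⟧-nonneg true  = ℤ.+≤+ ℕ.z≤n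
⟦⟧-nonneg false = ℤ.+≤+ ℕ.z≤n

δ : Fin n → Fin n → ℤ
δ i j = ⟦ i == j ⟧

δ-refl : (i : Fin n) → δ i i ≡ + 1
δ-refl i = cong ⟦_⟧ (==-refl i)

δ-≢ : {i j : Fin n} → i ≢ j → δ i j ≡ + 0
δ-≢ i≢j = cong ⟦_⟧ (==-≢ i≢j)

δ-sym : (i j : Fin n) → δ i j ≡ δ j i
δ-sym i j = cong ⟦_⟧ (==-sym i j)

if-δ : (i j : Fin n) (x : ℤ) → (if i == j then x else + 0) ≡ δ i j * x
if-δ i j x with i == j
... | true  = ≡-sym (ℤ.*-identityˡ x)
... | false = refl

∑-δ : (j : Fin n) (f : Fin n → ℤ) → ∑ (λ i → δ j i * f i) ≡ f j
∑-δ j f = trans (∑-single j (λ i i≢j → cong (_* f i) (δ-≢ (i≢j ∘ ≡-sym))))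
                (trans (cong (_* f j) (δ-refl j)) (ℤ.*-identityˡ _))

∑-δʳ : (j : Fin n) (f : Fin n → ℤ) → ∑ (λ i → δ i j * f i) ≡ f j
∑-δʳ j f = trans (∑-cong (λ i → cong (_* f i) (δ-sym i j))) (∑-δ j f)

∑-const : ∀ c → ∑ {n} (λ _ → c) ≡ + n * c
∑-const {zero}  c = refl
∑-const {suc n} c = trans (cong (ℤ._+_ (c)) (∑-const {n} c)) (ring (+ n) c)
  where
  ring : ∀ k c → c + k * c ≡ (+ 1 + k) * c
  ring = solve-∀

count-∑ : (b : Fin n → Bool) → + count b ≡ ∑ (λ i → ⟦ b i ⟧)
count-∑ {zero} b = refl
count-∑ {suc n} b with b zero
... | true  = cong (ℤ._+_ (+ 1)) (count-∑ (b ∘ suc))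
... | false = trans (count-∑ (b ∘ suc)) (≡-sym (ℤ.+-identityˡ _))

-- Determinants

Matrix : ℕ → Set
Matrix n = Fin n → Fin n → ℤ

minor : Matrix (suc n) → Fin (suc n) → Matrix n
minor M c i j = M (suc i) (punchIn c j)

expansion : Matrix (suc n) → Fin (suc n) → ℤ
expansion M c = sign (toℕ c) * (M zero c * det (minor M c))

det-cong : {M N : Matrix n} → (∀ i j → M i j ≡ N i j) → det M ≡ det N
det-cong {zero} eq = refl
det-cong {suc n} eq = ∑-cong (λ c → cong (sign (toℕ c) *_)
  (cong₂ _*_ (eq zero c) (det-cong (λ i j → eq (suc i) (punchIn c j)))))

-- In the first-row expansion the term of column `k` splits through its row entry, its minor not
-- seeing that column; every other term splits through its minor, by induction.
det-linear : (k : Fin n) (a b : ℤ) {M N P : Matrix n} →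
  (∀ i → M i k ≡ a * N i k + b * P i k) →
  (∀ i j → j ≢ k → M i j ≡ N i j) → (∀ i j → j ≢ k → M i j ≡ P i j) →
  det M ≡ a * det N + b * det P
det-linear {suc n} k a b {M} {N} {P} col offN offP =
  trans (∑-cong {f = expansion M} term) (∑-linear a b (expansion N) (expansion P))
  where
  ring₁ : ∀ s x y a b d → s * ((a * x + b * y) * d) ≡ a * (s * (x * d)) + b * (s * (y * d))
  ring₁ = solve-∀
  ring₂ : ∀ s x a b d e → s * (x * (a * d + b * e)) ≡ a * (s * (x * d)) + b * (s * (x * e))
  ring₂ = solve-∀
  term : ∀ c → sign (toℕ c) * (M zero c * det (minor M c))
             ≡ a * (sign (toℕ c) * (N zero c * det (minor N c)))
             + b * (sign (toℕ c) * (P zero c * det (minor P c)))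
  term c with c Fin.≟ k
  ... | yes refl = begin
    sign (toℕ c) * (M zero c * det (minor M c))
      ≡⟨ cong (λ x → sign (toℕ c) * (x * det (minor M c))) (col zero) ⟩
    sign (toℕ c) * ((a * N zero c + b * P zero c) * det (minor M c))
      ≡⟨ ring₁ (sign (toℕ c)) (N zero c) (P zero c) a b _ ⟩
    a * (sign (toℕ c) * (N zero c * det (minor M c)))
      + b * (sign (toℕ c) * (P zero c * det (minor M c)))
      ≡⟨ cong₂ (λ x y → a * (sign (toℕ c) * (N zero c * x)) + b * (sign (toℕ c) * (P zero c * y)))
           (det-cong (λ i j → offN (suc i) (punchIn c j) (Fin.punchInᵢ≢i c j)))
           (det-cong (λ i j → offP (suc i) (punchIn c j) (Fin.punchInᵢ≢i c j))) ⟩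
    _ ∎
  ... | no c≢k = begin
    sign (toℕ c) * (M zero c * det (minor M c))
      ≡⟨ cong (λ x → sign (toℕ c) * (M zero c * x)) ih ⟩
    sign (toℕ c) * (M zero c * (a * det (minor N c) + b * det (minor P c)))
      ≡⟨ ring₂ (sign (toℕ c)) (M zero c) a b _ _ ⟩
    a * (sign (toℕ c) * (M zero c * det (minor N c)))
      + b * (sign (toℕ c) * (M zero c * det (minor P c)))
      ≡⟨ cong₂ (λ x y → a * (sign (toℕ c) * (x * det (minor N c)))
                      + b * (sign (toℕ c) * (y * det (minor P c))))
           (offN zero c c≢k) (offP zero c c≢k) ⟩
    _ ∎
    where
    k′ : Fin n
    k′ = punchOut c≢k
    back : punchIn c k′ ≡ k
    back = Fin.punchIn-punchOut c≢k
    off : ∀ j → j ≢ k′ → punchIn c j ≢ k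
    off j j≢k′ eq = j≢k′ (Fin.punchIn-injective c j k′ (trans eq (≡-sym back)))
    ih : det (minor M c) ≡ a * det (minor N c) + b * det (minor P c)
    ih = det-linear k′ a b
      (λ i → subst (λ x → M (suc i) x ≡ a * N (suc i) x + b * P (suc i) x) (≡-sym back) (col (suc i)))
      (λ i j j≢ → offN (suc i) (punchIn c j) (off j j≢))
      (λ i j j≢ → offP (suc i) (punchIn c j) (off j j≢))

*-mod : ∀ {t} x y {u v} → t ∣ (x - y) → t ∣ (u - v) → t ∣ (x * u - y * v)
*-mod {t} x y {u} {v} p q =
  subst (t ∣_) (ring x y u v) (∣m∣n⇒∣m+n (∣m⇒∣m*n u p) (∣n⇒∣m*n y q))
  where
  ring : ∀ x y u v → (x - y) * u + y * (u - v) ≡ x * u - y * v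
  ring = solve-∀

∣0 : ∀ {t} → t ∣ + 0
∣0 = divides (+ 0) refl

-≡0 : ∀ x → x - x ≡ + 0
-≡0 = ℤ.+-inverseʳ

≡⇒mod : ∀ {t x y} → x ≡ y → t ∣ (x - y)
≡⇒mod {t} {x} refl = subst (t ∣_) (≡-sym (-≡0 x)) ∣0

det-mod : ∀ {t} (M N : Matrix n) → (∀ i j → t ∣ (M i j - N i j)) → t ∣ (det M - det N)
det-mod {zero} M N eq = ∣0
det-mod {suc n} {t} M N eq = ∑-mod (expansion M) (expansion N) (λ c →
  *-mod (sign (toℕ c)) (sign (toℕ c)) {M zero c * det (minor M c)} (≡⇒mod {x = sign (toℕ c)} refl)
    (*-mod (M zero c) (N zero c) {det (minor M c)} (eq zero c)
      (det-mod (minor M c) (minor N c) (λ i j → eq (suc i) (punchIn c j)))))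

∑-adjacent : (j : Fin n) {f : Fin (suc n) → ℤ} →
  (∀ i → i ≢ inject₁ j → i ≢ suc j → f i ≡ + 0) → f (inject₁ j) + f (suc j) ≡ + 0 → ∑ f ≡ + 0
∑-adjacent zero {f} off eq =
  trans (cong (λ x → f zero + (f (suc zero) + x)) (∑-zero (λ i → off (suc (suc i)) (λ ()) (λ ()))))
        (trans (cong (ℤ._+_ (f zero)) (ℤ.+-identityʳ _)) eq)
∑-adjacent (suc j) {f} off eq =
  cong₂ _+_ (off zero (λ ()) (λ ()))
    (∑-adjacent j (λ i p q → off (suc i) (p ∘ Fin.suc-injective) (q ∘ Fin.suc-injective)) eq)

-- Deleting a third column leaves two neighbouring columns neighbours, so a minor inherits a pair of
-- equal adjacent columns.
punchIn-adjacent : (c : Fin (suc (suc n))) (j : Fin (suc n)) → c ≢ inject₁ j → c ≢ suc j →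
  Σ (Fin n) λ k → punchIn c (inject₁ k) ≡ inject₁ j × punchIn c (suc k) ≡ suc j
punchIn-adjacent zero zero p q = ⊥-elim (p refl)
punchIn-adjacent (suc zero) zero p q = ⊥-elim (q refl)
punchIn-adjacent {suc n} (suc (suc c)) zero p q = zero , refl , refl
punchIn-adjacent zero (suc j) p q = j , refl , refl
punchIn-adjacent {suc n} (suc c) (suc j) p q
  with punchIn-adjacent c j (p ∘ cong suc) (q ∘ cong suc)
... | k , e₁ , e₂ = suc k , cong suc e₁ , cong suc e₂

-- Deleting either of two neighbouring columns gives the same list except in one place, where the
-- other of the two stands. If they are equal, the two minors coincide.
punchIn-inject₁-suc : (j k : Fin n) →
  punchIn (inject₁ j) k ≡ punchIn (suc j) k ⊎
  (punchIn (inject₁ j) k ≡ suc j × punchIn (suc j) k ≡ inject₁ j)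
punchIn-inject₁-suc zero zero = inj₂ (refl , refl)
punchIn-inject₁-suc zero (suc k) = inj₁ refl
punchIn-inject₁-suc (suc j) zero = inj₁ refl
punchIn-inject₁-suc (suc j) (suc k) with punchIn-inject₁-suc j k
... | inj₁ e = inj₁ (cong suc e)
... | inj₂ (e₁ , e₂) = inj₂ (cong suc e₁ , cong suc e₂)

-- In the first-row expansion, terms that keep both equal columns vanish by induction; the two
-- remaining terms have equal minors and opposite signs.
det-alternating-adjacent : {M : Matrix (suc n)} (j : Fin n) →
  (∀ i → M i (inject₁ j) ≡ M i (suc j)) → det M ≡ + 0
det-alternating-adjacent {suc n} {M} j eq = ∑-adjacent j off cancel
  where
  off : ∀ c → c ≢ inject₁ j → c ≢ suc j → sign (toℕ c) * (M zero c * det (minor M c)) ≡ + 0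
  off c p q with punchIn-adjacent c j p q
  ... | k , e₁ , e₂ = trans (cong (λ x → sign (toℕ c) * (M zero c * x))
          (det-alternating-adjacent {M = minor M c} k
            (λ i → trans (cong (M (suc i)) e₁) (trans (eq (suc i)) (cong (M (suc i)) (≡-sym e₂))))))
        (trans (cong (sign (toℕ c) *_) (ℤ.*-zeroʳ (M zero c))) (ℤ.*-zeroʳ (sign (toℕ c))))
  same-minors : ∀ i k → minor M (inject₁ j) i k ≡ minor M (suc j) i k
  same-minors i k with punchIn-inject₁-suc j k
  ... | inj₁ e = cong (M (suc i)) e
  ... | inj₂ (e₁ , e₂) =
    trans (cong (M (suc i)) e₁) (trans (≡-sym (eq (suc i))) (cong (M (suc i)) (≡-sym e₂)))
  ring : ∀ s x d → s * (x * d) + (- s) * (x * d) ≡ + 0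
  ring = solve-∀
  cancel : sign (toℕ (inject₁ j)) * (M zero (inject₁ j) * det (minor M (inject₁ j)))
         + - sign (toℕ j) * (M zero (suc j) * det (minor M (suc j))) ≡ + 0
  cancel = trans
    (cong₂ (λ x y → x + - sign (toℕ j) * y)
      (cong₂ (λ s y → sign s * y) (Fin.toℕ-inject₁ j) (cong₂ _*_ (eq zero) (det-cong same-minors)))
      refl)
    (ring (sign (toℕ j)) (M zero (suc j)) _)

-- Replacing a column; alternation

infixl 8 _[_≔_]
abstract
  -- Opaque, so that the index comparison never unfolds inside determinants; `≔-at` and `≔-off` are
  -- the only access to it.
  _[_≔_] : Matrix n → Fin n → (Fin n → ℤ) → Matrix n
  (M [ k ≔ w ]) i j = if j == k then w i else M i j

  ≔-at : ∀ (M : Matrix n) k w {j} i → j ≡ k → (M [ k ≔ w ]) i j ≡ w i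
  ≔-at M k w {j} i j≡k rewrite ==-≡ j≡k = refl

  ≔-off : ∀ (M : Matrix n) k w {j} i → j ≢ k → (M [ k ≔ w ]) i j ≡ M i j
  ≔-off M k w {j} i j≢k rewrite ==-≢ j≢k = refl

≔-elim : ∀ (M : Matrix n) k w (P : Fin n → Fin n → ℤ) → (∀ i → w i ≡ P i k) →
  (∀ i j → j ≢ k → M i j ≡ P i j) → ∀ i j → (M [ k ≔ w ]) i j ≡ P i j
≔-elim M k w P at off i j with j Fin.≟ k
... | yes refl = trans (≔-at M k w i refl) (at i)
... | no j≢k   = trans (≔-off M k w i j≢k) (off i j j≢k)

≔-linear : ∀ (M : Matrix n) k a b u v →
  det (M [ k ≔ (λ i → a * u i + b * v i) ]) ≡ a * det (M [ k ≔ u ]) + b * det (M [ k ≔ v ])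
≔-linear M k a b u v = det-linear k a b
  (λ i → trans (≔-at M k (λ i → a * u i + b * v i) i refl)
    (cong₂ (λ x y → a * x + b * y) (≡-sym (≔-at M k u i refl)) (≡-sym (≔-at M k v i refl))))
  (λ i j j≢k → trans (≔-off M k (λ i → a * u i + b * v i) i j≢k) (≡-sym (≔-off M k u i j≢k)))
  (λ i j j≢k → trans (≔-off M k (λ i → a * u i + b * v i) i j≢k) (≡-sym (≔-off M k v i j≢k)))

≔-cong : ∀ (M : Matrix n) k {u v} → (∀ i → u i ≡ v i) → det (M [ k ≔ u ]) ≡ det (M [ k ≔ v ])
≔-cong M k {u} {v} eq = det-cong (≔-elim M k u (M [ k ≔ v ])
  (λ i → trans (eq i) (≡-sym (≔-at M k v i refl))) (λ i j j≢k → ≡-sym (≔-off M k v i j≢k)))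

≔-+ : ∀ (M : Matrix n) k u v →
  det (M [ k ≔ (λ i → u i + v i) ]) ≡ det (M [ k ≔ u ]) + det (M [ k ≔ v ])
≔-+ M k u v = trans (≔-cong M k (λ i → cong₂ _+_ (≡-sym (ℤ.*-identityˡ (u i))) (≡-sym (ℤ.*-identityˡ (v i)))))
  (trans (≔-linear M k (+ 1) (+ 1) u v) (cong₂ _+_ (ℤ.*-identityˡ (det (M [ k ≔ u ]))) (ℤ.*-identityˡ (det (M [ k ≔ v ])))))

≔-* : ∀ (M : Matrix n) k a u → det (M [ k ≔ (λ i → a * u i) ]) ≡ a * det (M [ k ≔ u ])
≔-* M k a u = trans (≔-cong M k (λ i → ring a (u i)))
  (trans (≔-linear M k a (+ 0) u u) (≡-sym (ring a (det (M [ k ≔ u ])))))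
  where
  ring : ∀ a x → a * x ≡ a * x + + 0 * x
  ring = solve-∀

≔-0 : ∀ (M : Matrix n) k {u} → (∀ i → u i ≡ + 0) → det (M [ k ≔ u ]) ≡ + 0
≔-0 M k {u} eq = trans (≔-cong M k eq) (≔-* M k (+ 0) (λ _ → + 0))

≔-∑ : ∀ (M : Matrix n) k (c : Fin m → ℤ) (w : Fin m → Fin n → ℤ) →
  det (M [ k ≔ (λ i → ∑ (λ j → c j * w j i)) ]) ≡ ∑ (λ j → c j * det (M [ k ≔ w j ]))
≔-∑ {m = zero} M k c w = ≔-0 M k (λ _ → refl)
≔-∑ {m = suc m} M k c w =
  trans (≔-+ M k (λ i → c zero * w zero i) (λ i → ∑ (λ j → c (suc j) * w (suc j) i))) (cong₂ _+_ (≔-* M k (c zero) (w zero)) (≔-∑ M k (c ∘ suc) (w ∘ suc)))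

≔-self : ∀ (M : Matrix n) k → det (M [ k ≔ (λ i → M i k) ]) ≡ det M
≔-self M k = det-cong (≔-elim M k (λ i → M i k) M (λ i → refl) (λ _ _ _ → refl))

-- Polarization: put `u+v` in both columns and expand. Alternation is a hypothesis because the lemma
-- is first applied to adjacent columns, in order to derive alternation for arbitrary ones.
≔-swap : ∀ (M : Matrix n) {j k} u v → j ≢ k → (∀ w → det (M [ j ≔ w ] [ k ≔ w ]) ≡ + 0) →
  det (M [ j ≔ u ] [ k ≔ v ]) ≡ - det (M [ j ≔ v ] [ k ≔ u ])
≔-swap M {j} {k} u v j≢k alt = neg (≡-sym (begin
  + 0
    ≡⟨ alt u+v ⟨
  det (M [ j ≔ u+v ] [ k ≔ u+v ])
    ≡⟨ ≔-+ (M [ j ≔ u+v ]) k u v ⟩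
  det (M [ j ≔ u+v ] [ k ≔ u ]) + det (M [ j ≔ u+v ] [ k ≔ v ])
    ≡⟨ cong₂ _+_ (split u) (split v) ⟩
  (det (M [ j ≔ u ] [ k ≔ u ]) + det (M [ j ≔ v ] [ k ≔ u ]))
    + (det (M [ j ≔ u ] [ k ≔ v ]) + det (M [ j ≔ v ] [ k ≔ v ]))
    ≡⟨ cong₂ (λ x y → (x + det (M [ j ≔ v ] [ k ≔ u ])) + (det (M [ j ≔ u ] [ k ≔ v ]) + y)) (alt u) (alt v) ⟩
  (+ 0 + det (M [ j ≔ v ] [ k ≔ u ])) + (det (M [ j ≔ u ] [ k ≔ v ]) + + 0)
    ≡⟨ ring (det (M [ j ≔ v ] [ k ≔ u ])) (det (M [ j ≔ u ] [ k ≔ v ])) ⟩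
  det (M [ j ≔ u ] [ k ≔ v ]) + det (M [ j ≔ v ] [ k ≔ u ])
    ∎))
  where
  u+v = λ i → u i + v i
  ring : ∀ x y → (+ 0 + x) + (y + + 0) ≡ y + x
  ring = solve-∀
  neg : ∀ {x y} → x + y ≡ + 0 → x ≡ - y
  neg {x} {y} eq = trans (r x y) (trans (cong (_+ - y) eq) (ℤ.+-identityˡ _))
    where
    r : ∀ x y → x ≡ x + y + - y
    r = solve-∀
  comm : ∀ p q → ∀ r c → (M [ j ≔ p ] [ k ≔ q ]) r c ≡ (M [ k ≔ q ] [ j ≔ p ]) r c
  comm p q r c with c Fin.≟ k
  ... | yes refl = trans (≔-at (M [ j ≔ p ]) c q r refl)
    (≡-sym (trans (≔-off (M [ c ≔ q ]) j p r (j≢k ∘ ≡-sym)) (≔-at M c q r refl)))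
  ... | no c≢k with c Fin.≟ j
  ...   | yes refl = trans (≔-off (M [ c ≔ p ]) k q r c≢k)
    (trans (≔-at M c p r refl) (≡-sym (≔-at (M [ k ≔ q ]) c p r refl)))
  ...   | no c≢j = trans (trans (≔-off (M [ j ≔ p ]) k q r c≢k) (≔-off M j p r c≢j))
    (≡-sym (trans (≔-off (M [ k ≔ q ]) j p r c≢j) (≔-off M k q r c≢k)))
  split : ∀ w → det (M [ j ≔ u+v ] [ k ≔ w ]) ≡ det (M [ j ≔ u ] [ k ≔ w ]) + det (M [ j ≔ v ] [ k ≔ w ])
  split w = trans (det-cong (comm u+v w)) (trans (≔-+ (M [ k ≔ w ]) j u v)
    (≡-sym (cong₂ _+_ (det-cong (comm u w)) (det-cong (comm v w)))))

≔-≔-self : ∀ (M : Matrix n) j k → j ≢ k →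
  det (M [ j ≔ (λ i → M i j) ] [ k ≔ (λ i → M i k) ]) ≡ det M
≔-≔-self M j k j≢k = det-cong (≔-elim (M [ j ≔ (λ i → M i j) ]) k (λ i → M i k) M (λ _ → refl)
  (λ i c _ → ≔-elim M j (λ i → M i j) M (λ _ → refl) (λ _ _ _ → refl) i c))

-- Induction on the gap `d` between the equal columns: exchanging column `k` with its left neighbour
-- changes the sign and brings the pair one step closer.
det-alternating-< : (d : ℕ) {M : Matrix n} (j k : Fin n) → toℕ k ≡ suc (d ℕ.+ toℕ j) →
  (∀ i → M i j ≡ M i k) → det M ≡ + 0
det-alternating-< {suc n} d j zero ()
det-alternating-< {suc n} zero {M} j (suc k) p eq =
  det-alternating-adjacent {M = M} k (λ i → trans (cong (M i) (≡-sym j≡k)) (eq i))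
  where
  j≡k : j ≡ inject₁ k
  j≡k = Fin.toℕ-injective (trans (≡-sym (ℕ.suc-injective p)) (≡-sym (Fin.toℕ-inject₁ k)))
det-alternating-< {suc n} (suc d) {M} j (suc k) p eq = begin
  det M
    ≡⟨ ≔-≔-self M (inject₁ k) (suc k) k≢sk ⟨
  det (M [ inject₁ k ≔ u ] [ suc k ≔ v ])
    ≡⟨ ≔-swap M u v k≢sk (λ w → det-alternating-adjacent {M = M [ inject₁ k ≔ w ] [ suc k ≔ w ]} k (λ i →
         trans (trans (≔-off (M [ inject₁ k ≔ w ]) (suc k) w i k≢sk) (≔-at M (inject₁ k) w i refl))
               (≡-sym (≔-at (M [ inject₁ k ≔ w ]) (suc k) w i refl)))) ⟩
  - det M′
    ≡⟨ cong -_ (det-alternating-< d {M′} j (inject₁ k) toℕ-k (λ i → trans (at-j i)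
         (≡-sym (trans (≔-off (M [ inject₁ k ≔ v ]) (suc k) u i k≢sk) (≔-at M (inject₁ k) v i refl))))) ⟩
  + 0 ∎
  where
  u v : Fin (suc n) → ℤ
  u i = M i (inject₁ k)
  v i = M i (suc k)
  M′ = M [ inject₁ k ≔ v ] [ suc k ≔ u ]
  toℕ-k : toℕ (inject₁ k) ≡ suc (d ℕ.+ toℕ j)
  toℕ-k = trans (Fin.toℕ-inject₁ k) (ℕ.suc-injective p)
  k≢sk : inject₁ k ≢ suc k
  k≢sk e = ℕ.1+n≢n (≡-sym (trans (≡-sym (Fin.toℕ-inject₁ k)) (cong toℕ e)))
  j≢k : j ≢ inject₁ k
  j≢k e = ℕ.m≢1+n+m (toℕ j) (trans (cong toℕ e) toℕ-k)
  j≢sk : j ≢ suc k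
  j≢sk e = ℕ.m≢1+n+m (toℕ j) (trans (cong toℕ e) p)
  at-j : ∀ i → M′ i j ≡ M i (suc k)
  at-j i = trans (≔-off (M [ inject₁ k ≔ v ]) (suc k) u i j≢sk)
    (trans (≔-off M (inject₁ k) v i j≢k) (eq i))

det-alternating : {M : Matrix n} {j k : Fin n} → j ≢ k → (∀ i → M i j ≡ M i k) → det M ≡ + 0
det-alternating {M = M} {j} {k} j≢k eq with Fin.<-cmp j k
... | tri< j<k _ _ = det-alternating-< _ {M} j k (≡-sym (trans (≡-sym (ℕ.+-suc _ _)) (ℕ.m∸n+n≡m j<k))) eq
... | tri≈ _ j≡k _ = ⊥-elim (j≢k j≡k)
... | tri> _ _ k<j = det-alternating-< _ {M} k j (≡-sym (trans (≡-sym (ℕ.+-suc _ _)) (ℕ.m∸n+n≡m k<j))) (≡-sym ∘ eq)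

≔-alternating : ∀ (M : Matrix n) {j k} → j ≢ k → det (M [ k ≔ (λ i → M i j) ]) ≡ + 0
≔-alternating M {j} {k} j≢k = det-alternating {M = M [ k ≔ (λ i → M i j) ]} j≢k
  (λ i → trans (≔-off M k (λ i → M i j) i j≢k) (≡-sym (≔-at M k (λ i → M i j) i refl)))

-- Only the term j = k survives, the others having a repeated column. It is always applied with
-- `c k` equal to 1, as a column operation that leaves the determinant unchanged.
det-combination : ∀ (M : Matrix n) k (c : Fin n → ℤ) →
  det (M [ k ≔ (λ i → ∑ (λ j → c j * M i j)) ]) ≡ c k * det M
det-combination M k c = begin
  det (M [ k ≔ (λ i → ∑ (λ j → c j * M i j)) ])
    ≡⟨ ≔-∑ M k c (λ j i → M i j) ⟩
  ∑ (λ j → c j * det (M [ k ≔ (λ i → M i j) ]))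
    ≡⟨ ∑-single k (λ j j≢k → trans (cong (c j *_) (≔-alternating M j≢k)) (ℤ.*-zeroʳ (c j))) ⟩
  c k * det (M [ k ≔ (λ i → M i k) ])
    ≡⟨ cong (c k *_) (≔-self M k) ⟩
  c k * det M ∎

det-identity : det (δ {n}) ≡ + 1
det-identity {zero} = refl
det-identity {suc n} = trans (∑-single zero off) (trans
  (cong (λ x → + 1 * (+ 1 * x)) (trans (det-cong {M = minor δ zero} suc-δ) (det-identity {n}))) refl)
  where
  off : ∀ (c : Fin (suc n)) → c ≢ zero → sign (toℕ c) * (δ zero c * det (minor δ c)) ≡ + 0
  off zero p = ⊥-elim (p refl)
  off (suc c) p = ℤ.*-zeroʳ (sign (toℕ (suc c)))
  suc-δ : ∀ i j → δ (suc i) (suc j) ≡ δ {n} i j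
  suc-δ i j with i Fin.≟ j
  ... | yes _ = refl
  ... | no _  = refl

≟-cases : ∀ {A : Set} (i j : Fin n) → (i ≡ j → A) → (i ≢ j → A) → A
≟-cases i j f g with i Fin.≟ j
... | yes i≡j = f i≡j
... | no i≢j  = g i≢j

-- Divisibility of determinants by column lattices

swap-columns : ∀ (M : Matrix n) {j k} → j ≢ k →
  det (M [ j ≔ (λ i → M i k) ] [ k ≔ (λ i → M i j) ]) ≡ - det M
swap-columns M {j} {k} j≢k = trans
  (≔-swap M (λ i → M i k) (λ i → M i j) j≢k (λ w →
    det-alternating {M = M [ j ≔ w ] [ k ≔ w ]} j≢k (λ i →
      trans (trans (≔-off (M [ j ≔ w ]) k w i j≢k) (≔-at M j w i refl))
            (≡-sym (≔-at (M [ j ≔ w ]) k w i refl)))))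
  (cong -_ (≔-≔-self M j k j≢k))

-- The determinant is ± det S if `φ` is a permutation and 0 otherwise. The proof sorts the columns:
-- positions below `k` are already in place and `d` remain. If some column `j` shows column `k` of
-- `S`, it is exchanged into position `k`.
columns-divides : (S : Matrix n) (d k : ℕ) → k ℕ.+ d ≡ n → (M : Matrix n) (φ : Fin n → Fin n) →
  (∀ i j → M i j ≡ S i (φ j)) → (∀ j → toℕ j ℕ.< k → φ j ≡ j) → det S ∣ det M
columns-divides {n} S zero k k≡n M φ cols fix =
  subst (det S ∣_) (det-cong (λ i j → ≡-sym (trans (cols i j) (cong (S i) (fix j (lt j)))))) ∣-refl
  where
  lt : ∀ j → toℕ j ℕ.< k
  lt j = subst (toℕ j ℕ.<_) (≡-sym (trans (≡-sym (ℕ.+-identityʳ k)) k≡n)) (Fin.toℕ<n j)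
columns-divides {zero} S (suc d) k k≡n M φ cols fix = ⊥-elim (ℕ.m+1+n≢0 k k≡n)
columns-divides {suc n} S (suc d) k k≡n M φ cols fix with Fin.any? (λ j → φ j Fin.≟ κ)
  where
  κ = Fin.fromℕ< (subst (k ℕ.<_) k≡n (ℕ.m<m+n k (ℕ.s≤s ℕ.z≤n)))
... | no ∄ = subst (det S ∣_) (≡-sym vanish) ∣0
  where
  κ = Fin.fromℕ< (subst (k ℕ.<_) k≡n (ℕ.m<m+n k (ℕ.s≤s ℕ.z≤n)))
  κ≢ : ∀ j → κ ≢ φ j
  κ≢ j e = ∄ (j , ≡-sym e)
  -- A map `φ` that misses the value `κ` must repeat another one, which gives two equal columns.
  vanish : det M ≡ + 0
  vanish with Fin.pigeonhole (ℕ.n<1+n n) (λ j → punchOut (κ≢ j))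
  ... | a , b , a<b , e = det-alternating {M = M} (Fin.<⇒≢ a<b) (λ i → trans (cols i a)
    (trans (cong (S i) (Fin.punchOut-injective (κ≢ a) (κ≢ b) e)) (≡-sym (cols i b))))
... | yes (j , φj≡κ) with j Fin.≟ κ
  where
  κ = Fin.fromℕ< (subst (k ℕ.<_) k≡n (ℕ.m<m+n k (ℕ.s≤s ℕ.z≤n)))
...   | yes refl = columns-divides S d (suc k) (trans (≡-sym (ℕ.+-suc k d)) k≡n) M φ cols fix′
  where
  κ : Fin (suc n)
  κ = Fin.fromℕ< (subst (k ℕ.<_) k≡n (ℕ.m<m+n k (ℕ.s≤s ℕ.z≤n)))
  fix′ : ∀ i → toℕ i ℕ.< suc k → φ i ≡ i
  fix′ i (ℕ.s≤s i≤k) with ℕ.m≤n⇒m<n∨m≡n i≤k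
  ... | inj₁ i<k = fix i i<k
  ... | inj₂ refl = subst (λ x → φ x ≡ x) (Fin.toℕ-injective (Fin.toℕ-fromℕ< _)) φj≡κ
...   | no j≢κ = subst (det S ∣_) (trans (cong -_ (swap-columns M j≢κ)) (ℤ.neg-involutive (det M)))
  (∣m⇒∣-m (columns-divides S d (suc k) (trans (≡-sym (ℕ.+-suc k d)) k≡n)
    (M [ j ≔ (λ i → M i κ) ] [ κ ≔ (λ i → M i j) ]) φ′ cols′ fix′))
  where
  κ : Fin (suc n)
  κ = Fin.fromℕ< (subst (k ℕ.<_) k≡n (ℕ.m<m+n k (ℕ.s≤s ℕ.z≤n)))
  φ′ : Fin (suc n) → Fin (suc n)
  φ′ i = if i == κ then κ else (if i == j then φ κ else φ i)
  φ′-κ : φ′ κ ≡ κ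
  φ′-κ rewrite ==-refl κ = refl
  φ′-j : φ′ j ≡ φ κ
  φ′-j rewrite ==-≢ j≢κ | ==-refl j = refl
  φ′-off : ∀ i → i ≢ κ → i ≢ j → φ′ i ≡ φ i
  φ′-off i p q rewrite ==-≢ p | ==-≢ q = refl
  cols′ : ∀ i c → (M [ j ≔ (λ i → M i κ) ] [ κ ≔ (λ i → M i j) ]) i c ≡ S i (φ′ c)
  cols′ = ≔-elim (M [ j ≔ (λ i → M i κ) ]) κ (λ i → M i j) (λ i c → S i (φ′ c))
    (λ i → trans (cols i j) (cong (S i) (trans φj≡κ (≡-sym φ′-κ))))
    (λ i c c≢κ → ≔-off-j i c c≢κ)
    where
    ≔-off-j : ∀ i c → c ≢ κ → (M [ j ≔ (λ i → M i κ) ]) i c ≡ S i (φ′ c)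
    ≔-off-j i c c≢κ = ≟-cases c j
      (λ { refl → trans (≔-at M j (λ i → M i κ) i refl)
        (trans (cols i κ) (cong (S i) (≡-sym φ′-j))) })
      (λ c≢j → trans (≔-off M j (λ i → M i κ) i c≢j)
        (trans (cols i c) (cong (S i) (≡-sym (φ′-off c c≢κ c≢j)))))
  toℕ-κ : toℕ κ ≡ k
  toℕ-κ = Fin.toℕ-fromℕ< _
  fix′ : ∀ i → toℕ i ℕ.< suc k → φ′ i ≡ i
  fix′ i (ℕ.s≤s i≤k) = ≟-cases i κ (λ { refl → φ′-κ }) (λ i≢κ → ≟-cases i j
    (λ { refl → ⊥-elim (j≢κ (trans (≡-sym (fix i (i<k i≢κ))) φj≡κ)) })
    (λ i≢j → trans (φ′-off i i≢κ i≢j) (fix i (i<k i≢κ))))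
    where
    i<k : i ≢ κ → toℕ i ℕ.< k
    i<k i≢κ = ℕ.≤∧≢⇒< i≤k (λ e → i≢κ (Fin.toℕ-injective (trans e (≡-sym toℕ-κ))))

InSpan : Matrix n → (Fin n → ℤ) → Set
InSpan {n} S w = Σ (Fin n → ℤ) λ c → ∀ i → w i ≡ ∑ (λ j → c j * S i j)

∣∑ : ∀ {t} (f : Fin n → ℤ) → (∀ i → t ∣ f i) → t ∣ ∑ f
∣∑ {zero} f p = ∣0
∣∑ {suc n} f p = ∣m∣n⇒∣m+n (p zero) (∣∑ (f ∘ suc) (p ∘ suc))

-- Interpolates between lattice vectors (columns below `k`) and actual columns of `S` (the others).
-- Expanding the last lattice vector by multilinearity turns it into columns of `S` and lowers `k`.
partial-span-divides : (S : Matrix n) (k : ℕ) → k ℕ.≤ n → (M : Matrix n) (φ : Fin n → Fin n) →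
  (∀ j → toℕ j ℕ.< k → InSpan S (λ i → M i j)) → (∀ i j → k ℕ.≤ toℕ j → M i j ≡ S i (φ j)) →
  det S ∣ det M
partial-span-divides {n} S zero _ M φ _ cols =
  columns-divides S n 0 refl M φ (λ i j → cols i j ℕ.z≤n) (λ _ ())
partial-span-divides {n} S (suc k) k<n M φ inSpan cols =
  subst (det S ∣_) (trans (≡-sym (≔-∑ M κ c (λ l i → S i l)))
    (trans (≔-cong M κ (λ i → ≡-sym (proj₂ span-κ i))) (≔-self M κ)))
    (∣∑ (λ l → c l * det (M [ κ ≔ (λ i → S i l) ])) (λ l → ∣n⇒∣m*n (c l) (rec l)))
  where
  κ : Fin n
  κ = Fin.fromℕ< k<n
  toℕ-κ : toℕ κ ≡ k
  toℕ-κ = Fin.toℕ-fromℕ< k<n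
  span-κ : InSpan S (λ i → M i κ)
  span-κ = inSpan κ (subst (ℕ._< suc k) (≡-sym toℕ-κ) (ℕ.n<1+n k))
  c = proj₁ span-κ
  rec : ∀ l → det S ∣ det (M [ κ ≔ (λ i → S i l) ])
  rec l = partial-span-divides S k (ℕ.<⇒≤ k<n) (M [ κ ≔ (λ i → S i l) ])
    (λ j → if j == κ then l else φ j) below above
    where
    below : ∀ j → toℕ j ℕ.< k → InSpan S (λ i → (M [ κ ≔ (λ i → S i l) ]) i j)
    below j j<k with inSpan j (ℕ.m<n⇒m<1+n j<k)
    ... | d , eq = d , λ i → trans (≔-off M κ (λ i → S i l) i j≢κ) (eq i)
      where
      j≢κ : j ≢ κ
      j≢κ e = ℕ.<-irrefl (trans (cong toℕ e) toℕ-κ) j<k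
    above : ∀ i j → k ℕ.≤ toℕ j → (M [ κ ≔ (λ i → S i l) ]) i j ≡ S i (if j == κ then l else φ j)
    above i j k≤j with j Fin.≟ κ
    ... | yes j≡κ = ≔-at M κ (λ i → S i l) i j≡κ
    ... | no j≢κ = trans (≔-off M κ (λ i → S i l) i j≢κ)
      (cols i j (ℕ.≤∧≢⇒< k≤j (λ e → j≢κ (Fin.toℕ-injective (trans (≡-sym e) (≡-sym toℕ-κ))))))

-- This stands in for det (S C) = det S · det C. Used in both directions, it gives equal absolute
-- values for two matrices with the same column lattice.
span-divides : (S M : Matrix n) → (∀ j → InSpan S (λ i → M i j)) → det S ∣ det M
span-divides {n} S M inSpan = partial-span-divides S n ℕ.≤-refl M (λ j → j) (λ j _ → inSpan j)
  (λ i j n≤j → ⊥-elim (ℕ.<-irrefl refl (ℕ.<-≤-trans (Fin.toℕ<n j) n≤j)))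

module _ {S : Matrix n} where

  span-cong : ∀ {u v} → (∀ i → u i ≡ v i) → InSpan S u → InSpan S v
  span-cong eq (c , p) = c , λ i → trans (≡-sym (eq i)) (p i)

  span-column : ∀ j → InSpan S (λ i → S i j)
  span-column j = δ j , λ i → ≡-sym (∑-δ j (S i))

  span-+ : ∀ {u v} → InSpan S u → InSpan S v → InSpan S (λ i → u i + v i)
  span-+ (c , p) (d , q) = (λ j → c j + d j) , λ i → trans (cong₂ _+_ (p i) (q i))
    (trans (≡-sym (∑-+ (λ j → c j * S i j) (λ j → d j * S i j)))
      (∑-cong (λ j → ≡-sym (ℤ.*-distribʳ-+ (S i j) (c j) (d j)))))

  span-* : ∀ a {u} → InSpan S u → InSpan S (λ i → a * u i)
  span-* a (c , p) = (λ j → a * c j) , λ i → trans (cong (a *_) (p i))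
    (trans (≡-sym (∑-*ˡ a (λ j → c j * S i j))) (∑-cong (λ j → ≡-sym (ℤ.*-assoc a (c j) (S i j)))))

  span-- : ∀ {u v} → InSpan S u → InSpan S v → InSpan S (λ i → u i - v i)
  span-- {u} {v} p q = span-cong (λ i → cong (ℤ._+_ (u i)) (ℤ.-1*i≡-i (v i)))
    (span-+ {u} {λ i → - + 1 * v i} p (span-* (- + 1) {v} q))

  span-∑ : (w : Fin m → Fin n → ℤ) → (∀ l → InSpan S (w l)) → InSpan S (λ i → ∑ (λ l → w l i))
  span-∑ {m = zero} w p = (λ _ → + 0) , λ i → ≡-sym (∑-zero {n} (λ _ → refl))
  span-∑ {m = suc m} w p =
    span-+ {w zero} {λ i → ∑ (λ l → w (suc l) i)} (p zero) (span-∑ (w ∘ suc) (p ∘ suc))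

-- Coefficients of the characteristic polynomial

-- A nonzero `x` is not divisible by ∣x∣ + 1. Through this lemma, congruences modulo all positive
-- integers become equalities.
multiples-of-all : ∀ {x} → (∀ t → + suc t ∣ x) → x ≡ + 0
multiples-of-all {x} p with ∣ x ∣ in eq
... | zero  = ℤ.∣i∣≡0⇒i≡0 eq
... | suc k = ⊥-elim (ℕ.>⇒∤ (ℕ.n<1+n (suc k)) (subst (suc (suc k) ℕ.∣_) eq (∣⇒∣ᵤ (p (suc k)))))

*-cancel-suc : ∀ t {x} → + suc t * x ≡ + 0 → x ≡ + 0
*-cancel-suc t {x} eq = ℤ.*-cancelˡ-≡ (+ suc t) x (+ 0) (trans eq (≡-sym (ℤ.*-zeroʳ (+ suc t))))

-- Σ cₖ aᵏ bᵈ⁻ᵏ, with the coefficient c₀ at the head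
form : ∀ {d} → Vec ℤ (suc d) → ℤ → ℤ → ℤ
form (c ∷ []) a b = c
form {suc d} (c ∷ cs@(_ ∷ _)) a b = c * b ℤ.^ suc d + a * form cs a b

Form : ℕ → (ℤ → ℤ → ℤ) → Set
Form d F = Σ (Vec ℤ (suc d)) λ cs → ∀ a b → F a b ≡ form cs a b

form-zero : ∀ d → Form d (λ _ _ → + 0)
form-zero zero = + 0 ∷ [] , λ a b → refl
form-zero (suc d) with form-zero d
... | c ∷ cs , p = + 0 ∷ c ∷ cs , λ a b →
  trans (ring (b ℤ.^ suc d) a) (cong (λ x → (+ 0) * b ℤ.^ suc d + a * x) (p a b))
  where
  ring : ∀ x a → + 0 ≡ + 0 * x + a * + 0
  ring = solve-∀

form-linear : ∀ {d F G} x y → Form d F → Form d G → Form d (λ a b → x * F a b + y * G a b)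
form-linear x y (cs , p) (ds , q) =
  zipWith (λ c d → x * c + y * d) cs ds ,
  λ a b → trans (cong₂ (λ u v → x * u + y * v) (p a b) (q a b)) (go cs ds a b)
  where
  ring : ∀ x y c e β a u v →
    x * (c * β + a * u) + y * (e * β + a * v) ≡ (x * c + y * e) * β + a * (x * u + y * v)
  ring = solve-∀
  go : ∀ {d} (cs ds : Vec ℤ (suc d)) a b →
    x * form cs a b + y * form ds a b ≡ form (zipWith (λ c d → x * c + y * d) cs ds) a b
  go (c ∷ []) (e ∷ []) a b = refl
  go {suc d} (c ∷ cs@(_ ∷ _)) (e ∷ ds@(_ ∷ _)) a b =
    trans (ring x y c e (b ℤ.^ suc d) a (form cs a b) (form ds a b))
          (cong (λ u → (x * c + y * e) * b ℤ.^ suc d + a * u) (go cs ds a b))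

form-*ˡ : ∀ {d F} → Form d F → Form (suc d) (λ a b → a * F a b)
form-*ˡ {d} (c ∷ cs , p) = + 0 ∷ c ∷ cs , λ a b →
  trans (cong (a *_) (p a b)) (ring (b ℤ.^ suc d) (a * form (c ∷ cs) a b))
  where
  ring : ∀ x y → y ≡ + 0 * x + y
  ring = solve-∀

form-*ʳ : ∀ {d F} → Form d F → Form (suc d) (λ a b → b * F a b)
form-*ʳ (cs , p) = shift cs , λ a b → trans (cong (b *_) (p a b)) (go cs a b)
  where
  shift : ∀ {d} → Vec ℤ (suc d) → Vec ℤ (suc (suc d))
  shift (c ∷ []) = c ∷ + 0 ∷ []
  shift (c ∷ cs@(_ ∷ _)) = c ∷ shift cs
  ring₁ : ∀ a b c → b * c ≡ c * (b * + 1) + a * + 0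
  ring₁ = solve-∀
  ring₂ : ∀ a b c β u → b * (c * β + a * u) ≡ c * (b * β) + a * (b * u)
  ring₂ = solve-∀
  go : ∀ {d} (cs : Vec ℤ (suc d)) a b → b * form cs a b ≡ form (shift cs) a b
  go (c ∷ []) a b = ring₁ a b c
  go (c ∷ e ∷ []) a b = trans (ring₂ a b c (b ℤ.^ 1) e) (cong (λ u → c * (b * b ℤ.^ 1) + a * u) (go (e ∷ []) a b))
  go {suc d} (c ∷ cs@(_ ∷ _ ∷ _)) a b =
    trans (ring₂ a b c (b ℤ.^ suc d) (form cs a b))
          (cong (λ u → c * (b * b ℤ.^ suc d) + a * u) (go cs a b))

form-cong : ∀ {d F G} → (∀ a b → F a b ≡ G a b) → Form d G → Form d F
form-cong eq (cs , p) = cs , λ a b → trans (eq a b) (p a b)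

form-∑ : ∀ {d} (F : Fin n → ℤ → ℤ → ℤ) → (∀ i → Form d (F i)) → Form d (λ a b → ∑ (λ i → F i a b))
form-∑ {zero} F p = form-zero _
form-∑ {suc n} F p = form-cong (λ a b → ring (F zero a b) (∑ (λ i → F (suc i) a b)))
  (form-linear (+ 1) (+ 1) (p zero) (form-∑ (F ∘ suc) (p ∘ suc)))
  where
  ring : ∀ x y → x + y ≡ + 1 * x + + 1 * y
  ring = solve-∀

-- Homogeneity in both variables is the point: values at b = 1, which the characteristic polynomial
-- gives, then determine the values at a = 1, from which the traces are extracted.
det-form : (P Q : Matrix n) → Form n (λ a b → det (λ i j → a * P i j + b * Q i j))
det-form {zero} P Q = + 1 ∷ [] , λ _ _ → refl
det-form {suc n} P Q = form-∑ _ λ c → form-cong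
  (λ a b → ring (sign (toℕ c)) a b (P zero c) (Q zero c) (D c a b))
  (form-linear (sign (toℕ c) * P zero c) (sign (toℕ c) * Q zero c)
    (form-*ˡ (det-form (minor P c) (minor Q c))) (form-*ʳ (det-form (minor P c) (minor Q c))))
  where
  D : Fin (suc n) → ℤ → ℤ → ℤ
  D c a b = det (λ i j → a * minor P c i j + b * minor Q c i j)
  ring : ∀ s a b p q d → s * ((a * p + b * q) * d) ≡ (s * p) * (a * d) + (s * q) * (b * d)
  ring = solve-∀

1^ : ∀ k → (+ 1) ℤ.^ k ≡ + 1
1^ zero = refl
1^ (suc k) = trans (ℤ.*-identityˡ ((+ 1) ℤ.^ k)) (1^ k)

form-at-1 : ∀ {d} c (cs : Vec ℤ (suc d)) t → form (c ∷ cs) t (+ 1) ≡ c + t * form cs t (+ 1)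
form-at-1 {d} c cs@(_ ∷ _) t =
  cong (λ x → x + t * form cs t (+ 1)) (trans (cong (c *_) (1^ (suc d))) (ℤ.*-identityʳ c))

-- Modulo `t` the form reduces to its constant coefficient, for every positive `t`.
form-zero-head : ∀ {d} c (cs : Vec ℤ (suc d)) e → (∀ t → form (c ∷ cs) (+ suc t) (+ 1) ≡ e) → c ≡ e
form-zero-head c cs e p = ℤ.i-j≡0⇒i≡j c e (multiples-of-all λ t →
  divides (- form cs (+ suc t) (+ 1)) (trans (cong (λ x → c - x) (trans (≡-sym (p t)) (form-at-1 c cs (+ suc t))))
    (ring c (+ suc t) (form cs (+ suc t) (+ 1)))))
  where
  ring : ∀ c t f → c - (c + t * f) ≡ - f * t
  ring = solve-∀

form-tail : ∀ {d} c (cs : Vec ℤ (suc d)) x y t →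
  form (c ∷ cs) (+ suc t) (+ 1) ≡ x → x ≡ c + + suc t * y → form cs (+ suc t) (+ 1) ≡ y
form-tail c cs x y t p q = ℤ.*-cancelˡ-≡ (+ suc t) _ _ (∙-cancel c _ _
  (trans (≡-sym (form-at-1 c cs (+ suc t))) (trans p q)))
  where
  ∙-cancel : ∀ c x y → c + x ≡ c + y → x ≡ y
  ∙-cancel c x y e = trans (ring c x) (trans (cong (λ z → z - c) e) (≡-sym (ring c y)))
    where
    ring : ∀ c x → x ≡ c + x - c
    ring = solve-∀

-- Without counting roots: the constant coefficient is zero, and after cancelling `t` the tail again
-- vanishes at all positive integers.
form-vanishes : ∀ {d} (cs : Vec ℤ (suc d)) → (∀ t → form cs (+ suc t) (+ 1) ≡ + 0) →
  ∀ a b → form cs a b ≡ + 0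
form-vanishes (c ∷ []) p a b = p 0
form-vanishes {suc d} (c ∷ cs@(_ ∷ _)) p a b = begin
  c * b ℤ.^ suc d + a * form cs a b
    ≡⟨ cong₂ (λ x y → x * b ℤ.^ suc d + a * y) c≡0 (form-vanishes cs tail a b) ⟩
  (+ 0) * b ℤ.^ suc d + a * + 0
    ≡⟨ ring (b ℤ.^ suc d) a ⟩
  + 0 ∎
  where
  c≡0 : c ≡ + 0
  c≡0 = form-zero-head c cs (+ 0) p
  ring : ∀ x a → + 0 * x + a * + 0 ≡ + 0
  ring = solve-∀
  ring′ : ∀ t → + 0 ≡ + 0 + t * + 0
  ring′ = solve-∀
  tail : ∀ t → form cs (+ suc t) (+ 1) ≡ + 0
  tail t = form-tail c cs (+ 0) (+ 0) t (p t) (trans (ring′ (+ suc t)) (cong (λ x → x + + suc t * + 0) (≡-sym c≡0)))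

form-at-0 : ∀ {d} c (cs : Vec ℤ (suc d)) → form (c ∷ cs) (+ 1) (+ 0) ≡ form cs (+ 1) (+ 0)
form-at-0 {d} c cs@(_ ∷ _) = ring c ((+ 0) ℤ.^ d) (form cs (+ 1) (+ 0))
  where
  ring : ∀ c x f → c * (+ 0 * x) + + 1 * f ≡ f
  ring = solve-∀

form-heads : ∀ {d e} c c′ (cs : Vec ℤ (suc d)) (ds : Vec ℤ (suc e)) →
  (∀ t → form (c ∷ cs) (+ suc t) (+ 1) ≡ form (c′ ∷ ds) (+ suc t) (+ 1)) → c ≡ c′
form-heads c c′ cs ds eq = ℤ.i-j≡0⇒i≡j c c′ (multiples-of-all λ t →
  divides (form ds (+ suc t) (+ 1) - form cs (+ suc t) (+ 1))
    (step c c′ (+ suc t) (form cs (+ suc t) (+ 1)) (form ds (+ suc t) (+ 1))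
      (trans (≡-sym (form-at-1 c cs (+ suc t))) (trans (eq t) (form-at-1 c′ ds (+ suc t))))))
  where
  ring : ∀ c d t f g → c - d ≡ (c + t * f) - (d + t * g) + (g - f) * t
  ring = solve-∀
  step : ∀ c d t f g → c + t * f ≡ d + t * g → c - d ≡ (g - f) * t
  step c d t f g e = trans (ring c d t f g) (trans (cong (λ x → x - (d + t * g) + (g - f) * t) e)
    (trans (cong (λ x → x + (g - f) * t) (-≡0 (d + t * g))) (ℤ.+-identityˡ _)))

-- form cs (+ 1) (+ 0) is the leading coefficient.
form-unique : ∀ {d e} (cs : Vec ℤ (suc d)) (ds : Vec ℤ (suc e)) →
  (∀ t → form cs (+ suc t) (+ 1) ≡ form ds (+ suc t) (+ 1)) →
  form cs (+ 1) (+ 0) ≡ + 1 → form ds (+ 1) (+ 0) ≡ + 1 →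
  d ≡ e × (∀ a b → form cs a b ≡ form ds a b)
form-unique (c ∷ []) (d ∷ []) eq _ _ = refl , λ _ _ → eq 0
form-unique (c ∷ []) (d ∷ ds@(_ ∷ _)) eq _ lead = ⊥-elim (absurd (trans (≡-sym lead)
  (trans (form-at-0 d ds) (form-vanishes ds tail (+ 1) (+ 0)))))
  where
  absurd : + 1 ≢ + 0
  absurd ()
  d≡c : d ≡ c
  d≡c = form-zero-head d ds c (λ t → ≡-sym (eq t))
  ring : ∀ c t → c ≡ c + t * + 0
  ring = solve-∀
  tail : ∀ t → form ds (+ suc t) (+ 1) ≡ + 0
  tail t = form-tail d ds c (+ 0) t (≡-sym (eq t)) (trans (≡-sym d≡c) (ring d (+ suc t)))
form-unique cs@(_ ∷ _ ∷ _) ds@(_ ∷ []) eq lead₁ lead₂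
  with form-unique ds cs (λ t → ≡-sym (eq t)) lead₂ lead₁
... | e , p = ≡-sym e , λ a b → ≡-sym (p a b)
form-unique {suc k} (c ∷ cs@(_ ∷ _)) (d ∷ ds@(_ ∷ _)) eq lead₁ lead₂
  with form-unique cs ds tail (trans (≡-sym (form-at-0 c cs)) lead₁) (trans (≡-sym (form-at-0 d ds)) lead₂)
  where
  tail : ∀ t → form cs (+ suc t) (+ 1) ≡ form ds (+ suc t) (+ 1)
  tail t = form-tail c cs (form (d ∷ ds) (+ suc t) (+ 1)) (form ds (+ suc t) (+ 1)) t (eq t)
    (trans (form-at-1 d ds (+ suc t)) (cong (λ x → x + + suc t * form ds (+ suc t) (+ 1)) (≡-sym (form-heads c d cs ds eq))))
... | refl , p = refl , λ a b → cong₂ (λ x y → x * b ℤ.^ suc k + a * y) (form-heads c d cs ds eq) (p a b)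

pencil : Matrix n → ℤ → ℤ → Matrix n
pencil M a b i j = a * δ i j + b * - M i j

lapCharPoly-pencil : (G : Graph n) (t : ℤ) → lapCharPoly G t ≡ det (pencil (laplacian G) t (+ 1))
lapCharPoly-pencil G t = det-cong λ i j → trans
  (cong (λ x → x - laplacian G i j) (trans (if-δ i j t) (ℤ.*-comm (δ i j) t)))
  (cong (ℤ._+_ (t * δ i j)) (≡-sym (ℤ.*-identityˡ (- laplacian G i j))))

pencil-1-0 : (M : Matrix n) → det (pencil M (+ 1) (+ 0)) ≡ + 1
pencil-1-0 {n} M = trans (det-cong (λ i j → ring (δ i j) (M i j))) (det-identity {n})
  where
  ring : ∀ x y → + 1 * x + + 0 * - y ≡ x
  ring = solve-∀

-- The orders agree because both forms have leading coefficient det I = 1: if the degrees differed,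
-- a tail of the longer form, and with it its leading coefficient, would vanish.
LCospectral⇒pencil : (G : Graph n) (H : Graph m) → LCospectral G H →
  n ≡ m × (∀ a b → det (pencil (laplacian G) a b) ≡ det (pencil (laplacian H) a b))
LCospectral⇒pencil G H co
  with det-form δ (λ i j → - laplacian G i j) | det-form δ (λ i j → - laplacian H i j)
... | cs , p | ds , q
  with form-unique cs ds
    (λ t → trans (≡-sym (p (+ suc t) (+ 1))) (trans (≡-sym (lapCharPoly-pencil G (+ suc t)))
      (trans (co (+ suc t)) (trans (lapCharPoly-pencil H (+ suc t)) (q (+ suc t) (+ 1))))))
    (trans (≡-sym (p (+ 1) (+ 0))) (pencil-1-0 (laplacian G)))
    (trans (≡-sym (q (+ 1) (+ 0))) (pencil-1-0 (laplacian H)))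
... | n≡m , r = n≡m , λ a b → trans (p a b) (trans (r a b) (≡-sym (q a b)))

-- Traces of powers

telescope : ∀ {d} n (F : ℕ → ℤ) (g : Fin n → ℤ) →
  (∀ j → d ∣ (F (toℕ j) - F (suc (toℕ j)) - g j)) → d ∣ (F 0 - F n - ∑ g)
telescope {d} zero F g p = subst (d ∣_) (ring (F 0)) ∣0
  where
  ring : ∀ x → + 0 ≡ x - x - + 0
  ring = solve-∀
telescope {d} (suc n) F g p = subst (d ∣_) (ring (F 0) (F 1) (F (suc n)) (g zero) (∑ (g ∘ suc)))
  (∣m∣n⇒∣m+n (p zero) (telescope n (F ∘ suc) (g ∘ suc) (p ∘ suc)))
  where
  ring : ∀ x y z u v → (x - y - u) + (y - z - v) ≡ x - z - (u + v)
  ring = solve-∀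

-- First-order Taylor expansion. Columns of `A` become columns of A - hM one at a time; each change
-- costs exactly h times a determinant that agrees modulo h with the one formed from `A` itself, so
-- the error is a multiple of h².
det-derivative : ∀ h (A M : Matrix n) → h * h ∣
  (det A - det (λ i j → A i j - h * M i j) - h * ∑ (λ j → det (A [ j ≔ (λ i → M i j) ])))
det-derivative {n} h A M = subst (h * h ∣_)
  (cong₂ _-_ (cong₂ _-_ (det-cong (λ i j → at-0 i j)) (det-cong at-n)) (∑-*ˡ h g))
  (telescope n (λ k → det (B k)) (λ j → h * g j) step)
  where
  g : Fin n → ℤ
  g j = det (A [ j ≔ (λ i → M i j) ])
  C : Matrix n
  C i j = A i j - h * M i j
  B : ℕ → Matrix n
  B k i j = if does (toℕ j ℕ.<? k) then C i j else A i j
  B-< : ∀ {k} i j → toℕ j ℕ.< k → B k i j ≡ C i j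
  B-< {k} i j j<k rewrite dec-true (toℕ j ℕ.<? k) j<k = refl
  B-≮ : ∀ {k} i j → ¬ (toℕ j ℕ.< k) → B k i j ≡ A i j
  B-≮ {k} i j j≮k rewrite dec-false (toℕ j ℕ.<? k) j≮k = refl
  at-0 : ∀ i j → B 0 i j ≡ A i j
  at-0 i j = B-≮ {0} i j λ ()
  at-n : ∀ i j → B n i j ≡ C i j
  at-n i j = B-< {n} i j (Fin.toℕ<n j)
  B≡A : ∀ k i j → h ∣ (B k i j - A i j)
  B≡A k i j with does (toℕ j ℕ.<? k)
  ... | true  = divides (- M i j) (ring (A i j) h (M i j))
    where
    ring : ∀ a h m → a - h * m - a ≡ - m * h
    ring = solve-∀
  ... | false = ≡⇒mod {x = A i j} refl
  step : ∀ j → h * h ∣ (det (B (toℕ j)) - det (B (suc (toℕ j))) - h * g j)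
  step j with det-mod (B k [ j ≔ (λ i → M i j) ]) (A [ j ≔ (λ i → M i j) ]) col
    where
    k = toℕ j
    col : ∀ r c → h ∣ ((B k [ j ≔ (λ i → M i j) ]) r c - (A [ j ≔ (λ i → M i j) ]) r c)
    col r c = ≟-cases c j
      (λ c≡j → ≡⇒mod {x = (B k [ j ≔ (λ i → M i j) ]) r c} (trans (≔-at (B k) j (λ i → M i j) r c≡j) (≡-sym (≔-at A j (λ i → M i j) r c≡j))))
      (λ c≢j → subst (h ∣_) (≡-sym (cong₂ _-_ (≔-off (B k) j (λ i → M i j) r c≢j) (≔-off A j (λ i → M i j) r c≢j))) (B≡A k r c))
  ... | divides q eq = divides q (trans (cong (λ x → det (B (toℕ j)) - x - h * g j) split)
      (trans (ring₁ (det (B (toℕ j))) h (det (B (toℕ j) [ j ≔ (λ i → M i j) ])) (g j))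
        (trans (cong (h *_) eq) (ring₂ h q))))
    where
    k = toℕ j
    ring₁ : ∀ x h y z → x - (+ 1 * x + - h * y) - h * z ≡ h * (y - z)
    ring₁ = solve-∀
    ring₂ : ∀ h q → h * (q * h) ≡ q * (h * h)
    ring₂ = solve-∀
    ring₃ : ∀ a h m → a - h * m ≡ + 1 * a + - h * m
    ring₃ = solve-∀
    unchanged : ∀ {c} r → c ≢ j → B (suc k) r c ≡ B k r c
    unchanged {c} r c≢j with ℕ._<?_ (toℕ c) k
    ... | yes c<k = trans (B-< {suc k} r c (ℕ.m<n⇒m<1+n c<k)) (≡-sym (B-< {k} r c c<k))
    ... | no c≮k  = trans
      (B-≮ {suc k} r c (λ c<1+k → c≮k (ℕ.≤∧≢⇒< (ℕ.s≤s⁻¹ c<1+k) (λ e → c≢j (Fin.toℕ-injective e)))))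
      (≡-sym (B-≮ {k} r c c≮k))
    split : det (B (suc k)) ≡ + 1 * det (B k) + - h * det (B k [ j ≔ (λ i → M i j) ])
    split = det-linear j (+ 1) (- h)
      (λ i → trans (B-< {suc k} i j (ℕ.n<1+n k)) (trans (ring₃ (A i j) h (M i j))
        (cong₂ (λ x y → + 1 * x + - h * y) (≡-sym (B-≮ {k} i j (ℕ.<-irrefl refl)))
          (≡-sym (≔-at (B k) j (λ i → M i j) i refl)))))
      (λ i c c≢j → unchanged i c≢j)
      (λ i c c≢j → trans (unchanged i c≢j) (≡-sym (≔-off (B k) j (λ i → M i j) i c≢j)))

-- Adjugate and resolvent

infixl 7 _⊗_
_⊗_ : Matrix n → Matrix n → Matrix n
(A ⊗ B) i j = ∑ (λ k → A i k * B k j)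

tr : Matrix n → ℤ
tr A = ∑ (λ i → A i i)

-- A cofactor written as in Cramer's rule, by inserting a unit vector instead of deleting a row and
-- a column; the lemmas on column replacement then apply directly.
adjugate : Matrix n → Matrix n
adjugate A j i = det (A [ j ≔ δ i ])

expand-column : (A : Matrix n) (j : Fin n) (w : Fin n → ℤ) →
  det (A [ j ≔ w ]) ≡ ∑ (λ i → w i * adjugate A j i)
expand-column A j w = trans (≔-cong A j (λ r → ≡-sym (∑-δʳ′ r))) (≔-∑ A j w δ)
  where
  ∑-δʳ′ : ∀ r → ∑ (λ i → w i * δ i r) ≡ w r
  ∑-δʳ′ r = trans (∑-cong (λ i → ℤ.*-comm (w i) (δ i r))) (∑-δʳ r w)

adjugate-inverse : (A : Matrix n) → ∀ j k → ∑ (λ i → A i k * adjugate A j i) ≡ δ j k * det A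
adjugate-inverse A j k = trans (≡-sym (expand-column A j (λ i → A i k))) (≟-cases k j
  (λ { refl → trans (≔-self A j) (≡-sym (trans (cong (_* det A) (δ-refl j)) (ℤ.*-identityˡ (det A)))) })
  (λ k≢j → trans (≔-alternating A k≢j) (≡-sym (cong (_* det A) (δ-≢ (k≢j ∘ ≡-sym))))))

module Resolvent {n} (M : Matrix n) where

  R : ℤ → Matrix n
  R s = pencil M (+ 1) s

  f : ℤ → ℤ
  f s = det (R s)

  X : ℤ → Matrix n
  X s = adjugate (R s)

  -- X (I - s M) = f I, solved for X
  X-rec : ∀ s j k → X s j k ≡ f s * δ j k + s * (X s ⊗ M) j k
  X-rec s j k = move (X s j k) (s * (X s ⊗ M) j k) (f s * δ j k) (begin
    X s j k - s * (X s ⊗ M) j k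
      ≡⟨ cong₂ _-_ (≡-sym (∑-δʳ k (X s j))) (≡-sym (∑-*ˡ s (λ i → X s j i * M i k))) ⟩
    ∑ (λ i → δ i k * X s j i) - ∑ (λ i → s * (X s j i * M i k))
      ≡⟨ ∑-- (λ i → δ i k * X s j i) (λ i → s * (X s j i * M i k)) ⟨
    ∑ (λ i → δ i k * X s j i - s * (X s j i * M i k))
      ≡⟨ ∑-cong (λ i → ring s (δ i k) (X s j i) (M i k)) ⟩
    ∑ (λ i → R s i k * X s j i)
      ≡⟨ adjugate-inverse (R s) j k ⟩
    δ j k * f s
      ≡⟨ ℤ.*-comm (δ j k) (f s) ⟩
    f s * δ j k ∎)
    where
    ring : ∀ s d x m → d * x - s * (x * m) ≡ (+ 1 * d + s * - m) * x
    ring = solve-∀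
    move : ∀ x y z → x - y ≡ z → x ≡ z + y
    move x y z e = trans (r x y) (cong (λ u → u + y) e)
      where
      r : ∀ x y → x ≡ x - y + y
      r = solve-∀

  -- Multiply `X-rec` by `B` and take the trace. Starting from B = M and iterating, each round
  -- splits off one more trace of a power of `M`.
  trace-rec : ∀ s (B : Matrix n) → tr (X s ⊗ B) ≡ f s * tr B + s * tr (X s ⊗ (M ⊗ B))
  trace-rec s B = begin
    ∑ (λ j → ∑ (λ i → X s j i * B i j))
      ≡⟨ ∑-cong (λ j → trans (∑-cong (λ i → cong (_* B i j) (X-rec s j i))) (row j)) ⟩
    ∑ (λ j → f s * B j j + s * (X s ⊗ (M ⊗ B)) j j)
      ≡⟨ ∑-linear (f s) s (λ j → B j j) (λ j → (X s ⊗ (M ⊗ B)) j j) ⟩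
    f s * tr B + s * tr (X s ⊗ (M ⊗ B)) ∎
    where
    ring : ∀ f d s y b → (f * d + s * y) * b ≡ f * (d * b) + s * (y * b)
    ring = solve-∀
    assoc : ∀ j → ∑ (λ i → (X s ⊗ M) j i * B i j) ≡ (X s ⊗ (M ⊗ B)) j j
    assoc j = begin
      ∑ (λ i → ∑ (λ k → X s j k * M k i) * B i j)
        ≡⟨ ∑-cong (λ i → ≡-sym (∑-*ʳ (B i j) (λ k → X s j k * M k i))) ⟩
      ∑ (λ i → ∑ (λ k → X s j k * M k i * B i j))
        ≡⟨ ∑-swap (λ i k → X s j k * M k i * B i j) ⟩
      ∑ (λ k → ∑ (λ i → X s j k * M k i * B i j))
        ≡⟨ ∑-cong (λ k → trans (∑-cong (λ i → ℤ.*-assoc (X s j k) (M k i) (B i j)))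
             (∑-*ˡ (X s j k) (λ i → M k i * B i j))) ⟩
      ∑ (λ k → X s j k * ∑ (λ i → M k i * B i j)) ∎
    row : ∀ j → ∑ (λ i → (f s * δ j i + s * (X s ⊗ M) j i) * B i j)
              ≡ f s * B j j + s * (X s ⊗ (M ⊗ B)) j j
    row j = begin
      ∑ (λ i → (f s * δ j i + s * (X s ⊗ M) j i) * B i j)
        ≡⟨ ∑-cong (λ i → ring (f s) (δ j i) s ((X s ⊗ M) j i) (B i j)) ⟩
      ∑ (λ i → f s * (δ j i * B i j) + s * ((X s ⊗ M) j i * B i j))
        ≡⟨ ∑-linear (f s) s (λ i → δ j i * B i j) (λ i → (X s ⊗ M) j i * B i j) ⟩
      f s * ∑ (λ i → δ j i * B i j) + s * ∑ (λ i → (X s ⊗ M) j i * B i j)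
        ≡⟨ cong₂ (λ x y → f s * x + s * y) (∑-δ j (λ i → B i j)) (assoc j) ⟩
      f s * B j j + s * (X s ⊗ (M ⊗ B)) j j ∎

  -- By Jacobi's formula this is -f′(s); `y-derivative` expresses that as a congruence modulo h².
  y : ℤ → ℤ
  y s = tr (X s ⊗ M)

  p₁ p₂ p₃ : ℤ
  p₁ = tr M
  p₂ = tr (M ⊗ M)
  p₃ = tr (M ⊗ (M ⊗ M))

  remainder : ℤ → ℤ
  remainder s = tr (X s ⊗ (M ⊗ (M ⊗ (M ⊗ M))))

  y-expansion : ∀ s → y s ≡ f s * p₁ + s * (f s * p₂ + s * (f s * p₃ + s * remainder s))
  y-expansion s = trans (trace-rec s M) (cong (λ x → f s * p₁ + s * x)
    (trans (trace-rec s (M ⊗ M)) (cong (λ x → f s * p₂ + s * x) (trace-rec s (M ⊗ (M ⊗ M))))))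

  y-derivative : ∀ s h → h * h ∣ (f s - f (s + h) - h * y s)
  y-derivative s h = subst (h * h ∣_)
    (cong₂ (λ a b → f s - a - h * b)
      (det-cong (λ i j → ring (δ i j) s h (M i j)))
      (∑-cong (λ j → trans (expand-column (R s) j (λ i → M i j)) (∑-cong (λ i → ℤ.*-comm (M i j) (X s j i))))))
    (det-derivative h (R s) M)
    where
    ring : ∀ d s h m → + 1 * d + s * - m - h * m ≡ + 1 * d + (s + h) * - m
    ring = solve-∀

  f-mod : ∀ s → s ∣ (f s - + 1)
  f-mod s = subst (λ x → s ∣ (f s - x)) (det-identity {n}) (det-mod (R s) δ
    (λ i j → divides (- M i j) (ring (δ i j) s (M i j))))
    where
    ring : ∀ d s m → + 1 * d + s * - m - d ≡ - m * s
    ring = solve-∀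

module _ {n m} (M : Matrix n) (N : Matrix m)
  (eq : ∀ s → det (pencil M (+ 1) s) ≡ det (pencil N (+ 1) s)) where

  private
    module A = Resolvent M
    module B = Resolvent N

  -- With equal `f`, the two derivative congruences for step `t` subtract to t² ∣ t (y - y′);
  -- cancelling `t` leaves a divisibility valid for every `t`.
  y-equal : ∀ s → A.y s ≡ B.y s
  y-equal s = ℤ.i-j≡0⇒i≡j (A.y s) (B.y s) (multiples-of-all λ t →
    *-cancelˡ-∣ (+ suc t) (subst ((+ suc t * + suc t) ∣_)
      (trans (cong₂ (λ u v → u - v - + suc t * B.y s - (A.f s - A.f (s + + suc t) - + suc t * A.y s)) (≡-sym (eq s)) (≡-sym (eq (s + + suc t))))
        (ring (A.f s) (A.f (s + + suc t)) (+ suc t) (A.y s) (B.y s)))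
      (∣m∣n⇒∣m-n (B.y-derivative s (+ suc t)) (A.y-derivative s (+ suc t)))))
    where
    ring : ∀ f g t a b → (f - g - t * b) - (f - g - t * a) ≡ t * (a - b)
    ring = solve-∀

  private
    -- f s ≡ 1 mod s, so s divides d for every s.
    peel : ∀ d (r : ℤ → ℤ) → (∀ t → A.f (+ suc t) * d + + suc t * r (+ suc t) ≡ + 0) → d ≡ + 0
    peel d r p = multiples-of-all go
      where
      ring : ∀ f d s r → d ≡ f * d + s * r - ((f - + 1) * d + s * r)
      ring = solve-∀
      go : ∀ t → + suc t ∣ d
      go t = subst (s ∣_) (≡-sym (ring (A.f s) d s (r s)))
        (∣m∣n⇒∣m-n (subst (s ∣_) (≡-sym (p t)) ∣0)
          (∣m∣n⇒∣m+n (∣m⇒∣m*n d (A.f-mod s)) (∣m⇒∣m*n (r s) ∣-refl)))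
        where s = + suc t

    d₁ d₂ d₃ : ℤ
    d₁ = A.p₁ - B.p₁
    d₂ = A.p₂ - B.p₂
    d₃ = A.p₃ - B.p₃
    q : ℤ → ℤ
    q s = A.remainder s - B.remainder s

    difference : ∀ s → A.f s * d₁ + s * (A.f s * d₂ + s * (A.f s * d₃ + s * q s)) ≡ + 0
    difference s = trans
      (ring (A.f s) s A.p₁ A.p₂ A.p₃ (A.remainder s) B.p₁ B.p₂ B.p₃ (B.remainder s))
      (trans (cong₂ _-_ (≡-sym (A.y-expansion s))
        (trans (cong (λ g → g * B.p₁ + s * (g * B.p₂ + s * (g * B.p₃ + s * B.remainder s))) (eq s))
          (≡-sym (B.y-expansion s))))
        (trans (cong (λ z → A.y s - z) (≡-sym (y-equal s))) (-≡0 (A.y s))))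
      where
      ring : ∀ f s a b c r a′ b′ c′ r′ →
        f * (a - a′) + s * (f * (b - b′) + s * (f * (c - c′) + s * (r - r′)))
        ≡ (f * a + s * (f * b + s * (f * c + s * r))) - (f * a′ + s * (f * b′ + s * (f * c′ + s * r′)))
      ring = solve-∀

    next : ∀ d (r : ℤ → ℤ) → d ≡ + 0 → (∀ t → A.f (+ suc t) * d + + suc t * r (+ suc t) ≡ + 0) →
      ∀ t → r (+ suc t) ≡ + 0
    next d r d≡0 p t = *-cancel-suc t (trans (ring (A.f (+ suc t)) (+ suc t * r (+ suc t)))
      (trans (cong (λ z → A.f (+ suc t) * z + + suc t * r (+ suc t)) (≡-sym d≡0)) (p t)))
      where
      ring : ∀ f x → x ≡ f * + 0 + x
      ring = solve-∀

    r₁ r₂ r₃ : ℤ → ℤ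
    r₃ s = q s
    r₂ s = A.f s * d₃ + s * r₃ s
    r₁ s = A.f s * d₂ + s * r₂ s

    d₁≡0 : d₁ ≡ + 0
    d₁≡0 = peel d₁ r₁ (λ t → difference (+ suc t))
    d₂≡0 : d₂ ≡ + 0
    d₂≡0 = peel d₂ r₂ (next d₁ r₁ d₁≡0 (λ t → difference (+ suc t)))
    d₃≡0 : d₃ ≡ + 0
    d₃≡0 = peel d₃ r₃ (next d₂ r₂ d₂≡0 (next d₁ r₁ d₁≡0 (λ t → difference (+ suc t))))

  traces-equal : tr M ≡ tr N × tr (M ⊗ M) ≡ tr (N ⊗ N) × tr (M ⊗ (M ⊗ M)) ≡ tr (N ⊗ (N ⊗ N))
  traces-equal = ℤ.i-j≡0⇒i≡j A.p₁ B.p₁ d₁≡0 , ℤ.i-j≡0⇒i≡j A.p₂ B.p₂ d₂≡0 , ℤ.i-j≡0⇒i≡j A.p₃ B.p₃ d₃≡0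

-- The Laplacian matrix

module Laplacian {n} (G : Graph n) where

  a : Matrix n
  a i j = ⟦ adj G i j ⟧

  d : Fin n → ℤ
  d i = + degree G i

  L : Matrix n
  L = laplacian G

  d-∑ : ∀ i → d i ≡ ∑ (a i)
  d-∑ i = count-∑ (adj G i)

  a-sym : ∀ i j → a i j ≡ a j i
  a-sym i j = cong ⟦_⟧ (Graph.sym G i j)

  a-irrefl : ∀ i → a i i ≡ + 0
  a-irrefl i = cong ⟦_⟧ (irrefl G i)

  a-idem : ∀ i j → a i j * a j i ≡ a i j
  a-idem i j = trans (cong (a i j *_) (a-sym j i)) (sq (adj G i j))
    where
    sq : ∀ b → ⟦ b ⟧ * ⟦ b ⟧ ≡ ⟦ b ⟧
    sq true = refl
    sq false = refl

  a-δ : ∀ i j → a i j * δ j i ≡ + 0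
  a-δ i j = ≟-cases j i
    (λ { refl → cong (_* δ j j) (a-irrefl j) })
    (λ j≢i → trans (cong (a i j *_) (δ-≢ j≢i)) (ℤ.*-zeroʳ (a i j)))

  L-def : ∀ i j → L i j ≡ δ i j * d i - a i j
  L-def i j = cong (λ x → x - a i j) (if-δ i j (d i))

  L-sym : ∀ i j → L i j ≡ L j i
  L-sym i j = trans (L-def i j) (trans
    (cong₂ _-_ (≟-cases i j (λ { refl → refl })
      (λ i≢j → trans (cong (_* d i) (δ-≢ i≢j)) (≡-sym (cong (_* d j) (δ-≢ (i≢j ∘ ≡-sym))))))
      (a-sym i j))
    (≡-sym (L-def j i)))

  L-diagonal : ∀ i → L i i ≡ d i
  L-diagonal i = trans (L-def i i) (trans
    (cong₂ (λ x y → x * d i - y) (δ-refl i) (a-irrefl i)) (ring (d i)))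
    where
    ring : ∀ x → + 1 * x - + 0 ≡ x
    ring = solve-∀

  L⊗ : ∀ B i j → (L ⊗ B) i j ≡ d i * B i j - ∑ (λ k → a i k * B k j)
  L⊗ B i j = begin
    ∑ (λ k → L i k * B k j)
      ≡⟨ ∑-cong (λ k → trans (cong (_* B k j) (L-def i k)) (ring (δ i k) (d i) (a i k) (B k j))) ⟩
    ∑ (λ k → δ i k * (d i * B k j) - a i k * B k j)
      ≡⟨ ∑-- (λ k → δ i k * (d i * B k j)) (λ k → a i k * B k j) ⟩
    ∑ (λ k → δ i k * (d i * B k j)) - ∑ (λ k → a i k * B k j)
      ≡⟨ cong (λ x → x - ∑ (λ k → a i k * B k j)) (∑-δ i (λ k → d i * B k j)) ⟩
    d i * B i j - ∑ (λ k → a i k * B k j) ∎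
    where
    ring : ∀ δ d a b → (δ * d - a) * b ≡ δ * (d * b) - a * b
    ring = solve-∀

  L-row-sum : ∀ i → ∑ (L i) ≡ + 0
  L-row-sum i = begin
    ∑ (L i)
      ≡⟨ ∑-cong (L-def i) ⟩
    ∑ (λ j → δ i j * d i - a i j)
      ≡⟨ ∑-- (λ j → δ i j * d i) (a i) ⟩
    ∑ (λ j → δ i j * d i) - ∑ (a i)
      ≡⟨ cong₂ _-_ (∑-δ i (λ _ → d i)) (≡-sym (d-∑ i)) ⟩
    d i - d i
      ≡⟨ -≡0 (d i) ⟩
    + 0 ∎

  a*L : ∀ i k → a i k * L k i ≡ - a i k
  a*L i k = trans (cong (a i k *_) (L-def k i)) (trans (ring (a i k) (δ k i) (d k) (a k i))
    (trans (cong₂ (λ x y → x * d k - y) (a-δ i k) (a-idem i k)) (ring′ (d k) (a i k))))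
    where
    ring : ∀ a δ d b → a * (δ * d - b) ≡ a * δ * d - a * b
    ring = solve-∀
    ring′ : ∀ d a → + 0 * d - a ≡ - a
    ring′ = solve-∀

  ∑-a*L : ∀ i → ∑ (λ k → a i k * L k i) ≡ - d i
  ∑-a*L i = trans (∑-cong (λ k → trans (a*L i k) (ring (a i k))))
    (trans (∑-*ˡ (- + 1) (a i)) (trans (cong (- + 1 *_) (≡-sym (d-∑ i))) (≡-sym (ring (d i)))))
    where
    ring : ∀ x → - x ≡ - + 1 * x
    ring = solve-∀

  L²-diagonal : ∀ i → (L ⊗ L) i i ≡ d i * d i + d i
  L²-diagonal i = trans (L⊗ L i i) (trans
    (cong₂ (λ x y → d i * x - y) (L-diagonal i) (∑-a*L i)) (ring (d i)))
    where
    ring : ∀ d → d * d - - d ≡ d * d + d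
    ring = solve-∀

  -- This is tr A³, that is, six times the number of triangles.
  triangles : ℤ
  triangles = ∑ (λ i → ∑ (λ j → a i j * ∑ (λ k → a j k * a k i)))

  tr-L : tr L ≡ ∑ d
  tr-L = ∑-cong L-diagonal

  tr-L² : tr (L ⊗ L) ≡ ∑ (λ i → d i * d i + d i)
  tr-L² = ∑-cong L²-diagonal

  -- With L = D - A, the terms with a single A vanish since A has zero diagonal, the three terms
  -- with two give 3 tr (D A²) = 3 Σ d², and the term with three is tr A³.
  tr-L³ : tr (L ⊗ (L ⊗ L)) ≡ ∑ (λ i → d i * d i * d i + + 3 * (d i * d i)) - triangles
  tr-L³ = begin
    ∑ (λ i → (L ⊗ (L ⊗ L)) i i)
      ≡⟨ ∑-cong (λ i → trans (L⊗ (L ⊗ L) i i) (cong₂ (λ x y → d i * x - y) (L²-diagonal i) (row i))) ⟩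
    ∑ (λ i → d i * (d i * d i + d i) - (t i - (ad i + d i * d i)))
      ≡⟨ ∑-cong (λ i → ring₁ (d i) (t i) (ad i)) ⟩
    ∑ (λ i → (d i * d i * d i + + 2 * (d i * d i) - t i) + ad i)
      ≡⟨ ∑-+ (λ i → d i * d i * d i + + 2 * (d i * d i) - t i) ad ⟩
    ∑ (λ i → d i * d i * d i + + 2 * (d i * d i) - t i) + ∑ ad
      ≡⟨ cong (ℤ._+_ (∑ (λ i → d i * d i * d i + + 2 * (d i * d i) - t i))) ∑-ad ⟩
    ∑ (λ i → d i * d i * d i + + 2 * (d i * d i) - t i) + ∑ (λ i → d i * d i)
      ≡⟨ ∑-+ (λ i → d i * d i * d i + + 2 * (d i * d i) - t i) (λ i → d i * d i) ⟨
    ∑ (λ i → d i * d i * d i + + 2 * (d i * d i) - t i + d i * d i)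
      ≡⟨ ∑-cong (λ i → ring₂ (d i) (t i)) ⟩
    ∑ (λ i → d i * d i * d i + + 3 * (d i * d i) - t i)
      ≡⟨ ∑-- (λ i → d i * d i * d i + + 3 * (d i * d i)) t ⟩
    ∑ (λ i → d i * d i * d i + + 3 * (d i * d i)) - ∑ t ∎
    where
    t ad : Fin n → ℤ
    t i = ∑ (λ j → a i j * ∑ (λ k → a j k * a k i))
    ad i = ∑ (λ j → a i j * d j)
    ring₁ : ∀ d t e → d * (d * d + d) - (t - (e + d * d)) ≡ (d * d * d + + 2 * (d * d) - t) + e
    ring₁ = solve-∀
    ring₂ : ∀ d t → d * d * d + + 2 * (d * d) - t + d * d ≡ d * d * d + + 3 * (d * d) - t
    ring₂ = solve-∀
    ∑-ad : ∑ ad ≡ ∑ (λ i → d i * d i)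
    ∑-ad = trans (∑-swap (λ i j → a i j * d j)) (∑-cong (λ j →
      trans (∑-*ʳ (d j) (λ i → a i j))
        (cong (_* d j) (trans (∑-cong (λ i → a-sym i j)) (≡-sym (d-∑ j))))))
    entry : ∀ i j → a i j * (L ⊗ L) j i ≡
      a i j * ∑ (λ k → a j k * a k i) - (a i j * d j + a i j * d i)
    entry i j = begin
      a i j * (L ⊗ L) j i
        ≡⟨ cong (a i j *_) (L⊗ L j i) ⟩
      a i j * (d j * L j i - ∑ (λ k → a j k * L k i))
        ≡⟨ cong (λ x → a i j * (d j * L j i - x)) inner ⟩
      a i j * (d j * L j i - (a j i * d i - ∑ (λ k → a j k * a k i)))
        ≡⟨ ring (a i j) (d j) (L j i) (a j i) (d i) (∑ (λ k → a j k * a k i)) ⟩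
      a i j * ∑ (λ k → a j k * a k i) + d j * (a i j * L j i) - a i j * a j i * d i
        ≡⟨ cong₂ (λ x y → a i j * ∑ (λ k → a j k * a k i) + d j * x - y * d i) (a*L i j) (a-idem i j) ⟩
      a i j * ∑ (λ k → a j k * a k i) + d j * - a i j - a i j * d i
        ≡⟨ ring′ (a i j * ∑ (λ k → a j k * a k i)) (d j) (a i j) (d i) ⟩
      a i j * ∑ (λ k → a j k * a k i) - (a i j * d j + a i j * d i) ∎
      where
      ring : ∀ a d l b e s → a * (d * l - (b * e - s)) ≡ a * s + d * (a * l) - a * b * e
      ring = solve-∀
      ring′ : ∀ s d a e → s + d * - a - a * e ≡ s - (a * d + a * e)
      ring′ = solve-∀
      ring″ : ∀ a δ d b → a * (δ * d - b) ≡ δ * (a * d) - a * b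
      ring″ = solve-∀
      inner : ∑ (λ k → a j k * L k i) ≡ a j i * d i - ∑ (λ k → a j k * a k i)
      inner = trans (∑-cong (λ k → trans (cong (a j k *_) (L-def k i)) (ring″ (a j k) (δ k i) (d k) (a k i))))
        (trans (∑-- (λ k → δ k i * (a j k * d k)) (λ k → a j k * a k i))
          (cong (λ x → x - ∑ (λ k → a j k * a k i)) (∑-δʳ i (λ k → a j k * d k))))
    row : ∀ i → ∑ (λ j → a i j * (L ⊗ L) j i) ≡ t i - (ad i + d i * d i)
    row i = trans (∑-cong (entry i)) (trans
      (∑-- (λ j → a i j * ∑ (λ k → a j k * a k i)) (λ j → a i j * d j + a i j * d i))
      (cong (λ x → t i - x) (trans (∑-+ (λ j → a i j * d j) (λ j → a i j * d i))
        (cong (ℤ._+_ (ad i)) (trans (∑-*ʳ (d i) (a i)) (cong (_* d i) (≡-sym (d-∑ i))))))))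

  -- By the matrix-tree theorem its determinant is ± n times the number of spanning trees.
  bordered : Fin n → Matrix n
  bordered r = (λ i j → - L i j) [ r ≔ (λ _ → + 1) ]

  -- Every row of tI - L sums to `t`, so adding all columns to column `r` makes it `t` times the
  -- column of ones.
  lapCharPoly-bordered : ∀ r t →
    det (pencil L t (+ 1)) ≡ t * det (pencil L t (+ 1) [ r ≔ (λ _ → + 1) ])
  lapCharPoly-bordered r t = begin
    det P
      ≡⟨ ℤ.*-identityˡ (det P) ⟨
    + 1 * det P
      ≡⟨ det-combination P r (λ _ → + 1) ⟨
    det (P [ r ≔ (λ i → ∑ (λ j → + 1 * P i j)) ])
      ≡⟨ ≔-cong P r (λ i → trans (row i) (≡-sym (ℤ.*-identityʳ t))) ⟩
    det (P [ r ≔ (λ i → t * + 1) ])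
      ≡⟨ ≔-* P r t (λ _ → + 1) ⟩
    t * det (P [ r ≔ (λ _ → + 1) ]) ∎
    where
    P = pencil L t (+ 1)
    ring : ∀ t x l → + 1 * (t * x + + 1 * - l) ≡ x * t - l
    ring = solve-∀
    row : ∀ i → ∑ (λ j → + 1 * P i j) ≡ t
    row i = trans (∑-cong (λ j → ring t (δ i j) (L i j))) (trans (∑-- (λ j → δ i j * t) (L i))
      (trans (cong₂ _-_ (∑-δ i (λ _ → t)) (L-row-sum i)) (ℤ.+-identityʳ t)))

  bordered-mod : ∀ r t → t ∣ (det (pencil L t (+ 1) [ r ≔ (λ _ → + 1) ]) - det (bordered r))
  bordered-mod r t = det-mod (P [ r ≔ (λ _ → + 1) ]) (bordered r) λ i j → ≟-cases j r
    (λ j≡r → ≡⇒mod {x = (P [ r ≔ (λ _ → + 1) ]) i j}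
      (trans (≔-at P r (λ _ → + 1) i j≡r) (≡-sym (≔-at (λ i j → - L i j) r (λ _ → + 1) i j≡r))))
    (λ j≢r → subst (t ∣_)
      (≡-sym (cong₂ _-_ (≔-off P r (λ _ → + 1) i j≢r) (≔-off (λ i j → - L i j) r (λ _ → + 1) i j≢r)))
      (divides (δ i j) (ring t (δ i j) (L i j))))
    where
    P = pencil L t (+ 1)
    ring : ∀ t x l → t * x + + 1 * - l - - l ≡ x * t
    ring = solve-∀

-- After cancelling the factor `t`, the two remaining determinants are equal, and modulo `t` they
-- reduce to the bordered ones. The columns `r` and `s` may be chosen independently.
LCospectral⇒bordered : (G : Graph n) (H : Graph m) → LCospectral G H →
  ∀ r s → det (Laplacian.bordered G r) ≡ det (Laplacian.bordered H s)
LCospectral⇒bordered G H co r s = ℤ.i-j≡0⇒i≡j (det (Laplacian.bordered G r)) (det (Laplacian.bordered H s))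
  (multiples-of-all λ t → subst (+ suc t ∣_)
    (trans (cong (λ x → x - det (Laplacian.bordered H s) - (bG t - det (Laplacian.bordered G r))) (≡-sym (same-b t)))
      (ring (bG t) (det (Laplacian.bordered G r)) (det (Laplacian.bordered H s))))
    (∣m∣n⇒∣m-n (Laplacian.bordered-mod H s (+ suc t)) (Laplacian.bordered-mod G r (+ suc t))))
  where
  bG : ℕ → ℤ
  bG t = det (pencil (laplacian G) (+ suc t) (+ 1) [ r ≔ (λ _ → + 1) ])
  bH : ℕ → ℤ
  bH t = det (pencil (laplacian H) (+ suc t) (+ 1) [ s ≔ (λ _ → + 1) ])
  ring : ∀ b x y → b - y - (b - x) ≡ x - y
  ring = solve-∀
  same-b : ∀ t → bG t ≡ bH t
  same-b t = ℤ.*-cancelˡ-≡ (+ suc t) (bG t) (bH t)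
    (trans (≡-sym (Laplacian.lapCharPoly-bordered G r (+ suc t)))
      (trans (proj₂ (LCospectral⇒pencil G H co) (+ suc t) (+ 1))
        (Laplacian.lapCharPoly-bordered H s (+ suc t))))

-- Degree moments determined by the spectrum

record SameMoments (G : Graph n) (H : Graph m) : Set where
  open Laplacian using (d; triangles)
  field
    moment₁ : ∑ (d G) ≡ ∑ (d H)
    moment₂ : ∑ (λ i → d G i * d G i) ≡ ∑ (λ i → d H i * d H i)
    moment₃ : ∑ (λ i → d G i * d G i * d G i) - triangles G
            ≡ ∑ (λ i → d H i * d H i * d H i) - triangles H

LCospectral⇒SameMoments : (G : Graph n) (H : Graph m) → LCospectral G H → SameMoments G H
LCospectral⇒SameMoments G H co = record { moment₁ = m₁ ; moment₂ = m₂ ; moment₃ = m₃ }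
  where
  module 𝐆 = Laplacian G
  module 𝐇 = Laplacian H
  equal : tr 𝐆.L ≡ tr 𝐇.L × tr (𝐆.L ⊗ 𝐆.L) ≡ tr (𝐇.L ⊗ 𝐇.L) ×
    tr (𝐆.L ⊗ (𝐆.L ⊗ 𝐆.L)) ≡ tr (𝐇.L ⊗ (𝐇.L ⊗ 𝐇.L))
  equal = traces-equal 𝐆.L 𝐇.L (proj₂ (LCospectral⇒pencil G H co) (+ 1))
  t₁ = proj₁ equal
  t₂ = proj₁ (proj₂ equal)
  t₃ = proj₂ (proj₂ equal)
  m₁ : ∑ 𝐆.d ≡ ∑ 𝐇.d
  m₁ = trans (≡-sym 𝐆.tr-L) (trans t₁ 𝐇.tr-L)
  m₂ : ∑ (λ i → 𝐆.d i * 𝐆.d i) ≡ ∑ (λ i → 𝐇.d i * 𝐇.d i)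
  m₂ = cancel (begin
    ∑ (λ i → 𝐆.d i * 𝐆.d i) + ∑ 𝐆.d
      ≡⟨ trans (≡-sym (∑-+ (λ i → 𝐆.d i * 𝐆.d i) 𝐆.d)) (trans (≡-sym 𝐆.tr-L²) (trans t₂ 𝐇.tr-L²)) ⟩
    ∑ (λ i → 𝐇.d i * 𝐇.d i + 𝐇.d i)
      ≡⟨ ∑-+ (λ i → 𝐇.d i * 𝐇.d i) 𝐇.d ⟩
    ∑ (λ i → 𝐇.d i * 𝐇.d i) + ∑ 𝐇.d
      ≡⟨ cong (ℤ._+_ (∑ (λ i → 𝐇.d i * 𝐇.d i))) (≡-sym m₁) ⟩
    ∑ (λ i → 𝐇.d i * 𝐇.d i) + ∑ 𝐆.d ∎)
    where
    cancel : ∀ {x y z} → x + z ≡ y + z → x ≡ y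
    cancel {x} {y} {z} e = trans (ring x z) (trans (cong (λ w → w - z) e) (≡-sym (ring y z)))
      where
      ring : ∀ x z → x ≡ x + z - z
      ring = solve-∀
  cube : ∀ {k} (K : Graph k) → let open Laplacian K using (d; L; triangles) in
    ∑ (λ i → d i * d i * d i) - triangles ≡ tr (L ⊗ (L ⊗ L)) - + 3 * ∑ (λ i → d i * d i)
  cube K = trans (ring (∑ (λ i → d i * d i * d i)) triangles (∑ (λ i → d i * d i)))
    (cong (λ x → x - + 3 * ∑ (λ i → d i * d i)) (≡-sym (trans tr-L³
      (cong (λ x → x - triangles) (trans (∑-+ (λ i → d i * d i * d i) (λ i → + 3 * (d i * d i)))
        (cong (ℤ._+_ (∑ (λ i → d i * d i * d i))) (∑-*ˡ (+ 3) (λ i → d i * d i))))))))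
    where
    open Laplacian K
    ring : ∀ x t y → x - t ≡ x + + 3 * y - t - + 3 * y
    ring = solve-∀
  m₃ : ∑ (λ i → 𝐆.d i * 𝐆.d i * 𝐆.d i) - 𝐆.triangles ≡ ∑ (λ i → 𝐇.d i * 𝐇.d i * 𝐇.d i) - 𝐇.triangles
  m₃ = trans (cube G) (trans (cong₂ (λ x y → x - + 3 * y) t₃ m₂) (≡-sym (cube H)))

-- Unicyclic graphs

iter : {A : Set} → (A → A) → ℕ → A → A
iter f zero    x = x
iter f (suc k) x = f (iter f k x)

iter-comm : ∀ {A : Set} (f : A → A) k x → iter f k (f x) ≡ f (iter f k x)
iter-comm f zero    x = refl
iter-comm f (suc k) x = cong f (iter-comm f k x)

∑-telescope : ∀ k (F : ℕ → ℤ) → ∑ {k} (λ j → F (suc (toℕ j)) - F (toℕ j)) ≡ F k - F 0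
∑-telescope zero F = ≡-sym (-≡0 (F 0))
∑-telescope (suc k) F = trans (cong (ℤ._+_ (F 1 - F 0)) (∑-telescope k (F ∘ suc))) (ring (F 0) (F 1) (F (suc k)))
  where
  ring : ∀ x y z → y - x + (z - y) ≡ z - x
  ring = solve-∀

bounded : (h : Fin n → ℕ) → Σ ℕ λ B → ∀ v → h v ℕ.< B
bounded {zero} h = 0 , λ ()
bounded {suc n} h with bounded (h ∘ suc)
... | B , p = suc (h zero) ℕ.⊔ B , λ
  { zero → ℕ.m≤m⊔n (suc (h zero)) B
  ; (suc v) → ℕ.≤-trans (p v) (ℕ.m≤n⊔m (suc (h zero)) B) }

-- A connected graph with as many edges as vertices: deleting the edge {root , f root} leaves a
-- tree in which f v is the parent of v ≢ root.
record Unicyclic (G : Graph n) : Set where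
  field
    f            : Fin n → Fin n
    root         : Fin n
    depth        : Fin n → ℕ
    edges        : ∀ u v → adj G u v ≡ (f u == v) ∨ (f v == u)
    -- This excludes fixed points too, so the pairs {v, f v} are n distinct edges.
    no-2-cycle   : ∀ v → f (f v) ≢ v
    depth-root   : depth root ≡ 0
    depth-parent : ∀ v → v ≢ root → depth v ≡ suc (depth (f v))

  -- The cycle leaves the root by its own edge and comes back along parents in `depth (f root)`
  -- further steps.
  girth : ℕ
  girth = suc (depth (f root))

  depth≡0 : ∀ {v} → depth v ≡ 0 → v ≡ root
  depth≡0 {v} e with v Fin.≟ root
  ... | yes v≡root = v≡root
  ... | no v≢root with trans (≡-sym e) (depth-parent v v≢root)
  ...   | ()

  depth≡suc : ∀ {v k} → depth v ≡ suc k → v ≢ root × depth (f v) ≡ k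
  depth≡suc {v} {k} e = v≢root , ℕ.suc-injective (trans (≡-sym (depth-parent v v≢root)) e)
    where
    v≢root : v ≢ root
    v≢root refl with trans (≡-sym depth-root) e
    ... | ()

  c : ℕ → Fin n
  c k = iter f k root

  -- From `f root` on, each step around the cycle lowers the depth by one; distinct depths later
  -- separate the cycle vertices.
  depth-c : ∀ k j → suc k ℕ.+ j ≡ girth → depth (c (suc k)) ≡ j
  depth-c zero j e = ≡-sym (ℕ.suc-injective e)
  depth-c (suc k) j e = proj₂ (depth≡suc (depth-c k (suc j) (trans (ℕ.+-suc (suc k) j) e)))

  c-girth : c girth ≡ root
  c-girth = depth≡0 (depth-c (depth (f root)) 0 (ℕ.+-identityʳ girth))

  3≤girth : 3 ℕ.≤ girth
  3≤girth with depth (f root) in eq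
  ... | zero  = ⊥-elim (no-2-cycle root (trans (cong f (depth≡0 eq)) (depth≡0 eq)))
  ... | suc zero = ⊥-elim (no-2-cycle root (depth≡0 (proj₂ (depth≡suc eq))))
  ... | suc (suc _) = ℕ.s≤s (ℕ.s≤s (ℕ.s≤s ℕ.z≤n))

  c-injective-ℕ : ∀ {i j} → i ℕ.< girth → j ℕ.< girth → c i ≡ c j → i ≡ j
  c-injective-ℕ {zero} {zero} _ _ _ = refl
  c-injective-ℕ {zero} {suc j} _ (ℕ.s≤s j<) e =
    ⊥-elim (proj₁ (depth≡suc (depth-c j (suc (depth (f root) ℕ.∸ suc j))
      (cong suc (trans (ℕ.+-suc j _) (ℕ.m+[n∸m]≡n j<))))) (≡-sym e))
  c-injective-ℕ {suc i} {zero} (ℕ.s≤s i<) _ e =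
    ⊥-elim (proj₁ (depth≡suc (depth-c i (suc (depth (f root) ℕ.∸ suc i))
      (cong suc (trans (ℕ.+-suc i _) (ℕ.m+[n∸m]≡n i<))))) e)
  c-injective-ℕ {suc i} {suc j} (ℕ.s≤s i<) (ℕ.s≤s j<) e = cong suc (ℕ.∸-cancelˡ-≡ (ℕ.<⇒≤ i<) (ℕ.<⇒≤ j<)
    (trans (≡-sym (depth-c i (depth (f root) ℕ.∸ i) (cong suc (ℕ.m+[n∸m]≡n (ℕ.<⇒≤ i<)))))
      (trans (cong depth e) (depth-c j (depth (f root) ℕ.∸ j) (cong suc (ℕ.m+[n∸m]≡n (ℕ.<⇒≤ j<)))))))

  cycle : Fin girth → Fin n
  cycle i = c (toℕ i)

  cycle-injective : ∀ {i j} → cycle i ≡ cycle j → i ≡ j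
  cycle-injective {i} {j} e = Fin.toℕ-injective (c-injective-ℕ (Fin.toℕ<n i) (Fin.toℕ<n j) e)

  on-cycle : Fin n → ℤ
  on-cycle v = ∑ (λ i → δ (cycle i) v)

  on-cycle-c : ∀ {k} → k ℕ.< girth → on-cycle (c k) ≡ + 1
  on-cycle-c {k} k<g = trans (∑-single j off) (trans (cong (λ v → δ v (c k)) j-k) (δ-refl (c k)))
    where
    j = Fin.fromℕ< k<g
    j-k : cycle j ≡ c k
    j-k = cong c (Fin.toℕ-fromℕ< k<g)
    off : ∀ i → i ≢ j → δ (cycle i) (c k) ≡ + 0
    off i i≢j = δ-≢ (λ e → i≢j (cycle-injective (trans e (≡-sym j-k))))

  indegree : Fin n → ℤ
  indegree v = ∑ (λ u → δ (f u) v)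

  open Laplacian G using (a; d; L; d-∑; L-def; L-sym; L-row-sum; bordered)

  a-f : ∀ i v → a i v ≡ δ (f i) v + δ (f v) i
  a-f i v = trans (cong ⟦_⟧ (edges i v)) (≟-cases (f i) v fi≡v fi≢v)
    where
    fi≡v : f i ≡ v → ⟦ (f i == v) ∨ (f v == i) ⟧ ≡ δ (f i) v + δ (f v) i
    fi≡v e rewrite ==-≡ e | ==-≢ (λ e′ → no-2-cycle i (trans (cong f e) e′)) = refl
    fi≢v : f i ≢ v → ⟦ (f i == v) ∨ (f v == i) ⟧ ≡ δ (f i) v + δ (f v) i
    fi≢v e rewrite ==-≢ e = ≡-sym (ℤ.+-identityˡ _)

  d-indegree : ∀ v → d v ≡ + 1 + indegree v
  d-indegree v = trans (d-∑ v) (trans (∑-cong (a-f v)) (trans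
    (∑-+ (λ i → δ (f v) i) (λ i → δ (f i) v))
    (cong (λ x → x + indegree v) (trans (∑-single (f v) (λ i i≢ → δ-≢ (i≢ ∘ ≡-sym))) (δ-refl (f v))))))

  -- The column of the incidence matrix for the edge oriented from v to f v.
  b : Fin n → Fin n → ℤ
  b v i = δ (f v) i - δ v i

  δ-* : ∀ (u v i : Fin n) → δ u v * δ u i ≡ δ u v * δ v i
  δ-* u v i = ≟-cases u v (λ { refl → refl })
    (λ u≢v → trans (cong (_* δ u i) (δ-≢ u≢v)) (≡-sym (cong (_* δ v i) (δ-≢ u≢v))))

  -- The factorization of L as incidence matrix times its transpose, read column by column: the edge
  -- leaving `v` minus the edges entering it from children.
  -L-b : ∀ i v → - L i v ≡ b v i - ∑ (λ u → δ (f u) v * b u i)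
  -L-b i v = begin
    - L i v
      ≡⟨ cong -_ (trans (L-sym i v) (L-def v i)) ⟩
    - (δ v i * d v - a v i)
      ≡⟨ cong₂ (λ x y → - (δ v i * x - y)) (d-indegree v) (a-f v i) ⟩
    - (δ v i * (+ 1 + indegree v) - (δ (f v) i + δ (f i) v))
      ≡⟨ ring (δ v i) (indegree v) (δ (f v) i) (δ (f i) v) ⟩
    b v i - (indegree v * δ v i - δ (f i) v)
      ≡⟨ cong (λ x → b v i - x) (≡-sym children) ⟩
    b v i - ∑ (λ u → δ (f u) v * b u i) ∎
    where
    ring : ∀ x k y z → - (x * (+ 1 + k) - (y + z)) ≡ y - x - (k * x - z)
    ring = solve-∀
    ring′ : ∀ x y z → x * (y - z) ≡ x * y - z * x
    ring′ = solve-∀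
    children : ∑ (λ u → δ (f u) v * b u i) ≡ indegree v * δ v i - δ (f i) v
    children = trans
      (∑-cong (λ u → trans (ring′ (δ (f u) v) (δ (f u) i) (δ u i)) (cong (λ x → x - δ u i * δ (f u) v) (δ-* (f u) v i))))
      (trans (∑-- (λ u → δ (f u) v * δ v i) (λ u → δ u i * δ (f u) v))
        (cong₂ _-_ (∑-*ʳ (δ v i) (λ u → δ (f u) v)) (∑-δʳ i (λ u → δ (f u) v))))

  -- Around the closed cycle the incidence vectors telescope. This relation is what makes the edge
  -- at `z` redundant below.
  ∑-on-cycle-b : ∀ i → ∑ (λ v → on-cycle v * b v i) ≡ + 0
  ∑-on-cycle-b i = begin
    ∑ (λ v → on-cycle v * b v i)
      ≡⟨ ∑-cong (λ v → ≡-sym (∑-*ʳ (b v i) (λ j → δ (cycle j) v))) ⟩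
    ∑ (λ v → ∑ (λ j → δ (cycle j) v * b v i))
      ≡⟨ ∑-swap (λ v j → δ (cycle j) v * b v i) ⟩
    ∑ (λ j → ∑ (λ v → δ (cycle j) v * b v i))
      ≡⟨ ∑-cong (λ j → ∑-δ (cycle j) (λ v → b v i)) ⟩
    ∑ {girth} (λ j → b (cycle j) i)
      ≡⟨ ∑-telescope girth (λ k → δ (c k) i) ⟩
    δ (c girth) i - δ root i
      ≡⟨ cong (λ v → δ v i - δ root i) c-girth ⟩
    δ root i - δ root i
      ≡⟨ -≡0 (δ root i) ⟩
    + 0 ∎

  -- winding (depth v) v is the number of cycle vertices other than root on the path from v to root
  winding : ℕ → Fin n → ℤ
  winding zero    v = + 0
  winding (suc k) v = on-cycle v + winding k (f v)

  winding-c : ∀ k i → i ℕ.+ k ℕ.≤ girth → winding k (c i) ≡ + k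
  winding-c zero i p = refl
  winding-c (suc k) i p = cong₂ _+_
    (on-cycle-c (ℕ.<-≤-trans (ℕ.m<m+n i (ℕ.s≤s ℕ.z≤n)) p))
    (winding-c k (suc i) (subst (ℕ._≤ girth) (ℕ.+-suc i k) p))

  x : Fin n → ℤ
  x v = winding (depth v) v

  x-root : x root ≡ + 0
  x-root = cong (λ k → winding k root) depth-root

  -- `x` is a potential: it is constant along edges off the cycle and drops by 1 along cycle edges,
  -- except at the root, where it must jump back by girth - 1, the number of the other cycle
  -- vertices.
  x-difference : ∀ v → x v - x (f v) ≡ on-cycle v - δ root v * + girth
  x-difference v with v Fin.≟ root
  ... | yes refl = trans (cong₂ _-_ x-root (winding-c (depth (f v)) 1 ℕ.≤-refl))
    (≡-sym (trans (cong₂ (λ y z → y - z * + girth) (on-cycle-c {0} (ℕ.s≤s ℕ.z≤n)) (δ-refl v))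
      (ring (+ depth (f v)))))
    where
    ring : ∀ k → + 1 - + 1 * (+ 1 + k) ≡ + 0 - k
    ring = solve-∀
  ... | no v≢root = trans
    (cong (λ k → winding k v - x (f v)) (depth-parent v v≢root))
    (trans (ring (on-cycle v) (x (f v)) (+ girth))
      (cong (λ y → on-cycle v - y * + girth) (≡-sym (δ-≢ (v≢root ∘ ≡-sym)))))
    where
    ring : ∀ y z k → y + z - z ≡ y - + 0 * k
    ring = solve-∀

  -- Summation by parts moves the differences of `x` onto the edge vectors; the cycle relation
  -- removes the `on-cycle` part, and only the jump at the root remains.
  x-combination : ∀ i → ∑ (λ v → x v * - L i v) ≡ - + girth * b root i
  x-combination i = begin
    ∑ (λ v → x v * - L i v)
      ≡⟨ ∑-cong (λ v → trans (cong (x v *_) (-L-b i v)) (ring₁ (x v) (b v i) (∑ (λ u → δ (f u) v * b u i)))) ⟩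
    ∑ (λ v → x v * b v i - x v * ∑ (λ u → δ (f u) v * b u i))
      ≡⟨ ∑-- (λ v → x v * b v i) (λ v → x v * ∑ (λ u → δ (f u) v * b u i)) ⟩
    ∑ (λ v → x v * b v i) - ∑ (λ v → x v * ∑ (λ u → δ (f u) v * b u i))
      ≡⟨ cong (λ y → ∑ (λ v → x v * b v i) - y) regroup ⟩
    ∑ (λ v → x v * b v i) - ∑ (λ u → x (f u) * b u i)
      ≡⟨ ∑-- (λ v → x v * b v i) (λ u → x (f u) * b u i) ⟨
    ∑ (λ v → x v * b v i - x (f v) * b v i)
      ≡⟨ ∑-cong (λ v → trans (ring₂ (x v) (x (f v)) (b v i))
           (trans (cong (_* b v i) (x-difference v)) (ring₃ (on-cycle v) (δ root v) (+ girth) (b v i)))) ⟩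
    ∑ (λ v → on-cycle v * b v i - + girth * (δ root v * b v i))
      ≡⟨ ∑-- (λ v → on-cycle v * b v i) (λ v → + girth * (δ root v * b v i)) ⟩
    ∑ (λ v → on-cycle v * b v i) - ∑ (λ v → + girth * (δ root v * b v i))
      ≡⟨ cong₂ _-_ (∑-on-cycle-b i) (trans (∑-*ˡ (+ girth) (λ v → δ root v * b v i))
           (cong (+ girth *_) (∑-δ root (λ v → b v i)))) ⟩
    + 0 - + girth * b root i
      ≡⟨ ring₄ (+ girth) (b root i) ⟩
    - + girth * b root i ∎
    where
    ring₁ : ∀ x y z → x * (y - z) ≡ x * y - x * z
    ring₁ = solve-∀
    ring₂ : ∀ x y z → x * z - y * z ≡ (x - y) * z
    ring₂ = solve-∀
    ring₃ : ∀ o e g y → (o - e * g) * y ≡ o * y - g * (e * y)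
    ring₃ = solve-∀
    ring₄ : ∀ g y → + 0 - g * y ≡ - g * y
    ring₄ = solve-∀
    ring₅ : ∀ x e y → x * (e * y) ≡ e * x * y
    ring₅ = solve-∀
    regroup : ∑ (λ v → x v * ∑ (λ u → δ (f u) v * b u i)) ≡ ∑ (λ u → x (f u) * b u i)
    regroup = trans
      (∑-cong (λ v → trans (≡-sym (∑-*ˡ (x v) (λ u → δ (f u) v * b u i)))
        (∑-cong (λ u → ring₅ (x v) (δ (f u) v) (b u i)))))
      (trans (∑-swap (λ v u → δ (f u) v * x v * b u i))
        (∑-cong (λ u → trans (∑-*ʳ (b u i) (λ v → δ (f u) v * x v))
          (cong (_* b u i) (∑-δ (f u) x)))))

  -- The cycle vertex just before the root. Since `x z` is 1, its column can be replaced by the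
  -- combination with coefficients `x`.
  z : Fin n
  z = c (depth (f root))

  f-z : f z ≡ root
  f-z = c-girth

  z≢root : z ≢ root
  z≢root e = no-2-cycle root (trans (cong (λ v → f (f v)) (≡-sym e)) (trans (cong f f-z) (trans (cong f (≡-sym e)) f-z)))

  x-z : x z ≡ + 1
  x-z = trans (cong (λ k → winding k z) (depth-parent z z≢root)) (cong₂ _+_
    (on-cycle-c (ℕ.n<1+n _)) (trans (cong x f-z) x-root))

  ones : Fin n → ℤ
  ones _ = + 1

  M M′ : Matrix n
  M = bordered root
  M′ = M [ z ≔ b root ]

  M-combination : ∀ i → ∑ (λ v → x v * M i v) ≡ - + girth * b root i
  M-combination i = trans (∑-cong (λ v → ≟-cases v root
    (λ { refl → trans (cong (_* M i v) x-root) (≡-sym (cong (_* - L i v) x-root)) })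
    (λ v≢root → cong (x v *_) (≔-off (λ i j → - L i j) root ones i v≢root)))) (x-combination i)

  -- The column operation at `z` pulls out the girth. The column of ones does not interfere, because
  -- `x root` is 0.
  det-M : det M ≡ - + girth * det M′
  det-M = begin
    det M
      ≡⟨ ℤ.*-identityˡ (det M) ⟨
    + 1 * det M
      ≡⟨ cong (_* det M) x-z ⟨
    x z * det M
      ≡⟨ det-combination M z x ⟨
    det (M [ z ≔ (λ i → ∑ (λ v → x v * M i v)) ])
      ≡⟨ ≔-cong M z M-combination ⟩
    det (M [ z ≔ (λ i → - + girth * b root i) ])
      ≡⟨ ≔-* M z (- + girth) (b root) ⟩
    - + girth * det M′ ∎

  -- The columns of N k generate the lattice of vectors whose coordinate sum is a multiple of k.
  N : ℤ → Matrix n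
  N k i v = δ v i - δ root i + δ v root * (k * δ root i)

  N-root : ∀ k i → N k i root ≡ k * δ root i
  N-root k i = trans (cong (λ y → δ root i - δ root i + y * (k * δ root i)) (δ-refl root)) (ring (δ root i) k)
    where
    ring : ∀ e k → e - e + + 1 * (k * e) ≡ k * e
    ring = solve-∀

  N-off : ∀ k i {v} → v ≢ root → N k i v ≡ δ v i - δ root i
  N-off k i {v} v≢root = trans (cong (λ y → δ v i - δ root i + y * (k * δ root i)) (δ-≢ v≢root))
    (ring (δ v i) (δ root i) k)
    where
    ring : ∀ y e k → y - e + + 0 * (k * e) ≡ y - e
    ring = solve-∀

  -- The coefficients are `w v` off the root and `s` at the root: the columns off the root reproduce
  -- `w` except that the root coordinate is too small by the total sum k s, which the root column
  -- supplies.
  N-span : ∀ k s (w : Fin n → ℤ) → ∑ w ≡ k * s → InSpan (N k) w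
  N-span k s w e = (λ v → w v + δ root v * (s - w root)) , λ i → ≡-sym (begin
    ∑ (λ v → (w v + δ root v * (s - w root)) * N k i v)
      ≡⟨ ∑-cong (λ v → ring₁ (w v) (δ root v) (s - w root) (N k i v)) ⟩
    ∑ (λ v → w v * N k i v + δ root v * ((s - w root) * N k i v))
      ≡⟨ ∑-+ (λ v → w v * N k i v) (λ v → δ root v * ((s - w root) * N k i v)) ⟩
    ∑ (λ v → w v * N k i v) + ∑ (λ v → δ root v * ((s - w root) * N k i v))
      ≡⟨ cong₂ _+_ (expand i) (trans (∑-δ root (λ v → (s - w root) * N k i v)) (cong ((s - w root) *_) (N-root k i))) ⟩
    (w i - ∑ w * δ root i + w root * (k * δ root i)) + (s - w root) * (k * δ root i)
      ≡⟨ cong (λ y → (w i - y * δ root i + w root * (k * δ root i)) + (s - w root) * (k * δ root i)) e ⟩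
    (w i - k * s * δ root i + w root * (k * δ root i)) + (s - w root) * (k * δ root i)
      ≡⟨ ring₂ (w i) k s (δ root i) (w root) ⟩
    w i ∎)
    where
    ring₁ : ∀ w e t y → (w + e * t) * y ≡ w * y + e * (t * y)
    ring₁ = solve-∀
    ring₂ : ∀ w k s e r → (w - k * s * e + r * (k * e)) + (s - r) * (k * e) ≡ w
    ring₂ = solve-∀
    ring₃ : ∀ w y e r k → w * (y - e + r * (k * e)) ≡ (y * w - w * e) + r * (w * (k * e))
    ring₃ = solve-∀
    expand : ∀ i → ∑ (λ v → w v * N k i v) ≡ w i - ∑ w * δ root i + w root * (k * δ root i)
    expand i = trans (∑-cong (λ v → ring₃ (w v) (δ v i) (δ root i) (δ v root) k))
      (trans (∑-+ (λ v → δ v i * w v - w v * δ root i) (λ v → δ v root * (w v * (k * δ root i))))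
        (cong₂ _+_ (trans (∑-- (λ v → δ v i * w v) (λ v → w v * δ root i))
            (cong₂ _-_ (∑-δʳ i w) (∑-*ʳ (δ root i) w)))
          (∑-δʳ root (λ v → w v * (k * δ root i)))))

  ∑-b : ∀ v → ∑ (b v) ≡ + 0
  ∑-b v = trans (∑-- (δ (f v)) (δ v)) (trans (cong₂ _-_ (one (f v)) (one v)) refl)
    where
    one : ∀ v → ∑ (δ v) ≡ + 1
    one v = trans (∑-single v (λ i i≢v → δ-≢ (i≢v ∘ ≡-sym))) (δ-refl v)

  M′-z : ∀ i → M′ i z ≡ b root i
  M′-z i = ≔-at M z (b root) i refl

  M′-root : ∀ i → M′ i root ≡ + 1
  M′-root i = trans (≔-off M z (b root) i (z≢root ∘ ≡-sym)) (≔-at (λ i j → - L i j) root ones i refl)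

  M′-off : ∀ i {v} → v ≢ z → v ≢ root → M′ i v ≡ - L i v
  M′-off i v≢z v≢root = trans (≔-off M z (b root) i v≢z) (≔-off (λ i j → - L i j) root ones i v≢root)

  -- Columns of -L and edge vectors have coordinate sum 0, and the column of ones has sum n.
  M′∈N : ∀ v → InSpan (N (+ n)) (λ i → M′ i v)
  M′∈N v = ≟-cases v z
    (λ { refl → N-span (+ n) (+ 0) (λ i → M′ i v)
      (trans (∑-cong M′-z) (trans (∑-b root) (≡-sym (ℤ.*-zeroʳ (+ n))))) })
    (λ v≢z → ≟-cases v root
      (λ { refl → N-span (+ n) (+ 1) (λ i → M′ i v) (trans (∑-cong M′-root) (∑-const {n} (+ 1))) })
      (λ v≢root → N-span (+ n) (+ 0) (λ i → M′ i v) (trans (∑-cong (λ i → trans (M′-off i v≢z v≢root)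
          (trans (cong -_ (L-sym i v)) (ring (L v i)))))
        (trans (∑-*ˡ (- + 1) (L v)) (trans (cong (- + 1 *_) (L-row-sum v)) (≡-sym (ℤ.*-zeroʳ (+ n))))))))
    where
    ring : ∀ y → - y ≡ - + 1 * y
    ring = solve-∀

  span-0 : ∀ {S : Matrix n} {w} → (∀ i → w i ≡ + 0) → InSpan S w
  span-0 e = (λ _ → + 0) , λ i → trans (e i) (≡-sym (∑-zero {n} (λ _ → refl)))

  -- Solving `-L-b` for `b v` leaves the edge vectors of the children, which are deeper than `v`
  -- unless the child is the root; `k` bounds the levels still below. The vector of the root is
  -- available as column `z`. Since that column replaced the Laplacian one, `z` is excluded; it
  -- never arises as a child here because its parent is the root.
  b∈M′-fuel : ∀ k v → v ≢ z → v ≡ root ⊎ proj₁ (bounded depth) ℕ.≤ k ℕ.+ depth v → InSpan M′ (b v)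
  b∈M′-fuel k v v≢z _ with v Fin.≟ root
  b∈M′-fuel k v v≢z _ | yes refl = span-cong M′-z (span-column {S = M′} z)
  b∈M′-fuel k v v≢z (inj₁ v≡root) | no v≢root = ⊥-elim (v≢root v≡root)
  b∈M′-fuel zero v v≢z (inj₂ p) | no v≢root =
    ⊥-elim (ℕ.<-irrefl refl (ℕ.<-≤-trans (proj₂ (bounded depth) v) p))
  b∈M′-fuel (suc k) v v≢z (inj₂ p) | no v≢root =
    span-cong (λ i → ≡-sym (trans (move i) (cong (λ y → y + ∑ (λ u → δ (f u) v * b u i)) (≡-sym (M′-off i v≢z v≢root)))))
      (span-+ {u = λ i → M′ i v} {λ i → ∑ (λ u → δ (f u) v * b u i)} (span-column {S = M′} v)
        (span-∑ (λ u i → δ (f u) v * b u i) child))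
    where
    ring : ∀ y s → y ≡ y - s + s
    ring = solve-∀
    move : ∀ i → b v i ≡ - L i v + ∑ (λ u → δ (f u) v * b u i)
    move i = trans (ring (b v i) (∑ (λ u → δ (f u) v * b u i)))
      (cong (λ y → y + ∑ (λ u → δ (f u) v * b u i)) (≡-sym (-L-b i v)))
    child : ∀ u → InSpan M′ (λ i → δ (f u) v * b u i)
    child u = ≟-cases (f u) v
      (λ fu≡v → span-* (δ (f u) v) {b u} (b∈M′-fuel k u
        (λ u≡z → v≢root (trans (≡-sym fu≡v) (trans (cong f u≡z) f-z)))
        (≟-cases u root inj₁ (λ u≢root → inj₂ (subst (proj₁ (bounded depth) ℕ.≤_)
          (trans (≡-sym (ℕ.+-suc k (depth v))) (cong (ℕ._+_ k)
            (≡-sym (trans (depth-parent u u≢root) (cong (suc ∘ depth) fu≡v))))) p)))))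
      (λ fu≢v → span-0 (λ i → cong (_* b u i) (δ-≢ fu≢v)))

  b∈M′-off : ∀ v → v ≢ z → InSpan M′ (b v)
  b∈M′-off v v≢z = b∈M′-fuel (proj₁ (bounded depth)) v v≢z (inj₂ (ℕ.m≤m+n _ (depth v)))

  b∈M′ : ∀ v → InSpan M′ (b v)
  b∈M′ v = ≟-cases v z (λ { refl → at-z }) (b∈M′-off v)
    where
    -- By the cycle relation `b z` is minus the sum of the other cycle edges; this coefficient
    -- vanishes at `z` itself.
    coefficient : Fin n → ℤ
    coefficient v = δ z v - on-cycle v
    ring : ∀ e o y → (e - o) * y ≡ e * y - o * y
    ring = solve-∀
    sum : ∀ i → ∑ (λ v → coefficient v * b v i) ≡ b z i
    sum i = trans (∑-cong (λ v → ring (δ z v) (on-cycle v) (b v i)))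
      (trans (∑-- (λ v → δ z v * b v i) (λ v → on-cycle v * b v i))
        (trans (cong₂ _-_ (∑-δ z (λ v → b v i)) (∑-on-cycle-b i)) (ℤ.+-identityʳ (b z i))))
    at-z : InSpan M′ (b z)
    at-z = span-cong sum (span-∑ (λ v i → coefficient v * b v i) (λ v → ≟-cases v z
      (λ { refl → span-0 (λ i → cong (_* b v i) (cong₂ _-_ (δ-refl v) (on-cycle-c (ℕ.n<1+n _)))) })
      (λ v≢z → span-* (coefficient v) {b v} (b∈M′-off v v≢z))))

  -- The edge vectors along the path from `v` to the root telescope to this difference, up to sign.
  difference∈M′ : ∀ k v → depth v ≡ k → InSpan M′ (λ i → δ v i - δ root i)
  difference∈M′ zero v e = span-0 (λ i → trans (cong (λ u → δ u i - δ root i) (depth≡0 e)) (-≡0 (δ root i)))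
  difference∈M′ (suc k) v e = span-cong (λ i → ring (δ (f v) i) (δ root i) (δ v i))
    (span-- {u = λ i → δ (f v) i - δ root i} {b v} (difference∈M′ k (f v) (proj₂ (depth≡suc e))) (b∈M′ v))
    where
    ring : ∀ x y z → x - y - (x - z) ≡ z - y
    ring = solve-∀

  N∈M′ : ∀ v → InSpan M′ (λ i → N (+ n) i v)
  N∈M′ v = ≟-cases v root
    -- The multiple of the root vector by n is the column of ones minus all the differences from the
    -- root.
    (λ { refl → span-cong (λ i → trans (sum i) (≡-sym (N-root (+ n) i)))
      (span-- {u = λ i → M′ i root} {λ i → ∑ (λ v → δ v i - δ root i)} (span-column {S = M′} root)
        (span-∑ (λ v i → δ v i - δ root i) (λ v → difference∈M′ (depth v) v refl))) })
    (λ v≢root → span-cong (λ i → ≡-sym (N-off (+ n) i v≢root)) (difference∈M′ (depth v) v refl))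
    where
    ring : ∀ y → + 1 - (+ 1 - y) ≡ y
    ring = solve-∀
    sum : ∀ i → M′ i root - ∑ (λ v → δ v i - δ root i) ≡ + n * δ root i
    sum i = trans (cong₂ _-_ (M′-root i) (trans (∑-- (λ v → δ v i) (λ _ → δ root i))
        (cong₂ _-_ (trans (∑-single i (λ v v≢i → δ-≢ v≢i)) (δ-refl i)) (∑-const {n} (δ root i)))))
      (ring (+ n * δ root i))

  det-N : det (N (+ n)) ≡ + n * det (N (+ 1))
  det-N = trans (det-linear root (+ n) (+ 0) {N (+ n)} {N (+ 1)} {N (+ 1)}
      (λ i → trans (N-root (+ n) i) (trans (ring₁ (+ n) (δ root i))
        (cong (λ y → + n * y + + 0 * y) (≡-sym (N-root (+ 1) i)))))
      (λ i v v≢root → trans (N-off (+ n) i v≢root) (≡-sym (N-off (+ 1) i v≢root)))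
      (λ i v v≢root → trans (N-off (+ n) i v≢root) (≡-sym (N-off (+ 1) i v≢root))))
    (ring₂ (+ n) (det (N (+ 1))))
    where
    ring₁ : ∀ k y → k * y ≡ k * (+ 1 * y) + + 0 * (+ 1 * y)
    ring₁ = solve-∀
    ring₂ : ∀ k y → k * y + + 0 * y ≡ k * y
    ring₂ = solve-∀

  -- For k = 1 the lattice is everything, so this determinant divides that of the identity.
  ∣det-N₁∣ : ∣ det (N (+ 1)) ∣ ≡ 1
  ∣det-N₁∣ = ℕ.∣1⇒≡1 (∣⇒∣ᵤ (subst (det (N (+ 1)) ∣_) (det-identity {n})
    (span-divides (N (+ 1)) δ (λ j → N-span (+ 1) (∑ (λ i → δ i j)) (λ i → δ i j) (≡-sym (ℤ.*-identityˡ _))))))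

  ∣det-bordered∣ : ∣ det (bordered root) ∣ ≡ girth ℕ.* n
  ∣det-bordered∣ = trans (cong ∣_∣ det-M) (trans (ℤ.abs-* (- + girth) (det M′)) (cong (girth ℕ.*_)
    (trans (ℕ.∣-antisym (∣⇒∣ᵤ (span-divides M′ (N (+ n)) N∈M′)) (∣⇒∣ᵤ (span-divides (N (+ n)) M′ M′∈N)))
      (trans (cong ∣_∣ det-N) (trans (ℤ.abs-* (+ n) (det (N (+ 1))))
        (trans (cong (n ℕ.*_) ∣det-N₁∣) (ℕ.*-identityʳ n)))))))

-- Spanning trees

true≢false : true ≢ false
true≢false ()

¬false : ∀ {b} → b ≢ false → b ≡ true
¬false {true} _ = refl
¬false {false} p = ⊥-elim (p refl)

Closed : Graph n → (Fin n → Bool) → Set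
Closed G χ = ∀ u v → χ u ≡ true → adj G u v ≡ true → χ v ≡ true

-- The indicator `x` of the complement of a closed set is in the kernel of L. As it vanishes at `r`,
-- it does not meet the column of ones, and it is a linear relation among the columns with
-- coefficient 1 at `w`.
closed⇒det-bordered≡0 : (G : Graph n) (χ : Fin n → Bool) → Closed G χ →
  ∀ r w → χ r ≡ true → χ w ≡ false → det (Laplacian.bordered G r) ≡ + 0
closed⇒det-bordered≡0 {n} G χ closed r w χr χw = begin
  det B
    ≡⟨ ℤ.*-identityˡ (det B) ⟨
  + 1 * det B
    ≡⟨ cong (λ y → ⟦ not y ⟧ * det B) χw ⟨
  x w * det B
    ≡⟨ det-combination B w x ⟨
  det (B [ w ≔ (λ i → ∑ (λ v → x v * B i v)) ])
    ≡⟨ ≔-0 B w (λ i → trans (∑-cong (entry i)) (row i)) ⟩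
  + 0 ∎
  where
  open Laplacian G
  B = bordered r
  x : Fin n → ℤ
  x v = ⟦ not (χ v) ⟧
  ring₁ : ∀ x δ d a → x * - (δ * d - a) ≡ x * a - δ * (d * x)
  ring₁ = solve-∀
  χ-adjacent : ∀ i v → adj G i v ≡ true → χ v ≡ χ i
  χ-adjacent i v e with χ i in χi | χ v in χv
  ... | true  | true  = refl
  ... | false | false = refl
  ... | true  | false = ≡-sym (trans (≡-sym (closed i v χi e)) χv)
  ... | false | true  = trans (≡-sym (closed v i χv (trans (Graph.sym G v i) e))) χi
  x-a : ∀ i v → x v * a i v ≡ x i * a i v
  x-a i v with adj G i v in e
  ... | true = cong (λ y → ⟦ not y ⟧ * + 1) (χ-adjacent i v e)
  ... | false = trans (ℤ.*-zeroʳ (x v)) (≡-sym (ℤ.*-zeroʳ (x i)))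
  entry : ∀ i v → x v * B i v ≡ x i * a i v - δ i v * (d i * x v)
  entry i v = trans (≟-cases v r
      (λ { refl → trans (cong (_* B i v) x-r) (≡-sym (cong (_* - L i v) x-r)) })
      (λ v≢r → cong (x v *_) (≔-off (λ i j → - L i j) r (λ _ → + 1) i v≢r)))
    (trans (cong (λ y → x v * - y) (L-def i v)) (trans (ring₁ (x v) (δ i v) (d i) (a i v))
      (cong (λ y → y - δ i v * (d i * x v)) (x-a i v))))
    where
    x-r : x r ≡ + 0
    x-r = cong (λ y → ⟦ not y ⟧) χr
  row : ∀ i → ∑ (λ v → x i * a i v - δ i v * (d i * x v)) ≡ + 0
  row i = trans (∑-- (λ v → x i * a i v) (λ v → δ i v * (d i * x v))) (trans
    (cong₂ _-_ (trans (∑-*ˡ (x i) (a i)) (trans (cong (x i *_) (≡-sym (d-∑ i))) (ℤ.*-comm (x i) (d i))))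
      (∑-δ i (λ v → d i * x v)))
    (-≡0 (d i * x i)))

count≤n : (χ : Fin n → Bool) → count χ ℕ.≤ n
count≤n {zero} χ = ℕ.z≤n
count≤n {suc n} χ with χ zero
... | true  = ℕ.s≤s (count≤n (χ ∘ suc))
... | false = ℕ.m≤n⇒m≤1+n (count≤n (χ ∘ suc))

count-mono : (χ ψ : Fin n → Bool) → (∀ i → χ i ≡ true → ψ i ≡ true) → count χ ℕ.≤ count ψ
count-mono {zero} χ ψ p = ℕ.z≤n
count-mono {suc n} χ ψ p with χ zero in e | ψ zero in e′
... | true  | true  = ℕ.s≤s (count-mono (χ ∘ suc) (ψ ∘ suc) (p ∘ suc))
... | true  | false = ⊥-elim (true≢false (trans (≡-sym (p zero e)) e′))
... | false | true  = ℕ.m≤n⇒m≤1+n (count-mono (χ ∘ suc) (ψ ∘ suc) (p ∘ suc))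
... | false | false = count-mono (χ ∘ suc) (ψ ∘ suc) (p ∘ suc)

count-strict : (χ ψ : Fin n → Bool) → (∀ i → χ i ≡ true → ψ i ≡ true) →
  ∀ v → χ v ≡ false → ψ v ≡ true → count χ ℕ.< count ψ
count-strict {suc n} χ ψ p zero χv ψv rewrite χv | ψv =
  ℕ.s≤s (count-mono (χ ∘ suc) (ψ ∘ suc) (p ∘ suc))
count-strict {suc n} χ ψ p (suc v) χv ψv with χ zero in e | ψ zero in e′
... | true  | true  = ℕ.s≤s (count-strict (χ ∘ suc) (ψ ∘ suc) (p ∘ suc) v χv ψv)
... | true  | false = ⊥-elim (true≢false (trans (≡-sym (p zero e)) e′))
... | false | true  = ℕ.m≤n⇒m≤1+n (count-strict (χ ∘ suc) (ψ ∘ suc) (p ∘ suc) v χv ψv)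
... | false | false = count-strict (χ ∘ suc) (ψ ∘ suc) (p ∘ suc) v χv ψv

-- `χ` marks the vertices reached so far; `parent` and `depth` are total functions with arbitrary
-- values outside it.
record PartialTree (G : Graph n) (r : Fin n) : Set where
  field
    χ          : Fin n → Bool
    parent     : Fin n → Fin n
    depth      : Fin n → ℕ
    root∈χ     : χ r ≡ true
    depth-root : depth r ≡ 0
    link       : ∀ v → χ v ≡ true → v ≢ r →
      adj G v (parent v) ≡ true × χ (parent v) ≡ true × depth v ≡ suc (depth (parent v))

SpanningTree : Graph n → Fin n → Set
SpanningTree G r = Σ (PartialTree G r) λ T → ∀ v → PartialTree.χ T v ≡ true

singleton-tree : (G : Graph n) (r : Fin n) → PartialTree G r
singleton-tree G r = record
  { χ = r ==_ ; parent = λ v → v ; depth = λ _ → 0 ; root∈χ = ==-refl r ; depth-root = refl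
  ; link = λ v χv v≢r → ⊥-elim (true≢false (trans (≡-sym χv) (==-≢ (v≢r ∘ ≡-sym)))) }

extend : {G : Graph n} {r : Fin n} (T : PartialTree G r) →
  ∀ u v → PartialTree.χ T u ≡ true → adj G u v ≡ true → PartialTree.χ T v ≡ false →
  Σ (PartialTree G r) λ T′ → count (PartialTree.χ T) ℕ.< count (PartialTree.χ T′)
extend {n} {G} {r} T u v χu uv χv = T′ ,
  count-strict χ χ′ (λ w → χ⊆χ′ w) v χv χ′v
  where
  open PartialTree T
  χ′ : Fin n → Bool
  χ′ w = if w == v then true else χ w
  parent′ : Fin n → Fin n
  parent′ w = if w == v then u else parent w
  depth′ : Fin n → ℕ
  depth′ w = if w == v then suc (depth u) else depth w
  χ′v : χ′ v ≡ true
  χ′v rewrite ==-refl v = refl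
  χ⊆χ′ : ∀ w → χ w ≡ true → χ′ w ≡ true
  χ⊆χ′ w e with w == v
  ... | true  = refl
  ... | false = e
  ∈⇒≢ : ∀ {w} → χ w ≡ true → w ≢ v
  ∈⇒≢ e refl = true≢false (trans (≡-sym e) χv)
  parent′-off : ∀ {w} → w ≢ v → parent′ w ≡ parent w
  parent′-off w≢v rewrite ==-≢ w≢v = refl
  depth′-off : ∀ {w} → w ≢ v → depth′ w ≡ depth w
  depth′-off w≢v rewrite ==-≢ w≢v = refl
  χ′-off : ∀ {w} → w ≢ v → χ′ w ≡ χ w
  χ′-off w≢v rewrite ==-≢ w≢v = refl
  parent′-v : parent′ v ≡ u
  parent′-v rewrite ==-refl v = refl
  depth′-v : depth′ v ≡ suc (depth u)
  depth′-v rewrite ==-refl v = refl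
  Link : Fin n → Fin n → Set
  Link w p = adj G w p ≡ true × χ′ p ≡ true × depth′ w ≡ suc (depth′ p)
  link′ : ∀ w → χ′ w ≡ true → w ≢ r → Link w (parent′ w)
  link′ w e w≢r = ≟-cases w v
    (λ { refl → subst (Link w) (≡-sym parent′-v)
      ( trans (Graph.sym G w u) uv , χ⊆χ′ u χu
      , trans depth′-v (cong suc (≡-sym (depth′-off (∈⇒≢ χu))))) })
    (λ w≢v → subst (Link w) (≡-sym (parent′-off w≢v))
      (let (wp , χp , dp) = link w (trans (≡-sym (χ′-off w≢v)) e) w≢r in
        wp , χ⊆χ′ (parent w) χp
        , trans (depth′-off w≢v) (trans dp (cong suc (≡-sym (depth′-off (∈⇒≢ χp)))))))
  T′ : PartialTree G r
  T′ = record
    { χ = χ′ ; parent = parent′ ; depth = depth′ ; root∈χ = χ⊆χ′ r root∈χ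
    ; depth-root = trans (depth′-off (∈⇒≢ root∈χ)) depth-root ; link = link′ }

ProperClosed : Graph n → Fin n → Set
ProperClosed {n} G r =
  Σ (Fin n → Bool) λ χ → Closed G χ × χ r ≡ true × Σ (Fin n) λ w → χ w ≡ false

-- As long as an edge leaves the tree, it is added and the tree gains a vertex, so `k` steps
-- suffice. When none leaves, the vertex set is closed: either everything or a witness of
-- disconnectedness.
grow : {G : Graph n} {r : Fin n} (k : ℕ) (T : PartialTree G r) →
  n ℕ.≤ k ℕ.+ count (PartialTree.χ T) → SpanningTree G r ⊎ ProperClosed G r
grow {n} {G} {r} k T p with Fin.any? (λ u → Fin.any? (λ v →
    (χ u Bool.≟ true) ×-dec ((adj G u v Bool.≟ true) ×-dec (χ v Bool.≟ false))))
  where open PartialTree T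
... | yes (u , v , χu , uv , χv) with extend T u v χu uv χv
grow {n} zero T p | yes _ | T′ , lt =
  ⊥-elim (ℕ.<-irrefl refl (ℕ.<-≤-trans lt (ℕ.≤-trans (count≤n (PartialTree.χ T′)) p)))
grow {n} (suc k) T p | yes _ | T′ , lt =
  grow k T′ (ℕ.≤-trans p (subst (ℕ._≤ k ℕ.+ count (PartialTree.χ T′)) (ℕ.+-suc k _) (ℕ.+-monoʳ-≤ k lt)))
grow {n} {G} {r} k T p | no ∄ with Fin.any? (λ w → PartialTree.χ T w Bool.≟ false)
... | yes (w , χw) = inj₂ (χ , (λ u v χu uv → ¬false (λ χv → ∄ (u , v , χu , uv , χv))) , root∈χ , w , χw)
  where open PartialTree T
... | no ∄w = inj₁ (T , λ v → ¬false (λ χv → ∄w (v , χv)))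

spanning-tree-or-closed : (G : Graph n) (r : Fin n) → SpanningTree G r ⊎ ProperClosed G r
spanning-tree-or-closed {n} G r = grow n (singleton-tree G r) (ℕ.m≤m+n n _)

-- Unicyclic structure from connectedness and the edge count

module _ (G : Graph n) (a b : Fin n) where

  private
    removed : Fin n → Fin n → Bool
    removed u v = (u == a) ∧ (v == b)

    removed-false : ∀ u v → ¬ (u ≡ a × v ≡ b) → removed u v ≡ false
    removed-false u v p with u Fin.≟ a | v Fin.≟ b
    ... | yes e | yes e′ = ⊥-elim (p (e , e′))
    ... | yes _ | no _   = refl
    ... | no _  | _      = refl

  delete-edge : Graph n
  delete-edge = record
    { adj    = λ u v → adj G u v ∧ not (removed u v ∨ removed v u)
    ; sym    = λ u v → cong₂ _∧_ (Graph.sym G u v) (cong not (Bool.∨-comm (removed u v) (removed v u)))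
    ; irrefl = λ u → cong (_∧ not (removed u u ∨ removed u u)) (irrefl G u) }

  delete-edge⁺ : ∀ u v → adj G u v ≡ true → ¬ (u ≡ a × v ≡ b) → ¬ (v ≡ a × u ≡ b) →
    adj delete-edge u v ≡ true
  delete-edge⁺ u v uv p q rewrite uv | removed-false u v p | removed-false v u q = refl

  delete-edge⁻ : ∀ {u v} → adj delete-edge u v ≡ true → adj G u v ≡ true
  delete-edge⁻ {u} {v} e with adj G u v
  ... | true = refl

  deleted : ¬ adj delete-edge b a ≡ true
  deleted e rewrite ==-refl a | ==-refl b | Bool.∨-zeroʳ (removed b a) | Bool.∧-zeroʳ (adj G b a) =
    true≢false (≡-sym e)

module _ (G : Graph n) (2n : ∑ (Laplacian.d G) ≡ + n + + n) where

  open Laplacian G using (a; d; d-∑; bordered; a-sym)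

  ∑∑-f : (f : Fin n → Fin n) → ∑ (λ u → ∑ (λ v → δ (f u) v)) ≡ + n
  ∑∑-f f = trans (∑-cong (λ u → trans (∑-single (f u) (λ i i≢ → δ-≢ (i≢ ∘ ≡-sym))) (δ-refl (f u))))
    (trans (∑-const {n} (+ 1)) (ℤ.*-identityʳ (+ n)))

  module _ {r} (T : SpanningTree G r) where

    open PartialTree (proj₁ T)

    TreeEdge : Fin n → Fin n → Set
    TreeEdge u v = u ≢ r × parent u ≡ v

    tree-edge? : ∀ u v → Dec (TreeEdge u v)
    tree-edge? u v = ¬? (u Fin.≟ r) ×-dec (parent u Fin.≟ v)

    ExtraEdge : Fin n → Fin n → Set
    ExtraEdge u v = adj G u v ≡ true × ¬ TreeEdge u v × ¬ TreeEdge v u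

    extra-edge? : ∀ u v → Dec (ExtraEdge u v)
    extra-edge? u v =
      (adj G u v Bool.≟ true) ×-dec (¬? (tree-edge? u v) ×-dec ¬? (tree-edge? v u))

    -- A tree accounts for 2(n - 1) ordered adjacent pairs, while the degree sum is 2n. If all edges
    -- were tree edges, the nonnegative `slack` would add up to -2.
    extra-edge : Σ (Fin n) λ u → Σ (Fin n) λ v → ExtraEdge u v
    extra-edge with Fin.any? (λ u → Fin.any? (extra-edge? u))
    ... | yes p = p
    ... | no ∄ = ⊥-elim (absurd (subst (+ 0 ℤ.≤_) total (∑-nonneg (λ u → ∑-nonneg (slack-nonneg u)))))
      where
      absurd : ¬ (+ 0 ℤ.≤ - + 2)
      absurd ()
      t : Fin n → Fin n → ℤ
      t u v = (+ 1 - δ r u) * δ (parent u) v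
      slack : Fin n → Fin n → ℤ
      slack u v = t u v + t v u - a u v
      t-tree : ∀ {u v} → TreeEdge u v → t u v ≡ + 1
      t-tree {u} (u≢r , refl) = cong₂ (λ x y → (+ 1 - x) * y) (δ-≢ (u≢r ∘ ≡-sym)) (δ-refl (parent u))
      t-nonneg : ∀ u v → + 0 ℤ.≤ t u v
      t-nonneg u v with r == u | parent u == v
      ... | true  | true  = ℤ.+≤+ ℕ.z≤n
      ... | true  | false = ℤ.+≤+ ℕ.z≤n
      ... | false | true  = ℤ.+≤+ ℕ.z≤n
      ... | false | false = ℤ.+≤+ ℕ.z≤n
      slack-nonneg : ∀ u v → + 0 ℤ.≤ slack u v
      slack-nonneg u v with adj G u v in uv
      ... | false = subst (+ 0 ℤ.≤_) (≡-sym (ℤ.+-identityʳ (t u v + t v u))) (ℤ.+-mono-≤ (t-nonneg u v) (t-nonneg v u))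
      ... | true with tree-edge? u v | tree-edge? v u
      ...   | yes e | _ = subst (+ 0 ℤ.≤_) (trans (ring (t v u)) (cong (λ x → x + t v u - + 1) (≡-sym (t-tree e)))) (t-nonneg v u)
        where
        ring : ∀ y → y ≡ + 1 + y - + 1
        ring = solve-∀
      ...   | no _ | yes e = subst (+ 0 ℤ.≤_) (trans (ring (t u v)) (cong (λ x → t u v + x - + 1) (≡-sym (t-tree e)))) (t-nonneg u v)
        where
        ring : ∀ y → y ≡ y + + 1 - + 1
        ring = solve-∀
      ...   | no p | no q = ⊥-elim (∄ (u , v , uv , p , q))
      ∑t : ∑ (λ u → ∑ (t u)) ≡ + n - + 1
      ∑t = trans (∑-cong (λ u → trans (∑-*ˡ (+ 1 - δ r u) (δ (parent u)))
          (trans (cong ((+ 1 - δ r u) *_) (trans (∑-single (parent u) (λ i i≢ → δ-≢ (i≢ ∘ ≡-sym))) (δ-refl (parent u))))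
            (ℤ.*-identityʳ (+ 1 - δ r u)))))
        (trans (∑-- (λ _ → + 1) (δ r)) (cong₂ _-_ (trans (∑-const {n} (+ 1)) (ℤ.*-identityʳ (+ n)))
          (trans (∑-single r (λ i i≢ → δ-≢ (i≢ ∘ ≡-sym))) (δ-refl r))))
      total : ∑ (λ u → ∑ (slack u)) ≡ - + 2
      total = trans (∑-cong (λ u → trans (∑-- (λ v → t u v + t v u) (a u))
          (cong₂ _-_ (∑-+ (t u) (λ v → t v u)) (≡-sym (d-∑ u)))))
        (trans (∑-- (λ u → ∑ (t u) + ∑ (λ v → t v u)) d)
          (trans (cong₂ _-_ (trans (∑-+ (λ u → ∑ (t u)) (λ u → ∑ (λ v → t v u)))
              (cong₂ _+_ ∑t (trans (∑-swap (λ u v → t v u)) ∑t))) 2n)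
            (ring (+ n))))
        where
        ring : ∀ k → k - + 1 + (k - + 1) - (k + k) ≡ - + 2
        ring = solve-∀

    -- Deleting the extra edge keeps the tree, hence keeps the graph connected.
    still-connected : ∀ {u v} → ExtraEdge u v → ∀ s → ¬ ProperClosed (delete-edge G u v) s
    still-connected {u} {v} (uv , p , q) s (ψ , closed , ψs , w , ψw) =
      true≢false (trans (≡-sym (down (depth w) w refl)) ψw)
      where
      edge : ∀ x → x ≢ r → adj (delete-edge G u v) x (parent x) ≡ true
      edge x x≢r = delete-edge⁺ G u v x (parent x) (proj₁ (link x (proj₂ T x) x≢r))
        (λ { (refl , e) → p (x≢r , e) }) (λ { (e , refl) → q (x≢r , e) })
      depth≡ : ∀ x → x ≢ r → depth x ≡ suc (depth (parent x))
      depth≡ x x≢r = proj₂ (proj₂ (link x (proj₂ T x) x≢r))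
      up : ∀ k x → depth x ≡ k → ψ x ≡ true → ψ r ≡ true
      up k x e ψx with x Fin.≟ r
      ... | yes refl = ψx
      up zero x e ψx | no x≢r with trans (≡-sym e) (depth≡ x x≢r)
      ... | ()
      up (suc k) x e ψx | no x≢r = up k (parent x) (ℕ.suc-injective (trans (≡-sym (depth≡ x x≢r)) e))
        (closed x (parent x) ψx (edge x x≢r))
      down : ∀ k x → depth x ≡ k → ψ x ≡ true
      down k x e with x Fin.≟ r
      ... | yes refl = up (depth s) s refl ψs
      down zero x e | no x≢r with trans (≡-sym e) (depth≡ x x≢r)
      ... | ()
      down (suc k) x e | no x≢r = closed (parent x) x
        (down k (parent x) (ℕ.suc-injective (trans (≡-sym (depth≡ x x≢r)) e)))
        (trans (Graph.sym (delete-edge G u v) (parent x) x) (edge x x≢r))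

  -- The tree is rooted at an end of the deleted edge, which therefore becomes the outgoing edge of
  -- the root. The n edges {v, f v} already use up the degree sum 2n, so `slack` is zero everywhere
  -- and there are no further edges.
  close-up : ∀ {r s} → adj G r s ≡ true → SpanningTree (delete-edge G r s) r → Unicyclic G
  close-up {r} {s} rs (T , spans) = record
    { f = f ; root = r ; depth = depth ; edges = edges ; no-2-cycle = no-2-cycle
    ; depth-root = depth-root ; depth-parent = λ v v≢r → trans (depth≡ v v≢r) (cong (suc ∘ depth) (≡-sym (f-off v≢r))) }
    where
    open PartialTree T
    f : Fin n → Fin n
    f v = if v == r then s else parent v
    f-root : f r ≡ s
    f-root rewrite ==-refl r = refl
    f-off : ∀ {v} → v ≢ r → f v ≡ parent v
    f-off v≢r rewrite ==-≢ v≢r = refl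
    edge : ∀ v → v ≢ r → adj (delete-edge G r s) v (parent v) ≡ true
    edge v v≢r = proj₁ (link v (spans v) v≢r)
    depth≡ : ∀ v → v ≢ r → depth v ≡ suc (depth (parent v))
    depth≡ v v≢r = proj₂ (proj₂ (link v (spans v) v≢r))
    s≢r : s ≢ r
    s≢r e = true≢false (trans (≡-sym rs) (trans (cong (adj G r) e) (irrefl G r)))
    -- The edge between `r` and `s` is missing from the tree; this rules out a 2-cycle through the
    -- root.
    parent-s : parent s ≢ r
    parent-s e = deleted G r s (subst (λ v → adj (delete-edge G r s) s v ≡ true) e (edge s s≢r))
    no-2-cycle : ∀ v → f (f v) ≢ v
    no-2-cycle v e = ≟-cases v r
      (λ { refl → parent-s (trans (≡-sym (trans (cong f f-root) (f-off s≢r))) e) })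
      (λ v≢r → ≟-cases (parent v) r
        (λ pv≡r → parent-s (trans (cong parent (trans (≡-sym (trans (cong f (trans (f-off v≢r) pv≡r)) f-root)) e)) pv≡r))
        (λ pv≢r → ℕ.m≢1+n+m (depth v) {1} (trans (depth≡ v v≢r) (cong suc (trans (depth≡ (parent v) pv≢r)
          (cong (suc ∘ depth) (trans (≡-sym (trans (cong f (f-off v≢r)) (f-off pv≢r))) e)))))))
    f-adjacent : ∀ u v → f u ≡ v → adj G u v ≡ true
    f-adjacent u v e = ≟-cases u r
      (λ { refl → subst (λ w → adj G u w ≡ true) (trans (≡-sym f-root) e) rs })
      (λ u≢r → subst (λ w → adj G u w ≡ true) (trans (≡-sym (f-off u≢r)) e) (delete-edge⁻ G r s (edge u u≢r)))
    slack : Fin n → Fin n → ℤ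
    slack u v = a u v - (δ (f u) v + δ (f v) u)
    slack-nonneg : ∀ u v → + 0 ℤ.≤ slack u v
    slack-nonneg u v with f u Fin.≟ v | f v Fin.≟ u
    ... | yes e | yes e′ = ⊥-elim (no-2-cycle u (trans (cong f e) e′))
    ... | yes e | no _ rewrite f-adjacent u v e = ℤ.+≤+ ℕ.z≤n
    ... | no _ | yes e rewrite trans (Graph.sym G u v) (f-adjacent v u e) = ℤ.+≤+ ℕ.z≤n
    ... | no _ | no _ = subst (+ 0 ℤ.≤_) (≡-sym (ℤ.+-identityʳ (a u v))) (⟦⟧-nonneg (adj G u v))
    total : ∑ (λ u → ∑ (slack u)) ≡ + 0
    total = trans (∑-cong (λ u → trans (∑-- (a u) (λ v → δ (f u) v + δ (f v) u))
        (cong₂ _-_ (≡-sym (d-∑ u)) (∑-+ (δ (f u)) (λ v → δ (f v) u)))))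
      (trans (∑-- d (λ u → ∑ (δ (f u)) + ∑ (λ v → δ (f v) u)))
        (trans (cong₂ _-_ 2n (trans (∑-+ (λ u → ∑ (δ (f u))) (λ u → ∑ (λ v → δ (f v) u)))
            (cong₂ _+_ (∑∑-f f) (trans (∑-swap (λ u v → δ (f v) u)) (∑∑-f f)))))
          (-≡0 (+ n + + n))))
    slack≡0 : ∀ u v → slack u v ≡ + 0
    slack≡0 u = ∑-nonneg-≡0 (slack-nonneg u) (∑-nonneg-≡0 (λ u → ∑-nonneg (slack-nonneg u)) total u)
    ⟦⟧-injective : ∀ x y → ⟦ x ⟧ ≡ ⟦ y ⟧ → x ≡ y
    ⟦⟧-injective true true _ = refl
    ⟦⟧-injective false false _ = refl
    ⟦⟧-injective true false ()
    ⟦⟧-injective false true ()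
    edges : ∀ u v → adj G u v ≡ (f u == v) ∨ (f v == u)
    edges u v = ⟦⟧-injective (adj G u v) _ (trans (ℤ.i-j≡0⇒i≡j (a u v) _ (slack≡0 u v)) disjoint)
      where
      disjoint : δ (f u) v + δ (f v) u ≡ ⟦ (f u == v) ∨ (f v == u) ⟧
      disjoint with f u Fin.≟ v | f v Fin.≟ u
      ... | yes e | yes e′ = ⊥-elim (no-2-cycle u (trans (cong f e) e′))
      ... | yes _ | no _  = refl
      ... | no _  | yes _ = refl
      ... | no _  | no _  = refl

  -- The first tree only serves to find an edge that can be deleted without disconnecting the graph;
  -- a second tree is then grown from an end of that edge, as `close-up` requires.
  unicyclic : Fin n → (∀ r → det (bordered r) ≢ + 0) → Unicyclic G
  unicyclic r det≢0 with spanning-tree-or-closed G r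
  ... | inj₂ (χ , closed , χr , w , χw) = ⊥-elim (det≢0 r (closed⇒det-bordered≡0 G χ closed r w χr χw))
  ... | inj₁ T with extra-edge T
  ...   | u , v , extra with spanning-tree-or-closed (delete-edge G u v) u
  ...     | inj₁ T′ = close-up (proj₁ extra) T′
  ...     | inj₂ C  = ⊥-elim (still-connected T extra u C)

-- The jellyfish graph

next : Fin (suc m) → Fin (suc m)
next {m} i with toℕ i ℕ.≟ m
... | yes _  = zero
... | no i≢m = suc (Fin.lower₁ i (i≢m ∘ ≡-sym))

next-last : {i : Fin (suc m)} → toℕ i ≡ m → next i ≡ zero
next-last {m} {i} e with toℕ i ℕ.≟ m
... | yes _ = refl
... | no p  = ⊥-elim (p e)

next-suc : {i : Fin (suc m)} → toℕ i ≢ m → Σ (Fin m) λ j → next i ≡ suc j × toℕ j ≡ toℕ i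
next-suc {m} {i} p with toℕ i ℕ.≟ m
... | yes e  = ⊥-elim (p e)
... | no i≢m = Fin.lower₁ i (i≢m ∘ ≡-sym) , refl , Fin.toℕ-lower₁ i (i≢m ∘ ≡-sym)

next-toℕ : {i : Fin (suc m)} → toℕ i ≢ m → toℕ (next i) ≡ suc (toℕ i)
next-toℕ {i = i} p with next-suc {i = i} p
... | j , e , e′ = trans (cong toℕ e) (cong suc e′)

prev : Fin (suc m) → Fin (suc m)
prev zero    = fromℕ _
prev (suc i) = inject₁ i

next-prev : (i : Fin (suc m)) → next (prev i) ≡ i
next-prev zero = next-last (Fin.toℕ-fromℕ _)
next-prev {m} (suc i) = Fin.toℕ-injective (trans (next-toℕ {i = inject₁ i} i≢m) (cong suc (Fin.toℕ-inject₁ i)))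
  where
  i≢m : toℕ (inject₁ i) ≢ m
  i≢m e = ℕ.<-irrefl (trans (≡-sym (Fin.toℕ-inject₁ i)) e) (Fin.toℕ<n i)

prev-next : (i : Fin (suc m)) → prev (next i) ≡ i
prev-next {m} i with toℕ i ℕ.≟ m
... | yes e  = Fin.toℕ-injective (trans (Fin.toℕ-fromℕ m) (≡-sym e))
... | no i≢m = Fin.inject₁-lower₁ i (i≢m ∘ ≡-sym)

next-next≢ : 2 ℕ.≤ m → (i : Fin (suc m)) → next (next i) ≢ i
next-next≢ {suc m} (ℕ.s≤s 1≤m) i e = first (toℕ i ℕ.≟ suc m)
  where
  second : toℕ i ≢ suc m → Dec (toℕ (next i) ≡ suc m) → ⊥
  second i≢m (yes ni≡m) = ℕ.<-irrefl (trans (cong toℕ (trans (≡-sym (next-last ni≡m)) e)) i≡m) 1≤m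
    where
    i≡m : toℕ i ≡ m
    i≡m = ℕ.suc-injective (trans (≡-sym (next-toℕ {i = i} i≢m)) ni≡m)
  second i≢m (no ni≢m) = ℕ.m≢1+n+m (toℕ i) {1} (trans (cong toℕ (≡-sym e))
    (trans (next-toℕ {i = next i} ni≢m) (cong suc (next-toℕ {i = i} i≢m))))
  first : Dec (toℕ i ≡ suc m) → ⊥
  first (yes i≡m) = ℕ.<-irrefl (trans (≡-sym 1≡) i≡m) (ℕ.s≤s 1≤m)
    where
    1≡ : toℕ i ≡ 1
    1≡ = trans (cong toℕ (trans (≡-sym e) (cong next (next-last i≡m)))) (next-toℕ {i = zero {suc m}} λ ())
  first (no i≢m) = second i≢m (toℕ (next i) ℕ.≟ suc m)

-- `cycAdj` is oriented: it records only the forward step around the cycle.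
cycAdj-next : (i j : Fin (suc m)) → cycAdj (suc m) (toℕ i) (toℕ j) ≡ (next i == j)
cycAdj-next {m} i j = by-last (toℕ i ℕ.≟ m)
  where
  i≡m⇒ : ∀ j → (suc m ℕ.≡ᵇ toℕ {suc m} j) ∨ ((suc m ℕ.≡ᵇ suc m) ∧ (toℕ j ℕ.≡ᵇ 0)) ≡ (zero == j)
  i≡m⇒ j = trans (cong₂ (λ x y → x ∨ (y ∧ (toℕ j ℕ.≡ᵇ 0)))
      (dec-false (suc m ℕ.≟ toℕ j) (λ e → ℕ.<-irrefl (≡-sym e) (Fin.toℕ<n j)))
      (dec-true (suc m ℕ.≟ suc m) refl))
    (zero-case j)
    where
    zero-case : ∀ j → (toℕ {suc m} j ℕ.≡ᵇ 0) ≡ (zero == j)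
    zero-case zero = refl
    zero-case (suc j) = refl
  by-last : Dec (toℕ i ≡ m) → cycAdj (suc m) (toℕ i) (toℕ j) ≡ (next i == j)
  by-last (yes e) = trans (cong (λ k → cycAdj (suc m) k (toℕ j)) e)
    (trans (i≡m⇒ j) (cong (_== j) (≡-sym (next-last e))))
  by-last (no i≢m) = trans (cong (λ x → (suc (toℕ i) ℕ.≡ᵇ toℕ j) ∨ (x ∧ (toℕ j ℕ.≡ᵇ 0)))
      (dec-false (suc (toℕ i) ℕ.≟ suc m) (i≢m ∘ ℕ.suc-injective)))
    (trans (Bool.∨-identityʳ _) (≟-cases (next i) j
      (λ e → trans (dec-true (suc (toℕ i) ℕ.≟ toℕ j) (trans (≡-sym (next-toℕ {i = i} i≢m)) (cong toℕ e)))
        (≡-sym (==-≡ e)))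
      (λ e → trans (dec-false (suc (toℕ i) ℕ.≟ toℕ j)
          (λ e′ → e (Fin.toℕ-injective (trans (next-toℕ {i = i} i≢m) e′))))
        (≡-sym (==-≢ e)))))

∑-++ : ∀ m (g : Fin (m ℕ.+ n) → ℤ) → ∑ g ≡ ∑ (λ i → g (i ↑ˡ n)) + ∑ (λ i → g (m ↑ʳ i))
∑-++ zero g = ≡-sym (ℤ.+-identityˡ (∑ g))
∑-++ {n} (suc m) g = trans (cong (ℤ._+_ (g zero)) (∑-++ m (g ∘ suc)))
  (≡-sym (ℤ.+-assoc (g zero) (∑ (λ i → g (suc (i ↑ˡ n)))) (∑ (λ i → g (suc (m ↑ʳ i))))))

∑-combine : ∀ m k (g : Fin (m ℕ.* k) → ℤ) → ∑ g ≡ ∑ {m} (λ i → ∑ {k} (λ a → g (combine i a)))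
∑-combine zero k g = refl
∑-combine (suc m) k g = trans (∑-++ k g)
  (cong (ℤ._+_ (∑ (λ i → g (i ↑ˡ (m ℕ.* k))))) (∑-combine m k (λ i → g (k ↑ʳ i))))

module Jellyfish (p m : ℕ) (2≤m : 2 ℕ.≤ m) where

  q : ℕ
  q = suc m

  Vertex : Set
  Vertex = Fin q × Fin (suc p)

  π : Fin (q ℕ.* suc p) → Vertex
  π = remQuot (suc p)

  ι : Vertex → Fin (q ℕ.* suc p)
  ι (i , a) = combine i a

  π-ι : ∀ x → π (ι x) ≡ x
  π-ι (i , a) = Fin.remQuot-combine i a

  ι-π : ∀ u → ι (π u) ≡ u
  ι-π u = Fin.combine-remQuot {q} (suc p) u

  step : Vertex → Vertex
  step (i , zero)  = next i , zero
  step (i , suc a) = i , zero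

  f : Fin (q ℕ.* suc p) → Fin (q ℕ.* suc p)
  f u = ι (step (π u))

  same-≡ : {x y : Vertex} → x ≡ y → same x y ≡ true
  same-≡ {x} refl = same-refl x

  same-≢ : {x y : Vertex} → x ≢ y → same x y ≡ false
  same-≢ {i , a} {j , b} x≢y with i Fin.≟ j | a Fin.≟ b
  ... | yes refl | yes refl = ⊥-elim (x≢y refl)
  ... | yes _    | no _     = refl
  ... | no _     | _        = refl

  f-same : ∀ u v → (f u == v) ≡ same (step (π u)) (π v)
  f-same u v = ≟-cases (f u) v
    (λ e → trans (==-≡ e) (≡-sym (same-≡ {step (π u)} {π v} (trans (≡-sym (π-ι (step (π u)))) (cong π e)))))
    (λ e → trans (==-≢ e) (≡-sym (same-≢ {step (π u)} {π v} (λ e′ → e (trans (cong ι e′) (ι-π v))))))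

  next≢ : ∀ i → next i ≢ i
  next≢ i e = next-next≢ 2≤m i (trans (cong next e) e)

  -- Pendant edges point to the leaf in `jfBase` and to the centre in `step`; symmetrization removes
  -- the difference. Between two centres, `not (same x y)` deletes nothing because no centre is its
  -- own successor.
  jfAdjPair-step : ∀ x y → jfAdjPair p q x y ≡ same (step x) y ∨ same (step y) x
  jfAdjPair-step (i , zero) (j , zero) = trans
    (cong₂ (λ A B → ((A ∨ ((i == j) ∧ false)) ∨ (B ∨ ((j == i) ∧ false))) ∧ not ((i == j) ∧ true))
      (cycAdj-next i j) (cycAdj-next j i))
    (bool (next i == j) (next j == i) (i == j) (j == i) excluded)
    where
    excluded : (i == j) ≡ true → (next i == j) ≡ false × (next j == i) ≡ false
    excluded e with i Fin.≟ j
    ... | yes refl = ==-≢ (next≢ i) , ==-≢ (next≢ i)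
    bool : ∀ A B E E′ → (E ≡ true → A ≡ false × B ≡ false) →
      ((A ∨ (E ∧ false)) ∨ (B ∨ (E′ ∧ false))) ∧ not (E ∧ true) ≡ (A ∧ true) ∨ (B ∧ true)
    bool A B true E′ h with h refl
    bool A B true true  h | refl , refl = refl
    bool A B true false h | refl , refl = refl
    bool true  B     false E′    _ = refl
    bool false true  false E′    _ = refl
    bool false false false true  _ = refl
    bool false false false false _ = refl
  jfAdjPair-step (i , zero) (j , suc b) = bool (i == j) (j == i) (next i == j) (==-sym i j)
    where
    bool : ∀ E E′ A → E ≡ E′ →
      ((E ∧ true) ∨ (E′ ∧ false)) ∧ not (E ∧ false) ≡ (A ∧ false) ∨ (E′ ∧ true)
    bool true  _ true  refl = refl
    bool true  _ false refl = refl
    bool false _ true  refl = refl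
    bool false _ false refl = refl
  jfAdjPair-step (i , suc a) (j , zero) = bool (i == j) (j == i) (next j == i) (==-sym i j)
    where
    bool : ∀ E E′ A → E ≡ E′ →
      ((E ∧ false) ∨ (E′ ∧ true)) ∧ not (E ∧ false) ≡ (E ∧ true) ∨ (A ∧ false)
    bool true  _ true  refl = refl
    bool true  _ false refl = refl
    bool false _ true  refl = refl
    bool false _ false refl = refl
  jfAdjPair-step (i , suc a) (j , suc b) = bool (i == j) (j == i) (same (i , suc a) (j , suc b))
    where
    bool : ∀ E E′ S → ((E ∧ false) ∨ (E′ ∧ false)) ∧ not S ≡ (E ∧ false) ∨ (E′ ∧ false)
    bool true  true  _ = refl
    bool true  false _ = refl
    bool false true  _ = refl
    bool false false _ = refl

  -- The number of forward steps to centre 0. The centre `suc i` has position toℕ i + 1, hence q -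
  -- (toℕ i + 1) = m - toℕ i steps to go.
  level : Fin q → ℕ
  level zero    = 0
  level (suc i) = m ℕ.∸ toℕ i

  height : Vertex → ℕ
  height (i , zero)  = level i
  height (i , suc a) = suc (level i)

  level-next : ∀ i → i ≢ zero → level i ≡ suc (level (next i))
  level-next zero p = ⊥-elim (p refl)
  level-next (suc i) _ with suc (toℕ i) ℕ.≟ m
  ... | yes e = trans (cong (ℕ._∸ toℕ i) (≡-sym e)) (ℕ.m+n∸n≡m 1 (toℕ i))
  ... | no i≢m = trans (≡-sym (ℕ.suc-pred (m ℕ.∸ toℕ i) {{ℕ.>-nonZero (ℕ.m<n⇒0<n∸m (Fin.toℕ<n i))}}))
    (cong suc (trans (ℕ.pred[m∸n]≡m∸[1+n] m (toℕ i))
      (cong (m ℕ.∸_) (≡-sym (Fin.toℕ-lower₁ (suc i) (i≢m ∘ ≡-sym))))))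

  height-step : ∀ x → x ≢ (zero , zero) → height x ≡ suc (height (step x))
  height-step (i , zero) p = level-next i (λ e → p (cong (_, zero) e))
  height-step (i , suc a) p = refl

  structure : Unicyclic (JFG p q)
  structure = record
    { f = f ; root = ι (zero , zero) ; depth = height ∘ π
    ; edges = λ u v → trans (jfAdjPair-step (π u) (π v)) (≡-sym (cong₂ _∨_ (f-same u v) (f-same v u)))
    ; no-2-cycle = λ v e → step-step≢ (π v) (trans (cong step (≡-sym (π-ι (step (π v)))))
        (trans (≡-sym (π-ι (step (π (f v))))) (cong π e)))
    ; depth-root = cong height (π-ι (zero , zero))
    ; depth-parent = λ v v≢root → trans
        (height-step (π v) (λ e → v≢root (trans (≡-sym (ι-π v)) (cong ι e))))
        (cong (suc ∘ height) (≡-sym (π-ι (step (π v)))))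
    }
    where
    step-step≢ : ∀ x → step (step x) ≢ x
    step-step≢ (i , zero) e = next-next≢ 2≤m i (cong proj₁ e)
    step-step≢ (i , suc a) ()

  girth≡q : Unicyclic.girth structure ≡ q
  girth≡q = cong suc (trans (cong height (trans (π-ι (step (π (ι (zero , zero))))) (cong step (π-ι (zero , zero)))))
    (first (next-suc {i = zero {m}} (λ e → ℕ.<-irrefl e (ℕ.<-≤-trans (ℕ.s≤s ℕ.z≤n) 2≤m)))))
    where
    first : (Σ (Fin m) λ j → next zero ≡ suc j × toℕ j ≡ 0) → level (next zero) ≡ m
    first (j , e , e′) = trans (cong level e) (cong (m ℕ.∸_) e′)

  δ-f : ∀ x y → δ (f (ι x)) (ι y) ≡ ⟦ same (step x) y ⟧
  δ-f x y = cong ⟦_⟧ (trans (f-same (ι x) (ι y)) (cong₂ (λ x y → same (step x) y) (π-ι x) (π-ι y)))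

  indegree-leaf : ∀ i a → Unicyclic.indegree structure (ι (i , suc a)) ≡ + 0
  indegree-leaf i a = ∑-zero (λ u → trans (cong (λ w → δ (f w) (ι (i , suc a))) (≡-sym (ι-π u)))
    (trans (δ-f (π u) (i , suc a)) (zero-case (π u))))
    where
    zero-case : ∀ x → ⟦ same (step x) (i , suc a) ⟧ ≡ + 0
    zero-case (j , zero)  = cong ⟦_⟧ (Bool.∧-zeroʳ (next j == i))
    zero-case (j , suc b) = cong ⟦_⟧ (Bool.∧-zeroʳ (j == i))

  indegree-centre : ∀ i → Unicyclic.indegree structure (ι (i , zero)) ≡ + suc p
  indegree-centre i = begin
    ∑ (λ u → δ (f u) (ι (i , zero)))
      ≡⟨ ∑-combine q (suc p) (λ u → δ (f u) (ι (i , zero))) ⟩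
    ∑ (λ j → ∑ (λ b → δ (f (ι (j , b))) (ι (i , zero))))
      ≡⟨ ∑-cong (λ j → cong₂ _+_ (trans (δ-f (j , zero) (i , zero)) (cong ⟦_⟧ (Bool.∧-identityʳ (next j == i))))
           (trans (∑-cong (λ b → trans (δ-f (j , suc b) (i , zero)) (cong ⟦_⟧ (Bool.∧-identityʳ (j == i)))))
             (∑-const {p} (δ j i)))) ⟩
    ∑ (λ j → δ (next j) i + + p * δ j i)
      ≡⟨ ∑-+ (λ j → δ (next j) i) (λ j → + p * δ j i) ⟩
    ∑ (λ j → δ (next j) i) + ∑ (λ j → + p * δ j i)
      ≡⟨ cong₂ _+_ (trans (∑-single {f = λ j → δ (next j) i} (prev i) (λ j j≢ → δ-≢ {i = next j} {i} (λ e → j≢ (trans (≡-sym (prev-next j)) (cong prev e)))))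
             (trans (cong (λ j → δ j i) (next-prev i)) (δ-refl i)))
           (trans (∑-*ˡ (+ p) (λ j → δ j i)) (cong (+ p *_) (trans (∑-single i (λ j j≢i → δ-≢ j≢i)) (δ-refl i)))) ⟩
    + 1 + + p * + 1
      ≡⟨ cong (ℤ._+_ (+ 1)) (ℤ.*-identityʳ (+ p)) ⟩
    + suc p ∎

  indegree-values : ∀ v → Unicyclic.indegree structure v ≡ + 0 ⊎ Unicyclic.indegree structure v ≡ + suc p
  indegree-values v with π v in e
  ... | i , zero = inj₂ (trans (cong (Unicyclic.indegree structure) (trans (≡-sym (ι-π v)) (cong ι e))) (indegree-centre i))
  ... | i , suc a = inj₁ (trans (cong (Unicyclic.indegree structure) (trans (≡-sym (ι-π v)) (cong ι e))) (indegree-leaf i a))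

-- Determination by the spectrum

*-nonneg : ∀ {x y} → + 0 ℤ.≤ x → + 0 ℤ.≤ y → + 0 ℤ.≤ x * y
*-nonneg {+ a} {+ b} _ _ = subst (+ 0 ℤ.≤_) (ℤ.pos-* a b) (ℤ.+≤+ ℕ.z≤n)

square-nonneg : ∀ x → + 0 ℤ.≤ x * x
square-nonneg (+ a)      = *-nonneg (ℤ.+≤+ {n = a} ℕ.z≤n) (ℤ.+≤+ {n = a} ℕ.z≤n)
square-nonneg ℤ.-[1+ a ] = ℤ.+≤+ ℕ.z≤n

module UnicyclicProperties {n} {G : Graph n} (U : Unicyclic G) where

  open Unicyclic U
  open Laplacian G using (a; d; triangles)

  ∑-indegree : ∑ indegree ≡ + n
  ∑-indegree = trans (∑-swap (λ v u → δ (f u) v)) (trans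
    (∑-cong (λ u → trans (∑-single (f u) (λ i i≢ → δ-≢ (i≢ ∘ ≡-sym))) (δ-refl (f u))))
    (trans (∑-const {n} (+ 1)) (ℤ.*-identityʳ (+ n))))

  ∑-d : ∑ d ≡ + n + + n
  ∑-d = trans (∑-cong d-indegree) (trans (∑-+ (λ _ → + 1) indegree)
    (cong₂ _+_ (trans (∑-const {n} (+ 1)) (ℤ.*-identityʳ (+ n))) ∑-indegree))

  indegree-nonneg : ∀ v → + 0 ℤ.≤ indegree v
  indegree-nonneg v = ∑-nonneg (λ u → ⟦⟧-nonneg (f u == v))

  indegree-image : ∀ v → indegree (f v) ≢ + 0
  indegree-image v e with trans (≡-sym (δ-refl (f v))) (∑-nonneg-≡0 (λ u → ⟦⟧-nonneg (f u == f v)) e v)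
  ... | ()

  -- Depth cannot drop three times and return to its value, so the root is among the three vertices;
  -- then `c 3` is `c 0`, which injectivity forbids for a longer cycle.
  rotation⇒girth≡3 : ∀ v → f (f (f v)) ≡ v → girth ≡ 3
  rotation⇒girth≡3 v e = go (v Fin.≟ root) (f v Fin.≟ root) (f (f v) Fin.≟ root)
    where
    at-root : f (f (f root)) ≡ root → girth ≡ 3
    at-root e = ℕ.≤-antisym (ℕ.≮⇒≥ λ 3<g → absurd (c-injective-ℕ {3} {0} 3<g (ℕ.s≤s ℕ.z≤n) e)) 3≤girth
      where
      absurd : 3 ≢ 0
      absurd ()
    go : Dec (v ≡ root) → Dec (f v ≡ root) → Dec (f (f v) ≡ root) → girth ≡ 3
    go (yes p) _ _ = at-root (subst (λ w → f (f (f w)) ≡ w) p e)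
    go (no _) (yes p) _ = at-root (subst (λ w → f (f (f w)) ≡ w) p (cong f e))
    go (no _) (no _) (yes p) = at-root (subst (λ w → f (f (f w)) ≡ w) p (cong (f ∘ f) e))
    go (no p) (no q) (no r) = ⊥-elim (ℕ.m≢1+n+m (depth v) {2} (trans (depth-parent v p)
      (cong suc (trans (depth-parent (f v) q) (cong suc (trans (depth-parent (f (f v)) r) (cong (suc ∘ depth) e)))))))

  adjacent : ∀ u v → adj G u v ≡ true → f u ≡ v ⊎ f v ≡ u
  adjacent u v e with f u Fin.≟ v | f v Fin.≟ u | trans (≡-sym e) (edges u v)
  ... | yes p | _     | _ = inj₁ p
  ... | no _  | yes p | _ = inj₂ p
  ... | no _  | no _  | ()

  distinct : ∀ {u v} → adj G u v ≡ true → u ≢ v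
  distinct {u} e refl = true≢false (trans (≡-sym e) (irrefl G u))

  -- Each edge is directed by `f` and each vertex has only one outgoing edge, so a triangle is
  -- directed cyclically.
  triangle⇒girth≡3 : ∀ i j k → adj G i j ≡ true → adj G j k ≡ true → adj G k i ≡ true → girth ≡ 3
  triangle⇒girth≡3 i j k ij jk ki with adjacent i j ij | adjacent j k jk | adjacent k i ki
  ... | inj₁ p | inj₁ q | inj₁ r = rotation⇒girth≡3 i (trans (cong (f ∘ f) p) (trans (cong f q) r))
  ... | inj₁ p | _      | inj₂ r = ⊥-elim (distinct jk (trans (≡-sym p) r))
  ... | inj₁ p | inj₂ q | inj₁ r = ⊥-elim (distinct ij (trans (≡-sym r) q))
  ... | inj₂ p | inj₁ q | _      = ⊥-elim (distinct ki (trans (≡-sym q) p))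
  ... | inj₂ p | inj₂ q | inj₁ r = ⊥-elim (distinct ij (trans (≡-sym r) q))
  ... | inj₂ p | inj₂ q | inj₂ r = rotation⇒girth≡3 i (trans (cong (f ∘ f) r) (trans (cong f q) p))

  triangles≡0 : girth ≢ 3 → triangles ≡ + 0
  triangles≡0 g≢3 = ∑-zero (λ i → ∑-zero (λ j → trans (≡-sym (∑-*ˡ (a i j) (λ k → a j k * a k i)))
    (∑-zero (λ k → none i j k))))
    where
    none : ∀ i j k → a i j * (a j k * a k i) ≡ + 0
    none i j k with adj G i j in ij | adj G j k in jk | adj G k i in ki
    ... | true  | true  | true  = ⊥-elim (g≢3 (triangle⇒girth≡3 i j k ij jk ki))
    ... | true  | true  | false = refl
    ... | true  | false | true  = refl
    ... | true  | false | false = refl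
    ... | false | true  | true  = refl
    ... | false | true  | false = refl
    ... | false | false | true  = refl
    ... | false | false | false = refl

-- nonnegative for d ≥ 1, and zero exactly when d ∈ {1 , e}
cubic : ℤ → ℤ → ℤ
cubic e d = (d - + 1) * ((d - e) * (d - e))

-- The sum depends only on n and the first three degree moments, which the spectrum fixes once
-- triangles are absent.
∑-cubic : (G : Graph n) → ∀ e →
  let d = Laplacian.d G in
  ∑ (λ i → cubic e (d i)) ≡ ∑ (λ i → d i * d i * d i)
    + (- (+ 2 * e + + 1) * ∑ (λ i → d i * d i) + ((e * e + + 2 * e) * ∑ d + + n * - (e * e)))
∑-cubic {n} G e = begin
  ∑ (λ i → cubic e (d i))
    ≡⟨ ∑-cong (λ i → ring (d i) e) ⟩
  ∑ (λ i → d i * d i * d i + (- (+ 2 * e + + 1) * (d i * d i) + ((e * e + + 2 * e) * d i + - (e * e))))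
    ≡⟨ ∑-+ (λ i → d i * d i * d i) (λ i → - (+ 2 * e + + 1) * (d i * d i) + ((e * e + + 2 * e) * d i + - (e * e))) ⟩
  ∑ (λ i → d i * d i * d i) + ∑ (λ i → - (+ 2 * e + + 1) * (d i * d i) + ((e * e + + 2 * e) * d i + - (e * e)))
    ≡⟨ cong (ℤ._+_ (∑ (λ i → d i * d i * d i))) (trans
         (∑-+ (λ i → - (+ 2 * e + + 1) * (d i * d i)) (λ i → (e * e + + 2 * e) * d i + - (e * e)))
         (cong₂ _+_ (∑-*ˡ (- (+ 2 * e + + 1)) (λ i → d i * d i))
           (trans (∑-+ (λ i → (e * e + + 2 * e) * d i) (λ _ → - (e * e)))
             (cong₂ _+_ (∑-*ˡ (e * e + + 2 * e) d) (∑-const {n} (- (e * e))))))) ⟩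
  _ ∎
  where
  open Laplacian G
  ring : ∀ d e → (d - + 1) * ((d - e) * (d - e)) ≡
    d * d * d + (- (+ 2 * e + + 1) * (d * d) + ((e * e + + 2 * e) * d + - (e * e)))
  ring = solve-∀

-- Reconstructing the jellyfish graph

enumerate : (χ : Fin n → Bool) → Σ (Fin (count χ) → Fin n) λ e →
  (∀ {a b} → e a ≡ e b → a ≡ b) × (∀ a → χ (e a) ≡ true)
enumerate {zero} χ = (λ ()) , (λ { {()} }) , λ ()
enumerate {suc n} χ with χ zero in χ0 | enumerate (χ ∘ suc)
... | true | e , inj , sound = e′ , inj′ , sound′
  where
  e′ : Fin (suc (count (χ ∘ suc))) → Fin (suc n)
  e′ zero    = zero
  e′ (suc a) = suc (e a)
  inj′ : ∀ {a b} → e′ a ≡ e′ b → a ≡ b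
  inj′ {zero}  {zero}  _ = refl
  inj′ {suc a} {suc b} p = cong suc (inj (Fin.suc-injective p))
  sound′ : ∀ a → χ (e′ a) ≡ true
  sound′ zero    = χ0
  sound′ (suc a) = sound a
... | false | e , inj , sound = suc ∘ e , inj ∘ Fin.suc-injective , sound

injective⇒surjective : (g : Fin n → Fin n) → (∀ {a b} → g a ≡ g b → a ≡ b) → ∀ y → Σ (Fin n) λ x → g x ≡ y
injective⇒surjective {suc n} g inj y with Fin.any? (λ x → g x Fin.≟ y)
... | yes p = p
... | no ∄ = ⊥-elim (collision (Fin.pigeonhole (ℕ.n<1+n n) (λ x → punchOut (y≢ x))))
  where
  y≢ : ∀ x → y ≢ g x
  y≢ x e = ∄ (x , ≡-sym e)
  collision : ¬ (∃₂ λ a b → a Fin.< b × punchOut (y≢ a) ≡ punchOut (y≢ b))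
  collision (a , b , a<b , e) = Fin.<⇒≢ a<b (inj (Fin.punchOut-injective (y≢ a) (y≢ b) e))

-- Adjacency is a formula in `f`, so an injection commuting with the two functions preserves and
-- reflects it; equal orders make it bijective.
conjugate⇒Iso : {G : Graph n} {H : Graph m} (U : Unicyclic G) (V : Unicyclic H) → m ≡ n →
  (φ : Fin n → Fin m) → (∀ {a b} → φ a ≡ φ b → a ≡ b) →
  (∀ v → Unicyclic.f V (φ v) ≡ φ (Unicyclic.f U v)) → Iso G H
conjugate⇒Iso {n} {G = G} {H} U V refl φ inj comm =
  mk↔ₛ′ φ ψ φ-ψ (λ x → inj (φ-ψ (φ x))) , λ i j → trans (U.edges i j)
    (trans (cong₂ _∨_ (image i j) (image j i)) (≡-sym (V.edges (φ i) (φ j))))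
  where
  module U = Unicyclic U
  module V = Unicyclic V
  ψ : Fin n → Fin n
  ψ y = proj₁ (injective⇒surjective φ inj y)
  φ-ψ : ∀ y → φ (ψ y) ≡ y
  φ-ψ y = proj₂ (injective⇒surjective φ inj y)
  image : ∀ i j → (U.f i == j) ≡ (V.f (φ i) == φ j)
  image i j = ≟-cases (U.f i) j
    (λ e → trans (==-≡ e) (≡-sym (==-≡ (trans (comm i) (cong φ e)))))
    (λ e → trans (==-≢ e) (≡-sym (==-≢ (λ e′ → e (inj (trans (≡-sym (comm i)) e′))))))

Iso-sym : (G : Graph n) (H : Graph m) → Iso G H → Iso H G
Iso-sym G H (σ , p) = ↔-sym σ , λ i j →
  ≡-sym (trans (p (from i) (from j)) (cong₂ (adj H) (strictlyInverseˡ i) (strictlyInverseˡ j)))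
  where open Inverse σ

Iso-trans : ∀ {k} (G : Graph n) (H : Graph m) (K : Graph k) → Iso G H → Iso H K → Iso G K
Iso-trans G H K (σ , p) (τ , q) = ↔-trans σ τ , λ i j →
  trans (p i j) (q (Inverse.to σ i) (Inverse.to σ j))

-- Every vertex has degree 1 or p + 2, and the cycle has length q: the q centres and their p leaves
-- each already make up all n = q (p + 1) vertices.
module FromIndegrees (p m : ℕ) (2≤m : 2 ℕ.≤ m) {H : Graph n} (U : Unicyclic H)
  (girth≡q : Unicyclic.girth U ≡ suc m) (n≡ : n ≡ suc m ℕ.* suc p)
  (values : ∀ v → Unicyclic.indegree U v ≡ + 0 ⊎ Unicyclic.indegree U v ≡ + suc p) where

  open Unicyclic U
  open UnicyclicProperties U
  open Jellyfish p m 2≤m using (q; Vertex; π; ι; π-ι; ι-π; step; structure)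

  centre : Fin q → Fin n
  centre i = c (toℕ i)

  f-centre : ∀ i → f (centre i) ≡ centre (next i)
  f-centre i with toℕ i ℕ.≟ m
  ... | yes e = trans (cong (c ∘ suc) e) (trans (cong c (≡-sym girth≡q)) c-girth)
  ... | no i≢m = cong (c ∘ suc) (≡-sym (Fin.toℕ-lower₁ i (i≢m ∘ ≡-sym)))

  f-prev : ∀ i → f (centre (prev i)) ≡ centre i
  f-prev i = trans (f-centre (prev i)) (cong centre (next-prev i))

  i<girth : ∀ (i : Fin q) → toℕ i ℕ.< girth
  i<girth i = subst (toℕ i ℕ.<_) (≡-sym girth≡q) (Fin.toℕ<n i)

  centre-injective : ∀ {i j} → centre i ≡ centre j → i ≡ j
  centre-injective {i} {j} e = Fin.toℕ-injective (c-injective-ℕ (i<girth i) (i<girth j) e)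

  -- A cycle vertex has its predecessor as a preimage, which excludes indegree 0.
  indegree-centre : ∀ i → indegree (centre i) ≡ + suc p
  indegree-centre i with values (centre i)
  ... | inj₁ e = ⊥-elim (indegree-image (centre (prev i)) (trans (cong indegree (f-prev i)) e))
  ... | inj₂ e = e

  -- Nothing here prevents such a vertex from having children of its own; that is excluded only when
  -- these vertices and the centres turn out to exhaust the graph.
  isLeaf : Fin q → Fin n → Bool
  isLeaf i u = (f u == centre i) ∧ not (u == centre (prev i))

  isLeaf⇒ : ∀ i u → isLeaf i u ≡ true → f u ≡ centre i × u ≢ centre (prev i)
  isLeaf⇒ i u e with f u Fin.≟ centre i | u Fin.≟ centre (prev i)
  ... | yes x | no y = x , y
  isLeaf⇒ i u () | yes _ | yes _
  isLeaf⇒ i u () | no _  | _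

  count-leaves : ∀ i → count (isLeaf i) ≡ p
  count-leaves i = ℤ.+-injective (begin
    + count (isLeaf i)
      ≡⟨ count-∑ (isLeaf i) ⟩
    ∑ (λ u → ⟦ isLeaf i u ⟧)
      ≡⟨ ∑-cong entry ⟩
    ∑ (λ u → δ (f u) (centre i) - δ u (centre (prev i)))
      ≡⟨ ∑-- (λ u → δ (f u) (centre i)) (λ u → δ u (centre (prev i))) ⟩
    indegree (centre i) - ∑ (λ u → δ u (centre (prev i)))
      ≡⟨ cong₂ _-_ (indegree-centre i)
           (trans (∑-single {f = λ u → δ u (centre (prev i))} (centre (prev i)) (λ u u≢ → δ-≢ u≢)) (δ-refl (centre (prev i)))) ⟩
    + p ∎)
    where
    entry : ∀ u → ⟦ isLeaf i u ⟧ ≡ δ (f u) (centre i) - δ u (centre (prev i))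
    entry u with u Fin.≟ centre (prev i)
    ... | yes refl rewrite ==-≡ (f-prev i) = refl
    ... | no _ with f u == centre i
    ...   | true  = refl
    ...   | false = refl

  leaves : ∀ i → Σ (Fin p → Fin n) λ e → (∀ {a b} → e a ≡ e b → a ≡ b) × (∀ a → isLeaf i (e a) ≡ true)
  leaves i = subst (λ k → Σ (Fin k → Fin n) λ e → (∀ {a b} → e a ≡ e b → a ≡ b) × (∀ a → isLeaf i (e a) ≡ true))
    (count-leaves i) (enumerate (isLeaf i))

  leaf : Fin q → Fin p → Fin n
  leaf i = proj₁ (leaves i)

  f-leaf : ∀ i a → f (leaf i a) ≡ centre i
  f-leaf i a = proj₁ (isLeaf⇒ i (leaf i a) (proj₂ (proj₂ (leaves i)) a))

  leaf≢centre : ∀ i a j → leaf i a ≢ centre j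
  leaf≢centre i a j e = proj₂ (isLeaf⇒ i (leaf i a) (proj₂ (proj₂ (leaves i)) a))
    (trans e (cong centre (trans (≡-sym (prev-next j)) (cong prev next-j≡i))))
    where
    next-j≡i : next j ≡ i
    next-j≡i = centre-injective (trans (≡-sym (f-centre j)) (trans (cong f (≡-sym e)) (f-leaf i a)))

  φ : Vertex → Fin n
  φ (i , zero)  = centre i
  φ (i , suc a) = leaf i a

  f-φ : ∀ x → f (φ x) ≡ φ (step x)
  f-φ (i , zero)  = f-centre i
  f-φ (i , suc a) = f-leaf i a

  φ-injective : ∀ x y → φ x ≡ φ y → x ≡ y
  φ-injective (i , zero)  (j , zero)  e = cong (_, zero) (centre-injective e)
  φ-injective (i , zero)  (j , suc b) e = ⊥-elim (leaf≢centre j b i (≡-sym e))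
  φ-injective (i , suc a) (j , zero)  e = ⊥-elim (leaf≢centre i a j e)
  φ-injective (i , suc a) (j , suc b) e
    with centre-injective {i} {j} (trans (≡-sym (f-leaf i a)) (trans (cong f e) (f-leaf j b)))
  ... | refl = cong (λ a → i , suc a) (proj₁ (proj₂ (leaves i)) e)

  iso : Iso (JFG p q) H
  iso = conjugate⇒Iso structure U n≡ (φ ∘ π)
    (λ {u} {v} e → trans (≡-sym (ι-π u)) (trans (cong ι (φ-injective (π u) (π v) e)) (ι-π v)))
    (λ v → trans (f-φ (π v)) (cong φ (≡-sym (π-ι (step (π v))))))

-- Stated for an abstract graph 𝐉 of abstract order N because det would unfold at the
-- order suc m * suc p.
module Determination (p m : ℕ) (2≤m : 2 ℕ.≤ m) (even : 2 ℕ.∣ suc m)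
  {N} {𝐉 : Graph N} (V : Unicyclic 𝐉) (N≡ : N ≡ suc m ℕ.* suc p) (girth-𝐉 : Unicyclic.girth V ≡ suc m)
  (indegree-𝐉 : ∀ v → Unicyclic.indegree V v ≡ + 0 ⊎ Unicyclic.indegree V v ≡ + suc p)
  {n} {H : Graph n} (co : LCospectral H 𝐉) where

  open Laplacian using (d; bordered; triangles)

  module V = Unicyclic V
  module VP = UnicyclicProperties V

  n≡N : n ≡ N
  n≡N = proj₁ (LCospectral⇒pencil H 𝐉 co)

  open SameMoments (LCospectral⇒SameMoments H 𝐉 co)

  ∣det-𝐉∣ : ∣ det (bordered 𝐉 V.root) ∣ ≡ suc m ℕ.* N
  ∣det-𝐉∣ = trans V.∣det-bordered∣ (cong (ℕ._* N) girth-𝐉)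

  det-H≢0 : ∀ r → det (bordered H r) ≢ + 0
  det-H≢0 r e = positive (trans (cong (suc m ℕ.*_) (≡-sym N≡)) (trans (≡-sym ∣det-𝐉∣)
    (cong ∣_∣ (trans (≡-sym (LCospectral⇒bordered H 𝐉 co r V.root)) e))))
    where
    positive : suc m ℕ.* (suc m ℕ.* suc p) ≢ 0
    positive ()

  -- Opaque, so that the spanning-tree construction does not unfold in the statements about `U`.
  abstract
    U : Unicyclic H
    U = unicyclic H (trans moment₁ (trans VP.∑-d (cong (λ k → + k + + k) (≡-sym n≡N))))
      (subst Fin (≡-sym (trans n≡N N≡)) zero) det-H≢0

  module U = Unicyclic U
  module UP = UnicyclicProperties U

  girth-H : U.girth ≡ suc m
  girth-H = ℕ.*-cancelʳ-≡ U.girth (suc m) (suc m ℕ.* suc p) (subst (λ k → U.girth ℕ.* k ≡ suc m ℕ.* k) N≡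
    (trans (cong (U.girth ℕ.*_) (≡-sym n≡N)) (trans (≡-sym U.∣det-bordered∣)
      (trans (cong ∣_∣ (LCospectral⇒bordered H 𝐉 co U.root V.root)) ∣det-𝐉∣))))

  q≢3 : suc m ≢ 3
  q≢3 e = odd (subst (2 ℕ.∣_) e even)
    where
    odd : ¬ (2 ℕ.∣ 3)
    odd (ℕ.divides (suc (suc _)) ())

  -- The degree p + 2 of a jellyfish centre, written as 1 plus its indegree so that the cubic
  -- becomes k (k - (p + 1))² in the indegree k.
  e : ℤ
  e = + 1 + + suc p

  cubic-indegree : ∀ k → cubic e (+ 1 + k) ≡ k * ((k - + suc p) * (k - + suc p))
  cubic-indegree k = ring k (+ suc p)
    where
    ring : ∀ k c → (+ 1 + k - + 1) * ((+ 1 + k - (+ 1 + c)) * (+ 1 + k - (+ 1 + c))) ≡ k * ((k - c) * (k - c))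
    ring = solve-∀

  no-triangles : triangles H ≡ + 0 × triangles 𝐉 ≡ + 0
  no-triangles = UP.triangles≡0 (λ g → q≢3 (trans (≡-sym girth-H) g)) ,
    VP.triangles≡0 (λ g → q≢3 (trans (≡-sym girth-𝐉) g))

  cubes : ∑ (λ i → d H i * d H i * d H i) ≡ ∑ (λ i → d 𝐉 i * d 𝐉 i * d 𝐉 i)
  cubes = trans (≡-sym (ℤ.+-identityʳ _)) (trans
    (cong (λ t → ∑ (λ i → d H i * d H i * d H i) - t) (≡-sym (proj₁ no-triangles)))
    (trans moment₃ (trans (cong (λ t → ∑ (λ i → d 𝐉 i * d 𝐉 i * d 𝐉 i) - t) (proj₂ no-triangles)) (ℤ.+-identityʳ _))))

  ∑-cubic-H : ∑ (λ i → cubic e (d H i)) ≡ + 0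
  ∑-cubic-H = trans (∑-cubic H e) (trans
    (cong₂ _+_ cubes (cong₂ _+_ (cong (- (+ 2 * e + + 1) *_) moment₂)
      (cong₂ _+_ (cong ((e * e + + 2 * e) *_) moment₁) (cong (λ k → + k * - (e * e)) n≡N))))
    (trans (≡-sym (∑-cubic 𝐉 e)) (∑-zero (λ v → trans (cong (cubic e) (V.d-indegree v))
      (trans (cubic-indegree (V.indegree v)) (zero-case (V.indegree v) (indegree-𝐉 v)))))))
    where
    ring : ∀ c → c * ((c - c) * (c - c)) ≡ + 0
    ring c = trans (cong (λ x → c * (x * x)) (-≡0 c)) (ℤ.*-zeroʳ c)
    zero-case : ∀ k → k ≡ + 0 ⊎ k ≡ + suc p → k * ((k - + suc p) * (k - + suc p)) ≡ + 0
    zero-case k (inj₁ refl) = refl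
    zero-case k (inj₂ refl) = ring (+ suc p)

  indegree-H : ∀ v → U.indegree v ≡ + 0 ⊎ U.indegree v ≡ + suc p
  indegree-H v = roots (U.indegree v) (∑-nonneg-≡0
    (λ v → *-nonneg (UP.indegree-nonneg v) (square-nonneg (U.indegree v - + suc p)))
    (trans (∑-cong (λ v → trans (≡-sym (cubic-indegree (U.indegree v))) (cong (cubic e) (≡-sym (U.d-indegree v))))) ∑-cubic-H) v)
    where
    roots : ∀ k → k * ((k - + suc p) * (k - + suc p)) ≡ + 0 → k ≡ + 0 ⊎ k ≡ + suc p
    roots k k≡ with ℤ.i*j≡0⇒i≡0∨j≡0 k k≡
    ... | inj₁ k≡0 = inj₁ k≡0
    ... | inj₂ square≡0 with ℤ.i*j≡0⇒i≡0∨j≡0 (k - + suc p) square≡0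
    ...   | inj₁ k≡c = inj₂ (ℤ.i-j≡0⇒i≡j k (+ suc p) k≡c)
    ...   | inj₂ k≡c = inj₂ (ℤ.i-j≡0⇒i≡j k (+ suc p) k≡c)

  iso : Iso (JFG p (suc m)) H
  iso = FromIndegrees.iso p m 2≤m U girth-H (trans n≡N N≡) indegree-H

theorem3p3 : ∀ (p q : ℕ) → 1 ≤ p → 3 ≤ q → 2 ℕ.∣ q →
    ∀ (n : ℕ) (H : Graph n) → LCospectral H (JFG p q) → DLS H
theorem3p3 p (suc m) _ (ℕ.s≤s 2≤m) even n H coH k K coK =
  Iso-trans K (JFG p (suc m)) H (Iso-sym (JFG p (suc m)) K (determined K (λ t → trans (coK t) (coH t)))) (determined H coH)
  where
  open Jellyfish p m 2≤m
  determined : ∀ {k} (K : Graph k) → LCospectral K (JFG p (suc m)) → Iso (JFG p (suc m)) K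
  determined K co = Determination.iso p m 2≤m even structure refl girth≡q indegree-values {H = K} co
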